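{- Let $(a_n)_{n\ge0}$ be the sequence, listed in increasing order, of the non-negative integers $m$ such that $840m+169$ is a perfect square. Define $t(n)=0$ if $n\equiv 0,1,2,4,11,13,14,15 \pmod{16}$ and $t(n)=1$ otherwise. Then $$\sum_{n=0}^\infty(-1)^{t(n)}q^{a_n}=\frac{(q^3,q^4,q^7;q^7)_\infty}{(q^2,q^3;q^5)_\infty}.$$
   Context: Here $q$ is a complex number with $|q|<1$ (equivalently, the identity may be read as an identity of formal power series in $q$). For a complex number $a$, $(a;q)_\infty:=\prod_{i=0}^\infty(1-aq^i)$, and $(a_1,a_2,\dots,a_m;q)_\infty:=\prod_{j=1}^m(a_j;q)_\infty$. -}

module Defs where

open import Data.Nat as ℕ using (ℕ; zero; suc; _∸_; _%_; _<_)
open import Data.Nat.Divisibility using (_∣?_)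
open import Data.Integer as ℤ using (ℤ; +_; -_; _*_; _+_)
open import Data.Bool using (Bool; true; false; if_then_else_)
open import Data.Product using (∃)
open import Relation.Binary.PropositionalEquality using (_≡_)
open import Relation.Nullary.Decidable using (does)

-- Formal power series in q with integer coefficients: coefficient functions.
Series : Set
Series = ℕ → ℤ

sumBelow : ℕ → (ℕ → ℤ) → ℤ
sumBelow zero    f = + 0
sumBelow (suc n) f = sumBelow n f + f n

_⊛_ : Series → Series → Series
(f ⊛ g) N = sumBelow (suc N) (λ i → f i * g (N ∸ i))
infixl 7 _⊛_

oneS : Series
oneS zero    = + 1
oneS (suc _) = + 0

oneMinusQ^ : ℕ → Series
oneMinusQ^ k N = (if does (N ℕ.≟ 0) then + 1 else + 0)
               + (if does (N ℕ.≟ k) then - (+ 1) else + 0)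

-- the series 1/(1 - q^k) = Σ_j q^{jk}   (used only with k ≥ 1)
invOneMinusQ^ : ℕ → Series
invOneMinusQ^ k N = if does (k ∣? N) then + 1 else + 0

prodBelow : (ℕ → Series) → ℕ → Series
prodBelow F zero    = oneS
prodBelow F (suc n) = prodBelow F n ⊛ F n

-- Infinite product ∏_{i≥0} F i, for factors with F i ≡ 1 mod q^{i+1}:
-- its q^N-coefficient is that of the finite product over i ≤ N.
infProd : (ℕ → Series) → Series
infProd F N = prodBelow F (suc N) N

poch : ℕ → ℕ → Series
poch c d = infProd (λ i → oneMinusQ^ (c ℕ.+ d ℕ.* i))

invPoch : ℕ → ℕ → Series
invPoch c d = infProd (λ i → invOneMinusQ^ (c ℕ.+ d ℕ.* i))

IsSquare : ℕ → Set
IsSquare x = ∃ λ k → k ℕ.* k ≡ x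

tZero : ℕ → Bool
tZero 0  = true
tZero 1  = true
tZero 2  = true
tZero 4  = true
tZero 11 = true
tZero 13 = true
tZero 14 = true
tZero 15 = true
tZero _  = false

t : ℕ → ℕ
t n = if tZero (n % 16) then 0 else 1

sgn : ℕ → ℤ
sgn n = if tZero (n % 16) then + 1 else - (+ 1)

-- Σ_n (-1)^{t(n)} q^{a n}, for a strictly increasing (so a n ≥ n and the
-- q^N coefficient only involves n ≤ N).
lhsSeries : (ℕ → ℕ) → Series
lhsSeries a N = sumBelow (suc N) (λ n → if does (a n ℕ.≟ N) then sgn n else + 0)

rhsSeries : Series
rhsSeries = poch 3 7 ⊛ poch 4 7 ⊛ poch 7 7 ⊛ invPoch 2 5 ⊛ invPoch 3 5

{-# OPTIONS --safe #-}
-- Since 1/(q²,q³;q⁵) = (q,q⁴,q⁵;q⁵)/(q;q), the claim is E L = T₇ T₅ with E = (q;q), L the left-hand side,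
-- T₇ = (q³,q⁴,q⁷;q⁷) and T₅ = (q,q⁴,q⁵;q⁵). By the Jacobi triple product E, T₇ and T₅ are theta series in
-- x² = 24 e + 1, u² = 56 e + 1 and v² = 40 e + 9, and so is L in y² = 840 e + 169, with signs that are periodic
-- in x, u, v, y. Both sides are thus signed counts of the solutions of 35 x² + y² = 840 N + 204 and of
-- 15 u² + 21 v² = 840 N + 204. The substitution x = (u + v)/2, y = (5u - 7v)/2 identifies the two forms, and in the
-- coordinates (u , x) both counts are sums of the same function K(u , x), over x prime to 6 and over odd u and odd x.
-- The terms with u even cancel under v ↦ - v, and those with x = 3z, z odd, under u ↦ 7z - u.
module Submission where

open import Defs
open import Data.Nat as ℕ using (ℕ; zero; suc; z≤n; s≤s; NonZero)
import Data.Nat.Properties as ℕ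
open import Data.Nat.DivMod using (_/_; _%_; m≡m%n+[m/n]*n; m%n<n; /-monoˡ-≤; [m+kn]%n≡m%n; m<n⇒m%n≡m; +-distrib-/-∣ʳ; m<n⇒m/n≡0; m*n/n≡m)
open import Data.Nat.Divisibility using (_∣_; _∣?_; divides; ∣m+n∣m⇒∣n; ∣m∣n⇒∣m+n; ∣-refl; ∣⇒≤; _∣0; n∣m*n)
import Data.Nat.Tactic.RingSolver as ℕ-Ring
open import Data.Integer as ℤ using (ℤ; +_; -[1+_]; -_; _+_; _*_; _-_; _⊖_; ∣_∣; 0ℤ; 1ℤ; -1ℤ)
import Data.Integer.Properties as ℤ
open import Data.Integer.DivMod using (_%ℕ_; _/ℕ_; n%ℕd<d; a≡a%ℕn+[a/ℕn]*n)
open import Data.Integer.Tactic.RingSolver using (solve-∀)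
open import Algebra.Bundles using (AbelianGroup; CommutativeMonoid)
import Algebra.Properties.Group (AbelianGroup.group ℤ.+-0-abelianGroup) as +ℤ
open import Data.Bool using (if_then_else_)
open import Data.Product using (∃; _×_; _,_; proj₁; proj₂)
open import Data.Sum using (_⊎_; inj₁; inj₂)
open import Data.Unit using (tt)
open import Function using (_∘_)
open import Function.Bundles using (_⇔_; Equivalence)
open import Relation.Binary.Definitions using (tri<; tri≈; tri>)
open import Relation.Binary.PropositionalEquality
open import Relation.Nullary using (Dec; yes; no; does; ¬_; contradiction)
open import Relation.Nullary.Decidable using (True; toWitness; _→-dec_; _⊎-dec_; _×-dec_; ¬?)

-- Finite sums

-- The constant 204 and the two forms come from 35 (24e + 1) + (840f + 169) = 15 (56e + 1) + 21 (40f
-- + 9) = 840 (e + f) + 204. The substitution has determinant - 3, so the supports of the two signed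
-- counts cannot correspond point by point: x and y must be prime to 3, while nothing modulo 3 is
-- asked of u or v. Hence K is defined on all pairs (u , x), and the surplus on each side has to
-- cancel. On the line x = 3z the common form is 36 (u² - 7uz + 21z²), whose symmetry in u is u ↦ 7z
-- - u. The signs match because y ≡ - v modulo 5 and y ≡ - u modulo 7, where the sign functions are
-- odd, and because the products of the characters modulo 4 and 12 depend only on the parity of u
-- and on conditions on x modulo 6 and on u - x modulo 2. Everything is done for one coefficient at
-- a time, with finite sums over symmetric intervals of integers. The exponents and weights are even
-- in x, y, u, v, so each theta series is doubled in order to sum over both signs of its variable,
-- and four times the coefficients are compared.

sum-cong : ∀ n {f g} → (∀ i → i ℕ.< n → f i ≡ g i) → sumBelow n f ≡ sumBelow n g
sum-cong zero    eq = refl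
sum-cong (suc n) eq = cong₂ _+_ (sum-cong n (λ i i<n → eq i (ℕ.m<n⇒m<1+n i<n))) (eq n (ℕ.n<1+n n))

sum-zero : ∀ n {f} → (∀ i → i ℕ.< n → f i ≡ 0ℤ) → sumBelow n f ≡ 0ℤ
sum-zero zero    eq = refl
sum-zero (suc n) eq = cong₂ _+_ (sum-zero n (λ i i<n → eq i (ℕ.m<n⇒m<1+n i<n))) (eq n (ℕ.n<1+n n))

+-interchange : ∀ a b c d → (a + b) + (c + d) ≡ (a + c) + (b + d)
+-interchange = solve-∀

x+x≡2x : ∀ x → x + x ≡ + 2 * x
x+x≡2x = solve-∀

x-y+y≡x : ∀ x y → x - y + y ≡ x
x-y+y≡x = solve-∀

x+y-y≡x : ∀ x y → x + y - y ≡ x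
x+y-y≡x = solve-∀

neg-square : ∀ x → (- x) * (- x) ≡ x * x
neg-square = solve-∀

sum-+ : ∀ n f g → sumBelow n (λ i → f i + g i) ≡ sumBelow n f + sumBelow n g
sum-+ zero    f g = refl
sum-+ (suc n) f g = trans (cong (_+ (f n + g n)) (sum-+ n f g)) (+-interchange (sumBelow n f) (sumBelow n g) (f n) (g n))

sum-*ˡ : ∀ n c f → sumBelow n (λ i → c * f i) ≡ c * sumBelow n f
sum-*ˡ zero    c f = sym (ℤ.*-zeroʳ c)
sum-*ˡ (suc n) c f = trans (cong (_+ c * f n) (sum-*ˡ n c f)) (sym (ℤ.*-distribˡ-+ c (sumBelow n f) (f n)))

sum-*ʳ : ∀ n c f → sumBelow n (λ i → f i * c) ≡ sumBelow n f * c
sum-*ʳ n c f = trans (sum-cong n (λ i _ → ℤ.*-comm (f i) c)) (trans (sum-*ˡ n c f) (ℤ.*-comm c (sumBelow n f)))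

sum-swap : ∀ n m (f : ℕ → ℕ → ℤ) →
  sumBelow n (λ i → sumBelow m (f i)) ≡ sumBelow m (λ j → sumBelow n (λ i → f i j))
sum-swap zero    m f = sym (sum-zero m (λ _ _ → refl))
sum-swap (suc n) m f = trans (cong (_+ sumBelow m (f n)) (sum-swap n m f))
  (sym (sum-+ m (λ j → sumBelow n (λ i → f i j)) (f n)))

sum-head : ∀ n f → sumBelow (suc n) f ≡ f 0 + sumBelow n (f ∘ suc)
sum-head zero    f = ℤ.+-comm 0ℤ (f 0)
sum-head (suc n) f = trans (cong (_+ f (suc n)) (sum-head n f)) (ℤ.+-assoc (f 0) (sumBelow n (f ∘ suc)) (f (suc n)))

sum-single : ∀ n k f → k ℕ.< n → (∀ i → i ℕ.< n → i ≢ k → f i ≡ 0ℤ) → sumBelow n f ≡ f k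
sum-single (suc n) k f k<1+n others with k ℕ.≟ n
... | yes refl = trans
  (cong (_+ f n) (sum-zero n (λ i i<n → others i (ℕ.m<n⇒m<1+n i<n) (ℕ.<⇒≢ i<n))))
  (ℤ.+-identityˡ (f n))
... | no k≢n = trans
  (cong₂ _+_ (sum-single n k f (ℕ.≤∧≢⇒< (ℕ.≤-pred k<1+n) k≢n) (λ i i<n → others i (ℕ.m<n⇒m<1+n i<n)))
             (others n (ℕ.n<1+n n) (k≢n ∘ sym)))
  (ℤ.+-identityʳ (f k))

𝟙 : {P : Set} → Dec P → ℤ
𝟙 P? = if does P? then 1ℤ else 0ℤ

𝟙-yes : {P : Set} (P? : Dec P) → P → 𝟙 P? ≡ 1ℤ
𝟙-yes (yes _) _ = refl
𝟙-yes (no ¬p) p = contradiction p ¬p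

𝟙-no : {P : Set} (P? : Dec P) → ¬ P → 𝟙 P? ≡ 0ℤ
𝟙-no (yes p) ¬p = contradiction p ¬p
𝟙-no (no _)  _  = refl

𝟙≢0 : {P : Set} (P? : Dec P) → 𝟙 P? ≢ 0ℤ → P
𝟙≢0 (yes p) _ = p
𝟙≢0 (no _)  n = contradiction refl n

𝟙-cong : {P Q : Set} (P? : Dec P) (Q? : Dec Q) → (P → Q) → (Q → P) → 𝟙 P? ≡ 𝟙 Q?
𝟙-cong (yes p) Q? f _ = sym (𝟙-yes Q? (f p))
𝟙-cong (no ¬p) Q? _ g = sym (𝟙-no Q? (¬p ∘ g))

*-≢0ˡ : ∀ x y → x * y ≢ 0ℤ → x ≢ 0ℤ
*-≢0ˡ x y xy≢0 refl = xy≢0 refl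

*-≢0ʳ : ∀ x y → x * y ≢ 0ℤ → y ≢ 0ℤ
*-≢0ʳ x y xy≢0 refl = xy≢0 (ℤ.*-zeroʳ x)

-- Sums over the integers n with ∣ n ∣ ≤ B

sumℤ : ℕ → (ℤ → ℤ) → ℤ
sumℤ B h = sumBelow (suc (B ℕ.+ B)) (λ i → h (i ⊖ B))

⊖-injectiveˡ : ∀ B {i j} → i ⊖ B ≡ j ⊖ B → i ≡ j
⊖-injectiveˡ B {i} {j} eq = ℤ.+-injective (+ℤ.∙-cancelʳ (- + B) (+ i) (+ j)
  (trans (ℤ.m-n≡m⊖n i B) (trans eq (sym (ℤ.m-n≡m⊖n j B)))))

⊖-surjective : ∀ B y → ∣ y ∣ ℕ.≤ B → ∃ λ i → i ℕ.< suc (B ℕ.+ B) × i ⊖ B ≡ y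
⊖-surjective B (+ n) n≤B = n ℕ.+ B , s≤s (ℕ.+-monoˡ-≤ B n≤B) ,
  trans (ℤ.⊖-≥ (ℕ.m≤n+m B n)) (cong +_ (ℕ.m+n∸n≡m n B))
⊖-surjective B -[1+ n ] 1+n≤B = B ℕ.∸ suc n , s≤s (ℕ.≤-trans (ℕ.m∸n≤m B (suc n)) (ℕ.m≤m+n B B)) ,
  trans (ℤ.⊖-≤ (ℕ.m∸n≤m B (suc n))) (cong (-_ ∘ +_) (ℕ.m∸[m∸n]≡n 1+n≤B))

⊖-bounded : ∀ B i → i ℕ.< suc (B ℕ.+ B) → ∣ i ⊖ B ∣ ℕ.≤ B
⊖-bounded B i i<2B+1 with ℕ.≤-total B i
... | inj₁ B≤i = subst (ℕ._≤ B) (sym (cong ∣_∣ (ℤ.⊖-≥ B≤i)))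
  (ℕ.≤-trans (ℕ.∸-monoˡ-≤ B (ℕ.≤-pred i<2B+1)) (ℕ.≤-reflexive (ℕ.m+n∸n≡m B B)))
... | inj₂ i≤B = subst (ℕ._≤ B) (sym (trans (cong ∣_∣ (ℤ.⊖-≤ i≤B)) (ℤ.∣-i∣≡∣i∣ (+ (B ℕ.∸ i))))) (ℕ.m∸n≤m B i)

sumℤ-cong : ∀ B {f g} → (∀ x → ∣ x ∣ ℕ.≤ B → f x ≡ g x) → sumℤ B f ≡ sumℤ B g
sumℤ-cong B eq = sum-cong (suc (B ℕ.+ B)) (λ i i< → eq (i ⊖ B) (⊖-bounded B i i<))

sumℤ-cong′ : ∀ B {f g} → (∀ x → f x ≡ g x) → sumℤ B f ≡ sumℤ B g
sumℤ-cong′ B eq = sumℤ-cong B (λ x _ → eq x)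

sumℤ-+ : ∀ B f g → sumℤ B (λ x → f x + g x) ≡ sumℤ B f + sumℤ B g
sumℤ-+ B f g = sum-+ (suc (B ℕ.+ B)) (λ i → f (i ⊖ B)) (λ i → g (i ⊖ B))

sumℤ-*ˡ : ∀ B c f → sumℤ B (λ x → c * f x) ≡ c * sumℤ B f
sumℤ-*ˡ B c f = sum-*ˡ (suc (B ℕ.+ B)) c (λ i → f (i ⊖ B))

sumℤ-swap : ∀ B C (f : ℤ → ℤ → ℤ) →
  sumℤ B (λ x → sumℤ C (f x)) ≡ sumℤ C (λ y → sumℤ B (λ x → f x y))
sumℤ-swap B C f = sum-swap (suc (B ℕ.+ B)) (suc (C ℕ.+ C)) (λ i j → f (i ⊖ B) (j ⊖ C))

sumℤ-single : ∀ B y h → ∣ y ∣ ℕ.≤ B → (∀ x → x ≢ y → h x ≡ 0ℤ) → sumℤ B h ≡ h y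
sumℤ-single B y h y≤B others with ⊖-surjective B y y≤B
... | k , k< , refl = sum-single (suc (B ℕ.+ B)) k (λ i → h (i ⊖ B)) k<
  (λ i _ i≢k → others (i ⊖ B) (i≢k ∘ ⊖-injectiveˡ B))

sumℤ-pick : ∀ B (h : ℤ → ℤ) y → (h y ≢ 0ℤ → ∣ y ∣ ℕ.≤ B) → sumℤ B (λ u → 𝟙 (y ℤ.≟ u) * h u) ≡ h y
sumℤ-pick B h y bounded with h y ℤ.≟ 0ℤ
... | yes hy≡0 = trans (sum-zero (suc (B ℕ.+ B)) (λ i _ → vanish (i ⊖ B))) (sym hy≡0)
  where
  vanish : ∀ u → 𝟙 (y ℤ.≟ u) * h u ≡ 0ℤ
  vanish u with y ℤ.≟ u
  ... | yes refl = trans (ℤ.*-identityˡ (h u)) hy≡0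
  ... | no _     = refl
... | no hy≢0 = trans
  (sumℤ-single B y (λ u → 𝟙 (y ℤ.≟ u) * h u) (bounded hy≢0)
    (λ u u≢y → cong (_* h u) (𝟙-no (y ℤ.≟ u) (u≢y ∘ sym))))
  (trans (cong (_* h y) (𝟙-yes (y ℤ.≟ y) refl)) (ℤ.*-identityˡ (h y)))

-- Interchange of summation in Σ_i Σ_u c i u · h u. The columns need total weight 1 only where `h`
-- is nonzero, so no bijection of index ranges has to be built.
double-count : ∀ n B (f : ℕ → ℤ) (h : ℤ → ℤ) (c : ℕ → ℤ → ℤ) →
  (∀ i → i ℕ.< n → sumℤ B (λ u → c i u * h u) ≡ f i) →
  (∀ u → h u ≢ 0ℤ → sumBelow n (λ i → c i u) ≡ 1ℤ) →
  sumBelow n f ≡ sumℤ B h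
double-count n B f h c rows columns = begin
  sumBelow n f
    ≡⟨ sum-cong n (λ i i<n → sym (rows i i<n)) ⟩
  sumBelow n (λ i → sumℤ B (λ u → c i u * h u))
    ≡⟨ sum-swap n (suc (B ℕ.+ B)) (λ i j → c i (j ⊖ B) * h (j ⊖ B)) ⟩
  sumℤ B (λ u → sumBelow n (λ i → c i u * h u))
    ≡⟨ sumℤ-cong′ B (λ u → trans (sum-*ʳ n (h u) (λ i → c i u)) (column u)) ⟩
  sumℤ B h ∎
  where
  open ≡-Reasoning
  column : ∀ u → sumBelow n (λ i → c i u) * h u ≡ h u
  column u with h u ℤ.≟ 0ℤ
  ... | yes hu≡0 = trans (cong (sumBelow n (λ i → c i u) *_) hu≡0) (trans (ℤ.*-zeroʳ (sumBelow n (λ i → c i u))) (sym hu≡0))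
  ... | no hu≢0  = trans (cong (_* h u) (columns u hu≢0)) (ℤ.*-identityˡ (h u))

-- The ranges `B` and `C` are unrelated: surjectivity and the bound are asked only on the support of
-- `h`, which suits linear substitutions between truncated sums.
sumℤ-reindex : ∀ B C (h : ℤ → ℤ) (φ : ℤ → ℤ) →
  (∀ j k → φ j ≡ φ k → j ≡ k) →
  (∀ u → h u ≢ 0ℤ → ∃ λ k → ∣ k ∣ ℕ.≤ B × φ k ≡ u) →
  (∀ k → h (φ k) ≢ 0ℤ → ∣ φ k ∣ ℕ.≤ C) →
  sumℤ B (h ∘ φ) ≡ sumℤ C h
sumℤ-reindex B C h φ injective surjective bounded =
  double-count (suc (B ℕ.+ B)) C (λ i → h (φ (i ⊖ B))) h (λ i u → 𝟙 (φ (i ⊖ B) ℤ.≟ u))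
    (λ i _ → sumℤ-pick C h (φ (i ⊖ B)) (bounded (i ⊖ B)))
    column
  where
  column : ∀ u → h u ≢ 0ℤ → sumBelow (suc (B ℕ.+ B)) (λ i → 𝟙 (φ (i ⊖ B) ℤ.≟ u)) ≡ 1ℤ
  column u hu≢0 with surjective u hu≢0
  ... | k , k≤B , refl = trans
    (sumℤ-single B k (λ x → 𝟙 (φ x ℤ.≟ φ k)) k≤B (λ x x≢k → 𝟙-no (φ x ℤ.≟ φ k) (x≢k ∘ injective x k)))
    (𝟙-yes (φ k ℤ.≟ φ k) refl)

sumℤ-neg : ∀ B h → sumℤ B (h ∘ -_) ≡ sumℤ B h
sumℤ-neg B h = trans (sumℤ-cong B (λ x x≤B → sym (clip-in (- x) (subst (ℕ._≤ B) (sym (ℤ.∣-i∣≡∣i∣ x)) x≤B))))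
  (trans (sumℤ-reindex B B clip -_ (λ j k → ℤ.neg-injective) surjective (λ k → clip-≢0 (- k)))
         (sumℤ-cong B clip-in))
  where
  -- Here `h` may be nonzero outside the range, so it is truncated before reindexing.
  clip : ℤ → ℤ
  clip u = 𝟙 (∣ u ∣ ℕ.≤? B) * h u
  clip-in : ∀ u → ∣ u ∣ ℕ.≤ B → clip u ≡ h u
  clip-in u u≤B = trans (cong (_* h u) (𝟙-yes (∣ u ∣ ℕ.≤? B) u≤B)) (ℤ.*-identityˡ (h u))
  clip-≢0 : ∀ u → clip u ≢ 0ℤ → ∣ u ∣ ℕ.≤ B
  clip-≢0 u nz = 𝟙≢0 (∣ u ∣ ℕ.≤? B) (*-≢0ˡ _ (h u) nz)
  surjective : ∀ u → clip u ≢ 0ℤ → ∃ λ k → ∣ k ∣ ℕ.≤ B × - k ≡ u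
  surjective u nz = - u , subst (ℕ._≤ B) (sym (ℤ.∣-i∣≡∣i∣ u)) (clip-≢0 u nz) , ℤ.neg-involutive u

-- The support of the even function `h` consists of the integers ± y i, and each i accounts for two
-- of them. They are distinct because the third hypothesis, with i = j, also excludes y i = 0.
sum-fold-even : ∀ n B (h : ℤ → ℤ) (y : ℕ → ℤ) →
  (∀ u → h (- u) ≡ h u) →
  (∀ i j → i ℕ.< n → j ℕ.< n → y i ≡ y j → i ≡ j) →
  (∀ i j → y i ≢ - y j) →
  (∀ u → h u ≢ 0ℤ → ∃ λ i → i ℕ.< n × (y i ≡ u ⊎ y i ≡ - u)) →
  (∀ i → i ℕ.< n → h (y i) ≢ 0ℤ → ∣ y i ∣ ℕ.≤ B) →
  + 2 * sumBelow n (h ∘ y) ≡ sumℤ B h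
sum-fold-even n B h y even injective opposite surjective bounded = trans
  (sym (sum-*ˡ n (+ 2) (h ∘ y)))
  (double-count n B (λ i → + 2 * h (y i)) h c row column)
  where
  c : ℕ → ℤ → ℤ
  c i u = 𝟙 (y i ℤ.≟ u) + 𝟙 (- y i ℤ.≟ u)
  row : ∀ i → i ℕ.< n → sumℤ B (λ u → c i u * h u) ≡ + 2 * h (y i)
  row i i<n = begin
    sumℤ B (λ u → c i u * h u)
      ≡⟨ sumℤ-cong′ B (λ u → ℤ.*-distribʳ-+ (h u) (𝟙 (y i ℤ.≟ u)) (𝟙 (- y i ℤ.≟ u))) ⟩
    sumℤ B (λ u → 𝟙 (y i ℤ.≟ u) * h u + 𝟙 (- y i ℤ.≟ u) * h u)
      ≡⟨ sumℤ-+ B (λ u → 𝟙 (y i ℤ.≟ u) * h u) (λ u → 𝟙 (- y i ℤ.≟ u) * h u) ⟩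
    sumℤ B (λ u → 𝟙 (y i ℤ.≟ u) * h u) + sumℤ B (λ u → 𝟙 (- y i ℤ.≟ u) * h u)
      ≡⟨ cong₂ _+_ (sumℤ-pick B h (y i) (bounded i i<n))
                   (sumℤ-pick B h (- y i) (λ nz → subst (ℕ._≤ B) (sym (ℤ.∣-i∣≡∣i∣ (y i)))
                                              (bounded i i<n (nz ∘ trans (even (y i)))))) ⟩
    h (y i) + h (- y i)
      ≡⟨ cong (_+_ (h (y i))) (even (y i)) ⟩
    h (y i) + h (y i)
      ≡⟨ x+x≡2x (h (y i)) ⟩
    + 2 * h (y i) ∎
    where
    open ≡-Reasoning
  column : ∀ u → h u ≢ 0ℤ → sumBelow n (λ i → c i u) ≡ 1ℤ
  column u hu≢0 with surjective u hu≢0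
  ... | k , k<n , inj₁ refl = trans
    (sum-single n k (λ i → c i (y k)) k<n (λ i i<n i≢k → cong₂ _+_
      (𝟙-no (y i ℤ.≟ y k) (i≢k ∘ injective i k i<n k<n))
      (𝟙-no (- y i ℤ.≟ y k) (opposite k i ∘ sym))))
    (cong₂ _+_ (𝟙-yes (y k ℤ.≟ y k) refl) (𝟙-no (- y k ℤ.≟ y k) (opposite k k ∘ sym)))
  ... | k , k<n , inj₂ yk≡-u = trans
    (sum-single n k (λ i → c i u) k<n (λ i i<n i≢k → cong₂ _+_
      (𝟙-no (y i ℤ.≟ u) (not-u i))
      (𝟙-no (- y i ℤ.≟ u) (λ eq → i≢k (injective i k i<n k<n
        (trans (sym (ℤ.neg-involutive (y i))) (trans (cong -_ eq) (sym yk≡-u))))))))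
    (cong₂ _+_ (𝟙-no (y k ℤ.≟ u) (not-u k)) (𝟙-yes (- y k ℤ.≟ u) (trans (cong -_ yk≡-u) (ℤ.neg-involutive u))))
    where
    not-u : ∀ i → y i ≢ u
    not-u i eq = opposite k i (trans yk≡-u (cong -_ (sym eq)))

-- The ring of power series

infixl 6 _⊕_ _⊝_
_⊕_ _⊝_ : Series → Series → Series
(f ⊕ g) N = f N + g N
(f ⊝ g) N = f N - g N

-- Congruence modulo q^{N+1}.
Agree : ℕ → Series → Series → Set
Agree N f g = ∀ i → i ℕ.≤ N → f i ≡ g i

⊛-agree : ∀ N {f f′ g g′} → Agree N f f′ → Agree N g g′ → Agree N (f ⊛ g) (f′ ⊛ g′)
⊛-agree N f≈ g≈ k k≤N = sum-cong (suc k) λ i i<1+k → cong₂ _*_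
  (f≈ i (ℕ.≤-trans (ℕ.≤-pred i<1+k) k≤N)) (g≈ (k ℕ.∸ i) (ℕ.≤-trans (ℕ.m∸n≤m k i) k≤N))

⊛-cong : ∀ {f f′ g g′} → f ≗ f′ → g ≗ g′ → f ⊛ g ≗ f′ ⊛ g′
⊛-cong f≗ g≗ N = ⊛-agree N (λ i _ → f≗ i) (λ i _ → g≗ i) N ℕ.≤-refl

⊛-congʳ : ∀ g {f f′} → f ≗ f′ → f ⊛ g ≗ f′ ⊛ g
⊛-congʳ g f≗ = ⊛-cong {g = g} f≗ (λ _ → refl)

-- Splitting off the constant term of one factor gives a recursion on the degree, so that
-- commutativity and associativity follow by induction without rearranging double sums.
⊛-suc : ∀ f g N → (f ⊛ g) (suc N) ≡ f 0 * g (suc N) + ((f ∘ suc) ⊛ g) N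
⊛-suc f g N = sum-head (suc N) (λ i → f i * g (suc N ℕ.∸ i))

⊛-sucʳ : ∀ f g N → (f ⊛ g) (suc N) ≡ (f ⊛ (g ∘ suc)) N + f (suc N) * g 0
⊛-sucʳ f g N = cong₂ _+_
  (sum-cong (suc N) λ i i<1+N → cong (λ k → f i * g k) (ℕ.+-∸-assoc 1 (ℕ.≤-pred i<1+N)))
  (cong (λ k → f (suc N) * g k) (ℕ.n∸n≡0 (suc N)))

⊛-comm : ∀ f g → f ⊛ g ≗ g ⊛ f
⊛-comm f g zero    = cong (_+_ 0ℤ) (ℤ.*-comm (f 0) (g 0))
⊛-comm f g (suc N) = begin
  (f ⊛ g) (suc N)                          ≡⟨ ⊛-suc f g N ⟩
  f 0 * g (suc N) + ((f ∘ suc) ⊛ g) N      ≡⟨ cong₂ _+_ (ℤ.*-comm (f 0) (g (suc N))) (⊛-comm (f ∘ suc) g N) ⟩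
  g (suc N) * f 0 + (g ⊛ (f ∘ suc)) N      ≡⟨ ℤ.+-comm (g (suc N) * f 0) ((g ⊛ (f ∘ suc)) N) ⟩
  (g ⊛ (f ∘ suc)) N + g (suc N) * f 0      ≡⟨ ⊛-sucʳ g f N ⟨
  (g ⊛ f) (suc N) ∎
  where open ≡-Reasoning

⊛-distribʳ-⊕ : ∀ h f g → (f ⊕ g) ⊛ h ≗ f ⊛ h ⊕ g ⊛ h
⊛-distribʳ-⊕ h f g N = trans
  (sum-cong (suc N) λ i _ → ℤ.*-distribʳ-+ (h (N ℕ.∸ i)) (f i) (g i))
  (sum-+ (suc N) (λ i → f i * h (N ℕ.∸ i)) (λ i → g i * h (N ℕ.∸ i)))

⊛-scale : ∀ c f g N → ((λ i → c * f i) ⊛ g) N ≡ c * (f ⊛ g) N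
⊛-scale c f g N = trans
  (sum-cong (suc N) λ i _ → ℤ.*-assoc c (f i) (g (N ℕ.∸ i)))
  (sum-*ˡ (suc N) c (λ i → f i * g (N ℕ.∸ i)))

⊛-assoc : ∀ f g h → (f ⊛ g) ⊛ h ≗ f ⊛ (g ⊛ h)
⊛-assoc f g h zero    = base (f 0) (g 0) (h 0)
  where
  base : ∀ a b c → 0ℤ + (0ℤ + a * b) * c ≡ 0ℤ + a * (0ℤ + b * c)
  base = solve-∀
⊛-assoc f g h (suc N) = begin
  ((f ⊛ g) ⊛ h) (suc N)
    ≡⟨ ⊛-suc (f ⊛ g) h N ⟩
  (0ℤ + f 0 * g 0) * h (suc N) + (((f ⊛ g) ∘ suc) ⊛ h) N
    ≡⟨ cong (_+_ ((0ℤ + f 0 * g 0) * h (suc N))) (⊛-congʳ h (⊛-suc f g) N) ⟩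
  (0ℤ + f 0 * g 0) * h (suc N) + (((λ i → f 0 * g (suc i)) ⊕ ((f ∘ suc) ⊛ g)) ⊛ h) N
    ≡⟨ cong (_+_ ((0ℤ + f 0 * g 0) * h (suc N))) (⊛-distribʳ-⊕ h (λ i → f 0 * g (suc i)) ((f ∘ suc) ⊛ g) N) ⟩
  (0ℤ + f 0 * g 0) * h (suc N) + (((λ i → f 0 * g (suc i)) ⊛ h) N + (((f ∘ suc) ⊛ g) ⊛ h) N)
    ≡⟨ cong (_+_ ((0ℤ + f 0 * g 0) * h (suc N))) (cong₂ _+_ (⊛-scale (f 0) (g ∘ suc) h N) (⊛-assoc (f ∘ suc) g h N)) ⟩
  (0ℤ + f 0 * g 0) * h (suc N) + (f 0 * ((g ∘ suc) ⊛ h) N + ((f ∘ suc) ⊛ (g ⊛ h)) N)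
    ≡⟨ regroup (f 0) (g 0) (h (suc N)) (((g ∘ suc) ⊛ h) N) (((f ∘ suc) ⊛ (g ⊛ h)) N) ⟩
  f 0 * (g 0 * h (suc N) + ((g ∘ suc) ⊛ h) N) + ((f ∘ suc) ⊛ (g ⊛ h)) N
    ≡⟨ cong (λ z → f 0 * z + ((f ∘ suc) ⊛ (g ⊛ h)) N) (⊛-suc g h N) ⟨
  f 0 * (g ⊛ h) (suc N) + ((f ∘ suc) ⊛ (g ⊛ h)) N
    ≡⟨ ⊛-suc f (g ⊛ h) N ⟨
  (f ⊛ (g ⊛ h)) (suc N) ∎
  where
  open ≡-Reasoning
  regroup : ∀ a b c x y → (0ℤ + a * b) * c + (a * x + y) ≡ a * (b * c + x) + y
  regroup = solve-∀

⊛-identityˡ : ∀ f → oneS ⊛ f ≗ f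
⊛-identityˡ f N = trans
  (sum-single (suc N) 0 (λ i → oneS i * f (N ℕ.∸ i)) (s≤s z≤n) others)
  (ℤ.*-identityˡ (f N))
  where
  others : ∀ i → i ℕ.< suc N → i ≢ 0 → oneS i * f (N ℕ.∸ i) ≡ 0ℤ
  others zero    _ 0≢0 = contradiction refl 0≢0
  others (suc i) _ _   = refl

⊛-identityʳ : ∀ f → f ⊛ oneS ≗ f
⊛-identityʳ f N = trans (⊛-comm f oneS N) (⊛-identityˡ f N)

⊛-commutativeMonoid : CommutativeMonoid _ _
⊛-commutativeMonoid = record
  { Carrier = Series ; _≈_ = _≗_ ; _∙_ = _⊛_ ; ε = oneS
  ; isCommutativeMonoid = record
    { isMonoid = record
      { isSemigroup = record
        { isMagma = record
          { isEquivalence = record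
            { refl = λ _ → refl ; sym = λ p N → sym (p N) ; trans = λ p q N → trans (p N) (q N) }
          ; ∙-cong = ⊛-cong }
        ; assoc = ⊛-assoc }
      ; identity = ⊛-identityˡ , ⊛-identityʳ }
    ; comm = ⊛-comm } }

open CommutativeMonoid ⊛-commutativeMonoid using () renaming (setoid to ≗-setoid)
open import Relation.Binary.Reasoning.Setoid ≗-setoid as ≗-Reasoning using ()
open import Algebra.Solver.CommutativeMonoid ⊛-commutativeMonoid as ⊛-Solver using (_⊜_) renaming (_⊕_ to _:⊛_)

-- Multiplication by a power of q

shift : ℕ → Series → Series
shift zero    f N       = f N
shift (suc k) f zero    = 0ℤ
shift (suc k) f (suc N) = shift k f N

shift-agree : ∀ k m {f g} → Agree m f g → Agree (k ℕ.+ m) (shift k f) (shift k g)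
shift-agree zero    m f≈g i       i≤    = f≈g i i≤
shift-agree (suc k) m f≈g zero    i≤    = refl
shift-agree (suc k) m f≈g (suc i) i≤    = shift-agree k m f≈g i (ℕ.≤-pred i≤)

shift-cong : ∀ k {f g} → f ≗ g → shift k f ≗ shift k g
shift-cong k f≗g N = shift-agree k N (λ i _ → f≗g i) N (ℕ.m≤n+m N k)

shift-shift : ∀ j k f → shift j (shift k f) ≗ shift (j ℕ.+ k) f
shift-shift zero    k f N       = refl
shift-shift (suc j) k f zero    = refl
shift-shift (suc j) k f (suc N) = shift-shift j k f N

shift-⊕ : ∀ k f g → shift k (f ⊕ g) ≗ shift k f ⊕ shift k g
shift-⊕ zero    f g N       = refl
shift-⊕ (suc k) f g zero    = refl
shift-⊕ (suc k) f g (suc N) = shift-⊕ k f g N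

shift-scale : ∀ k c f N → shift k (λ i → c * f i) N ≡ c * shift k f N
shift-scale zero    c f N       = refl
shift-scale (suc k) c f zero    = sym (ℤ.*-zeroʳ c)
shift-scale (suc k) c f (suc N) = shift-scale k c f N

shift-zero : ∀ k {f} → (∀ N → f N ≡ 0ℤ) → ∀ N → shift k f N ≡ 0ℤ
shift-zero zero    f≡0 N       = f≡0 N
shift-zero (suc k) f≡0 zero    = refl
shift-zero (suc k) f≡0 (suc N) = shift-zero k f≡0 N

shift-sum : ∀ k n (F : ℕ → Series) N →
  shift k (λ M → sumBelow n (λ i → F i M)) N ≡ sumBelow n (λ i → shift k (F i) N)
shift-sum k zero    F N = shift-zero k (λ _ → refl) N
shift-sum k (suc n) F N = trans
  (shift-⊕ k (λ M → sumBelow n (λ i → F i M)) (F n) N)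
  (cong (_+ shift k (F n) N) (shift-sum k n F N))

shift-⊛ : ∀ k f g → shift k f ⊛ g ≗ shift k (f ⊛ g)
shift-⊛ zero    f g N       = refl
shift-⊛ (suc k) f g zero    = refl
shift-⊛ (suc k) f g (suc N) = trans (⊛-suc (shift (suc k) f) g N) (trans (ℤ.+-identityˡ _) (shift-⊛ k f g N))

shift-one : ∀ k N → shift k oneS N ≡ 𝟙 (N ℕ.≟ k)
shift-one zero    zero    = refl
shift-one zero    (suc N) = refl
shift-one (suc k) zero    = refl
shift-one (suc k) (suc N) = shift-one k N

oneMinusQ^-shift : ∀ k → oneMinusQ^ (suc k) ≗ oneS ⊝ shift (suc k) oneS
oneMinusQ^-shift k zero    = refl
oneMinusQ^-shift k (suc N) = cong (_+_ 0ℤ) (trans (neg (suc N ℕ.≟ suc k)) (cong -_ (sym (shift-one (suc k) (suc N)))))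
  where
  neg : {P : Set} (P? : Dec P) → (if does P? then - (+ 1) else + 0) ≡ - 𝟙 P?
  neg (yes _) = refl
  neg (no _)  = refl

⊛-oneMinusQ^ : ∀ k f → f ⊛ oneMinusQ^ (suc k) ≗ f ⊝ shift (suc k) f
⊛-oneMinusQ^ k f = begin
  f ⊛ oneMinusQ^ (suc k)                               ≈⟨ ⊛-comm f (oneMinusQ^ (suc k)) ⟩
  oneMinusQ^ (suc k) ⊛ f                               ≈⟨ ⊛-congʳ f as-sum ⟩
  (oneS ⊕ (λ i → -1ℤ * shift (suc k) oneS i)) ⊛ f
    ≈⟨ ⊛-distribʳ-⊕ f oneS (λ i → -1ℤ * shift (suc k) oneS i) ⟩
  oneS ⊛ f ⊕ (λ i → -1ℤ * shift (suc k) oneS i) ⊛ f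
    ≈⟨ (λ N → cong₂ _+_ (⊛-identityˡ f N) (⊛-scale -1ℤ (shift (suc k) oneS) f N)) ⟩
  f ⊕ (λ N → -1ℤ * (shift (suc k) oneS ⊛ f) N)
    ≈⟨ (λ N → cong (λ z → f N + -1ℤ * z)
          (trans (shift-⊛ (suc k) oneS f N) (shift-cong (suc k) (⊛-identityˡ f) N))) ⟩
  f ⊕ (λ N → -1ℤ * shift (suc k) f N)
    ≈⟨ (λ N → cong (_+_ (f N)) (ℤ.-1*i≡-i (shift (suc k) f N))) ⟩
  f ⊝ shift (suc k) f ∎
  where
  open ≗-Reasoning
  as-sum : oneMinusQ^ (suc k) ≗ oneS ⊕ (λ i → -1ℤ * shift (suc k) oneS i)
  as-sum N = trans (oneMinusQ^-shift k N) (cong (_+_ (oneS N)) (sym (ℤ.-1*i≡-i (shift (suc k) oneS N))))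

-- Products

prod-agree : ∀ N n {F G} → (∀ i → Agree N (F i) (G i)) → Agree N (prodBelow F n) (prodBelow G n)
prod-agree N zero    F≈G = λ _ _ → refl
prod-agree N (suc n) F≈G = ⊛-agree N (prod-agree N n F≈G) (F≈G n)

prod-cong : ∀ n {F G} → (∀ i → F i ≗ G i) → prodBelow F n ≗ prodBelow G n
prod-cong n F≗G N = prod-agree N n (λ i k _ → F≗G i k) N ℕ.≤-refl

prod-one : ∀ n {F} → (∀ i → F i ≗ oneS) → prodBelow F n ≗ oneS
prod-one zero    F≗1 = λ _ → refl
prod-one (suc n) F≗1 N = trans (⊛-cong (prod-one n F≗1) (F≗1 n) N) (⊛-identityˡ oneS N)

prod-⊛ : ∀ n F G → prodBelow (λ i → F i ⊛ G i) n ≗ prodBelow F n ⊛ prodBelow G n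
prod-⊛ zero    F G N = sym (⊛-identityˡ oneS N)
prod-⊛ (suc n) F G N = trans (⊛-congʳ (F n ⊛ G n) (prod-⊛ n F G) N)
  (⊛-Solver.solve 4 (λ a b c d → (a :⊛ b) :⊛ (c :⊛ d) ⊜ (a :⊛ c) :⊛ (b :⊛ d)) (λ _ → refl)
    (prodBelow F n) (prodBelow G n) (F n) (G n) N)

prod-++ : ∀ m n F → prodBelow F (m ℕ.+ n) ≗ prodBelow F m ⊛ prodBelow (λ i → F (m ℕ.+ i)) n
prod-++ m zero F N = trans (cong (λ k → prodBelow F k N) (ℕ.+-identityʳ m)) (sym (⊛-identityʳ (prodBelow F m) N))
prod-++ m (suc n) F N = trans (cong (λ k → prodBelow F k N) (ℕ.+-suc m n))
  (trans (⊛-congʳ (F (m ℕ.+ n)) (prod-++ m n F) N)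
         (⊛-assoc (prodBelow F m) (prodBelow (λ i → F (m ℕ.+ i)) n) (F (m ℕ.+ n)) N))

prod-blocks : ∀ d n F → prodBelow F (n ℕ.* d) ≗ prodBelow (λ i → prodBelow (λ j → F (i ℕ.* d ℕ.+ j)) d) n
prod-blocks d zero    F N = refl
prod-blocks d (suc n) F N = trans (cong (λ k → prodBelow F k N) (ℕ.+-comm d (n ℕ.* d)))
  (trans (prod-++ (n ℕ.* d) d F N)
         (⊛-congʳ (prodBelow (λ j → F (n ℕ.* d ℕ.+ j)) d) (prod-blocks d n F) N))

prod-swap : ∀ n m (H : ℕ → ℕ → Series) →
  prodBelow (λ i → prodBelow (H i) m) n ≗ prodBelow (λ j → prodBelow (λ i → H i j) n) m
prod-swap zero    m H N = sym (prod-one m (λ _ _ → refl) N)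
prod-swap (suc n) m H N = trans
  (⊛-congʳ (prodBelow (H n) m) (prod-swap n m H) N)
  (sym (prod-⊛ m (λ j → prodBelow (λ i → H i j) n) (H n) N))

-- Infinite products and their inverses

UnitFactors : (ℕ → Series) → Set
UnitFactors F = ∀ i → Agree i (F i) oneS

-- Factors of index above k are 1 modulo q^{k+1}, so every partial product with more than k factors
-- has the same coefficient of q^k.
infProd-agree : ∀ {F} → UnitFactors F → ∀ N n → N ℕ.< n → Agree N (infProd F) (prodBelow F n)
infProd-agree {F} unit N n N<n k k≤N =
  trans (grow (n ℕ.∸ suc k)) (cong (λ m → prodBelow F m k) (ℕ.m∸n+n≡m (ℕ.≤-<-trans k≤N N<n)))
  where
  grow : ∀ e → prodBelow F (suc k) k ≡ prodBelow F (e ℕ.+ suc k) k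
  grow zero    = refl
  grow (suc e) = trans (grow e) (sym (trans
    (⊛-agree k {f = prodBelow F (e ℕ.+ suc k)} {g = F (e ℕ.+ suc k)} (λ _ _ → refl)
      (λ i i≤k → unit (e ℕ.+ suc k) i (ℕ.≤-trans i≤k (ℕ.≤-trans (ℕ.n≤1+n k) (ℕ.m≤n+m (suc k) e)))) k ℕ.≤-refl)
    (⊛-identityʳ (prodBelow F (e ℕ.+ suc k)) k)))

infProd-inverse : ∀ {F G} → UnitFactors F → UnitFactors G → (∀ i → F i ⊛ G i ≗ oneS) → infProd F ⊛ infProd G ≗ oneS
infProd-inverse {F} {G} unitF unitG inv N = trans
  (⊛-agree N (infProd-agree unitF N (suc N) ℕ.≤-refl) (infProd-agree unitG N (suc N) ℕ.≤-refl) N ℕ.≤-refl)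
  (trans (sym (prod-⊛ (suc N) F G N)) (prod-one (suc N) inv N))

shift-below : ∀ k f N → N ℕ.< k → shift k f N ≡ 0ℤ
shift-below (suc k) f zero    _   = refl
shift-below (suc k) f (suc N) N<k = shift-below k f N (ℕ.≤-pred N<k)

shift-above : ∀ k f N → shift k f (k ℕ.+ N) ≡ f N
shift-above zero    f N = refl
shift-above (suc k) f N = shift-above k f N

index≤exponent : ∀ c d .{{_ : NonZero d}} i → i ℕ.≤ c ℕ.+ d ℕ.* i
index≤exponent c d i = ℕ.≤-trans (ℕ.m≤n*m i d) (ℕ.m≤n+m (d ℕ.* i) c)

oneMinusQ^-agree : ∀ k → Agree k (oneMinusQ^ (suc k)) oneS
oneMinusQ^-agree k i i≤k = trans (oneMinusQ^-shift k i)
  (trans (cong (λ z → oneS i - z) (shift-below (suc k) oneS i (s≤s i≤k))) (ℤ.+-identityʳ (oneS i)))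

poch-unit : ∀ c d .{{_ : NonZero d}} → UnitFactors (λ i → oneMinusQ^ (suc c ℕ.+ d ℕ.* i))
poch-unit c d i j j≤i = oneMinusQ^-agree (c ℕ.+ d ℕ.* i) j (ℕ.≤-trans j≤i (index≤exponent c d i))

invPoch-unit : ∀ c d .{{_ : NonZero d}} → UnitFactors (λ i → invOneMinusQ^ (suc c ℕ.+ d ℕ.* i))
invPoch-unit c d i zero    _   = 𝟙-yes (suc c ℕ.+ d ℕ.* i ∣? 0) (_ ∣0)
invPoch-unit c d i (suc j) j≤i = 𝟙-no (suc c ℕ.+ d ℕ.* i ∣? suc j)
  (λ div → ℕ.<-irrefl refl (ℕ.≤-trans (∣⇒≤ div) (ℕ.≤-trans j≤i (index≤exponent c d i))))

invOneMinusQ^-inverse : ∀ k → oneMinusQ^ (suc k) ⊛ invOneMinusQ^ (suc k) ≗ oneS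
invOneMinusQ^-inverse k N = trans (⊛-comm (oneMinusQ^ (suc k)) (invOneMinusQ^ (suc k)) N)
  (trans (⊛-oneMinusQ^ k (invOneMinusQ^ (suc k)) N) (split N))
  where
  geometric = invOneMinusQ^ (suc k)
  split : ∀ N → geometric N - shift (suc k) geometric N ≡ oneS N
  split N with suc k ℕ.≤? N
  split zero | no _ = cong (_+ 0ℤ) (𝟙-yes (suc k ∣? 0) (_ ∣0))
  split (suc N) | no k≰N = cong₂ _-_
    (𝟙-no (suc k ∣? suc N) (λ div → k≰N (∣⇒≤ div)))
    (shift-below (suc k) geometric (suc N) (ℕ.≰⇒> k≰N))
  split N | yes k≤N with N ℕ.∸ suc k | ℕ.m+[n∸m]≡n k≤N
  ... | m | refl = trans
    (cong₂ _-_ (𝟙-cong (suc k ∣? suc k ℕ.+ m) (suc k ∣? m) (λ div → ∣m+n∣m⇒∣n div ∣-refl) (∣m∣n⇒∣m+n ∣-refl))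
               (shift-above (suc k) geometric m))
    (ℤ.+-inverseʳ (geometric m))

poch-inverse : ∀ c d .{{_ : NonZero d}} → poch (suc c) d ⊛ invPoch (suc c) d ≗ oneS
poch-inverse c d = infProd-inverse (poch-unit c d) (invPoch-unit c d) (λ i → invOneMinusQ^-inverse (c ℕ.+ d ℕ.* i))

-- The first (N + 1) d factors form N + 1 blocks of length d, and exchanging the two products sorts
-- the exponents by residue. The case d = 3 identifies (q,q²,q³;q³) with (q;q); the case d = 5
-- exhibits the factors to be cancelled.
poch-residues : ∀ d .{{_ : NonZero d}} → poch 1 1 ≗ prodBelow (λ j → poch (suc j) d) d
poch-residues d N = begin
  poch 1 1 N
    ≡⟨ infProd-agree (poch-unit 0 1) N (suc N ℕ.* d) (ℕ.m≤m*n (suc N) d) N ℕ.≤-refl ⟩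
  prodBelow (λ i → oneMinusQ^ (1 ℕ.+ 1 ℕ.* i)) (suc N ℕ.* d) N
    ≡⟨ prod-blocks d (suc N) (λ i → oneMinusQ^ (1 ℕ.+ 1 ℕ.* i)) N ⟩
  prodBelow (λ i → prodBelow (λ j → oneMinusQ^ (1 ℕ.+ 1 ℕ.* (i ℕ.* d ℕ.+ j))) d) (suc N) N
    ≡⟨ prod-swap (suc N) d (λ i j → oneMinusQ^ (1 ℕ.+ 1 ℕ.* (i ℕ.* d ℕ.+ j))) N ⟩
  prodBelow (λ j → prodBelow (λ i → oneMinusQ^ (1 ℕ.+ 1 ℕ.* (i ℕ.* d ℕ.+ j))) (suc N)) d N
    ≡⟨ prod-cong d (λ j → prod-cong (suc N) (λ i M → cong (λ k → oneMinusQ^ k M) (exponent i j d))) N ⟩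
  prodBelow (λ j → prodBelow (λ i → oneMinusQ^ (suc j ℕ.+ d ℕ.* i)) (suc N)) d N
    ≡⟨ prod-agree N d (λ j k k≤N → sym (infProd-agree (poch-unit j d) N (suc N) ℕ.≤-refl k k≤N)) N ℕ.≤-refl ⟩
  prodBelow (λ j → poch (suc j) d) d N ∎
  where
  open ≡-Reasoning
  exponent : ∀ i j d → 1 ℕ.+ 1 ℕ.* (i ℕ.* d ℕ.+ j) ≡ suc j ℕ.+ d ℕ.* i
  exponent = ℕ-Ring.solve-∀

-- Gaussian binomials in q^d

-- gauss d k l is the q^d-binomial coefficient "k + l choose k".
gauss : ℕ → ℕ → ℕ → Series
gauss d zero    l       = oneS
gauss d (suc k) zero    = oneS
gauss d (suc k) (suc l) = gauss d k (suc l) ⊕ shift (d ℕ.* suc k) (gauss d (suc k) l)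

shift-⊕-shift : ∀ a b k f g → a ℕ.+ b ≡ k → shift a (f ⊕ shift b g) ≗ shift a f ⊕ shift k g
shift-⊕-shift a b _ f g refl N = trans (shift-⊕ a f (shift b g) N) (cong (_+_ (shift a f N)) (shift-shift a b g N))

*-suc-suc : ∀ d l → d ℕ.* 1 ℕ.+ d ℕ.* suc l ≡ d ℕ.* suc (suc l)
*-suc-suc = ℕ-Ring.solve-∀

-- The definition builds in one of the two Pascal rules. This is the other one; it yields the
-- symmetry `gauss-sym` and drives the induction for the finite triple product.
gauss-pascal : ∀ d k l → gauss d (suc k) (suc l) ≗ gauss d (suc k) l ⊕ shift (d ℕ.* suc l) (gauss d k (suc l))
gauss-pascal d zero    zero    N = refl
gauss-pascal d zero    (suc l) N = begin
  oneS N + shift (d ℕ.* 1) (gauss d 1 (suc l)) N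
    ≡⟨ cong (_+_ (oneS N)) (shift-cong (d ℕ.* 1) (gauss-pascal d zero l) N) ⟩
  oneS N + shift (d ℕ.* 1) (gauss d 1 l ⊕ shift (d ℕ.* suc l) oneS) N
    ≡⟨ cong (_+_ (oneS N)) (shift-⊕-shift (d ℕ.* 1) (d ℕ.* suc l) (d ℕ.* suc (suc l)) (gauss d 1 l) oneS (*-suc-suc d l) N) ⟩
  oneS N + (shift (d ℕ.* 1) (gauss d 1 l) N + shift (d ℕ.* suc (suc l)) oneS N)
    ≡⟨ ℤ.+-assoc (oneS N) (shift (d ℕ.* 1) (gauss d 1 l) N) (shift (d ℕ.* suc (suc l)) oneS N) ⟨
  gauss d 1 (suc l) N + shift (d ℕ.* suc (suc l)) oneS N ∎
  where
  open ≡-Reasoning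
gauss-pascal d (suc k) zero    N = begin
  gauss d (suc k) 1 N + shift (d ℕ.* suc (suc k)) oneS N
    ≡⟨ cong (_+ shift (d ℕ.* suc (suc k)) oneS N) (gauss-pascal d k zero N) ⟩
  oneS N + shift (d ℕ.* 1) (gauss d k 1) N + shift (d ℕ.* suc (suc k)) oneS N
    ≡⟨ ℤ.+-assoc (oneS N) (shift (d ℕ.* 1) (gauss d k 1) N) (shift (d ℕ.* suc (suc k)) oneS N) ⟩
  oneS N + (shift (d ℕ.* 1) (gauss d k 1) N + shift (d ℕ.* suc (suc k)) oneS N)
    ≡⟨ cong (_+_ (oneS N)) (shift-⊕-shift (d ℕ.* 1) (d ℕ.* suc k) (d ℕ.* suc (suc k)) (gauss d k 1) oneS (*-suc-suc d k) N) ⟨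
  oneS N + shift (d ℕ.* 1) (gauss d k 1 ⊕ shift (d ℕ.* suc k) oneS) N ∎
  where
  open ≡-Reasoning
gauss-pascal d (suc k) (suc l) N = begin
  gauss d (suc k) (suc (suc l)) N + shift a (gauss d (suc (suc k)) (suc l)) N
    ≡⟨ cong₂ _+_ (gauss-pascal d k (suc l) N) (shift-cong a (gauss-pascal d (suc k) l) N) ⟩
  X N + shift b (gauss d k (suc (suc l))) N + shift a (gauss d (suc (suc k)) l ⊕ shift (d ℕ.* suc l) X) N
    ≡⟨ cong (_+_ (X N + shift b (gauss d k (suc (suc l))) N))
         (shift-⊕-shift a (d ℕ.* suc l) c (gauss d (suc (suc k)) l) X (exponent₁ d k l) N) ⟩
  X N + shift b (gauss d k (suc (suc l))) N + (shift a (gauss d (suc (suc k)) l) N + shift c X N)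
    ≡⟨ +-interchange (X N) (shift b (gauss d k (suc (suc l))) N) (shift a (gauss d (suc (suc k)) l) N) (shift c X N) ⟩
  X N + shift a (gauss d (suc (suc k)) l) N + (shift b (gauss d k (suc (suc l))) N + shift c X N)
    ≡⟨ cong (_+_ (X N + shift a (gauss d (suc (suc k)) l) N))
         (shift-⊕-shift b (d ℕ.* suc k) c (gauss d k (suc (suc l))) X (exponent₂ d k l) N) ⟨
  gauss d (suc (suc k)) (suc l) N + shift b (gauss d (suc k) (suc (suc l))) N ∎
  where
  open ≡-Reasoning
  X = gauss d (suc k) (suc l)
  a = d ℕ.* suc (suc k)
  b = d ℕ.* suc (suc l)
  c = d ℕ.* suc (suc (suc (k ℕ.+ l)))
  exponent₁ : ∀ d k l → d ℕ.* suc (suc k) ℕ.+ d ℕ.* suc l ≡ d ℕ.* suc (suc (suc (k ℕ.+ l)))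
  exponent₁ = ℕ-Ring.solve-∀
  exponent₂ : ∀ d k l → d ℕ.* suc (suc l) ℕ.+ d ℕ.* suc k ≡ d ℕ.* suc (suc (suc (k ℕ.+ l)))
  exponent₂ = ℕ-Ring.solve-∀

gauss-zeroʳ : ∀ d k → gauss d k zero ≗ oneS
gauss-zeroʳ d zero    N = refl
gauss-zeroʳ d (suc k) N = refl

gauss-sym : ∀ d k l → gauss d k l ≗ gauss d l k
gauss-sym d zero    l       N = sym (gauss-zeroʳ d l N)
gauss-sym d (suc k) zero    N = refl
gauss-sym d (suc k) (suc l) N = trans
  (cong₂ _+_ (gauss-sym d k (suc l) N) (shift-cong (d ℕ.* suc k) (gauss-sym d (suc k) l) N))
  (sym (gauss-pascal d l k N))

agree-one : ∀ c d .{{_ : NonZero d}} n → Agree 0 (prodBelow (λ i → oneMinusQ^ (suc c ℕ.+ d ℕ.* i)) n) oneS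
agree-one c d n i i≤0 = trans
  (prod-agree 0 n (λ j k k≤0 → poch-unit c d j k (ℕ.≤-trans k≤0 z≤n)) i i≤0)
  (prod-one n (λ _ _ → refl) i)

-- The product is that of 1 - q^{dj} over l < j ≤ l + k, hence 1 modulo q^{l+1}. The congruence is
-- proved without this closed form: in the Pascal recursion the two summands contribute 1 -
-- q^{d(k+1)} and q^{d(k+1)}.
gauss-⊛-prod : ∀ d₀ k l → let d = suc d₀ in
  Agree l (gauss d k l ⊛ prodBelow (λ i → oneMinusQ^ (d ℕ.+ d ℕ.* i)) k) oneS
gauss-⊛-prod d₀ zero    l    i i≤l = ⊛-identityˡ oneS i
gauss-⊛-prod d₀ (suc k) zero i i≤0 = trans
  (⊛-identityˡ (prodBelow (λ i → oneMinusQ^ (suc d₀ ℕ.+ suc d₀ ℕ.* i)) (suc k)) i)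
  (agree-one d₀ (suc d₀) (suc k) i i≤0)
gauss-⊛-prod d₀ (suc k) (suc l) i i≤1+l = begin
  ((G₁ ⊕ shift (d ℕ.* suc k) G₂) ⊛ (Φ ⊛ φ)) i
    ≡⟨ cong (λ e → ((G₁ ⊕ shift e G₂) ⊛ (Φ ⊛ φ)) i) (ℕ.*-suc d k) ⟩
  ((G₁ ⊕ shift a G₂) ⊛ (Φ ⊛ φ)) i
    ≡⟨ ⊛-distribʳ-⊕ (Φ ⊛ φ) G₁ (shift a G₂) i ⟩
  (G₁ ⊛ (Φ ⊛ φ)) i + (shift a G₂ ⊛ (Φ ⊛ φ)) i
    ≡⟨ cong₂ _+_ (sym (⊛-assoc G₁ Φ φ i)) (shift-⊛ a G₂ (Φ ⊛ φ) i) ⟩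
  ((G₁ ⊛ Φ) ⊛ φ) i + shift a (G₂ ⊛ (Φ ⊛ φ)) i
    ≡⟨ cong₂ _+_
         (⊛-agree (suc l) {g = φ} (gauss-⊛-prod d₀ k (suc l)) (λ _ _ → refl) i i≤1+l)
         -- The shift by a ≥ 1 raises the precision from l to at least l + 1.
         (shift-agree a l (gauss-⊛-prod d₀ (suc k) l) i (ℕ.≤-trans i≤1+l (s≤s (ℕ.m≤n+m l (d₀ ℕ.+ d ℕ.* k))))) ⟩
  (oneS ⊛ φ) i + shift a oneS i
    ≡⟨ cong (_+ shift a oneS i) (⊛-oneMinusQ^ (d₀ ℕ.+ d ℕ.* k) oneS i) ⟩
  oneS i - shift a oneS i + shift a oneS i
    ≡⟨ x-y+y≡x (oneS i) (shift a oneS i) ⟩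
  oneS i ∎
  where
  open ≡-Reasoning
  d = suc d₀
  a = d ℕ.+ d ℕ.* k
  Φ = prodBelow (λ i → oneMinusQ^ (d ℕ.+ d ℕ.* i)) k
  φ = oneMinusQ^ a
  G₁ = gauss d k (suc l)
  G₂ = gauss d (suc k) l

gauss-⊛-poch : ∀ d₀ k l N → N ℕ.< k → N ℕ.≤ l → Agree N (gauss (suc d₀) k l ⊛ poch (suc d₀) (suc d₀)) oneS
gauss-⊛-poch d₀ k l N N<k N≤l i i≤N = trans
  (⊛-agree N {f = gauss (suc d₀) k l} (λ _ _ → refl) (infProd-agree (poch-unit d₀ (suc d₀)) N k N<k) i i≤N)
  (gauss-⊛-prod d₀ k l i (ℕ.≤-trans i≤N N≤l))

-- Extension by zero to negative entries, which lets the index of the triple product run over all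
-- integers.
gaussℤ : ℕ → ℤ → ℤ → Series
gaussℤ d (+ k) (+ l) = gauss d k l
gaussℤ d _     _     = λ _ → 0ℤ

gaussℤ-sym : ∀ d k l → gaussℤ d k l ≗ gaussℤ d l k
gaussℤ-sym d (+ k)    (+ l)    = gauss-sym d k l
gaussℤ-sym d (+ k)    -[1+ l ] = λ _ → refl
gaussℤ-sym d -[1+ k ] (+ l)    = λ _ → refl
gaussℤ-sym d -[1+ k ] -[1+ l ] = λ _ → refl

-- The hypothesis on K + l excludes K = l = 0, where the left side is 1 and both terms on the right
-- vanish by the convention for negative entries.
gaussℤ-pascal : ∀ d K l s → K + + l ≡ + suc s →
  gaussℤ d K (+ l) ≗ gaussℤ d K (ℤ.pred (+ l)) ⊕ shift (d ℕ.* l) (gaussℤ d (ℤ.pred K) (+ l))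
gaussℤ-pascal d -[1+ k ]    zero    s eq N = sym (trans (ℤ.+-identityˡ _) (shift-zero (d ℕ.* 0) (λ _ → refl) N))
gaussℤ-pascal d -[1+ k ]    (suc l) s eq N = sym (trans (ℤ.+-identityˡ _) (shift-zero (d ℕ.* suc l) (λ _ → refl) N))
gaussℤ-pascal d (+ zero)    zero    s () N
gaussℤ-pascal d (+ zero)    (suc l) s eq N = sym (trans (cong (_+_ (oneS N)) (shift-zero (d ℕ.* suc l) (λ _ → refl) N)) (ℤ.+-identityʳ (oneS N)))
gaussℤ-pascal d (+ (suc k)) zero    s eq N = sym (trans (ℤ.+-identityˡ _)
  (trans (cong (λ e → shift e (gauss d k 0) N) (ℕ.*-zeroʳ d)) (gauss-zeroʳ d k N)))
gaussℤ-pascal d (+ (suc k)) (suc l) s eq N = gauss-pascal d k l N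

-- The Jacobi triple product

altℕ : ℕ → ℤ
altℕ zero    = 1ℤ
altℕ (suc n) = - altℕ n

alt : ℤ → ℤ
alt n = altℕ ∣ n ∣

alt-pred : ∀ n → alt (ℤ.pred n) ≡ - alt n
alt-pred (+ zero)    = refl
alt-pred (+ (suc n)) = sym (ℤ.neg-involutive (altℕ n))
alt-pred -[1+ n ]    = refl

tri : ℕ → ℕ
tri zero    = zero
tri (suc n) = n ℕ.+ tri n

-- For c + c′ = d this is d n (n - 1) / 2 + c n.
expo : ℕ → ℕ → ℕ → ℤ → ℕ
expo d c c′ (+ n)    = d ℕ.* tri n ℕ.+ c ℕ.* n
expo d c c′ -[1+ n ] = d ℕ.* tri (suc n) ℕ.+ c′ ℕ.* suc n

expo-neg : ∀ d c c′ n → expo d c c′ (- n) ≡ expo d c′ c n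
expo-neg d c c′ (+ zero)    = cong (d ℕ.* 0 ℕ.+_) (trans (ℕ.*-zeroʳ c) (sym (ℕ.*-zeroʳ c′)))
expo-neg d c c′ (+ (suc n)) = refl
expo-neg d c c′ -[1+ n ]    = refl

expo-≥ : ∀ d c₀ c₁ n → ∣ n ∣ ℕ.≤ expo d (suc c₀) (suc c₁) n
expo-≥ d c₀ c₁ (+ n)    = ℕ.≤-trans (ℕ.m≤n*m n (suc c₀)) (ℕ.m≤n+m _ (d ℕ.* tri n))
expo-≥ d c₀ c₁ -[1+ n ] = ℕ.≤-trans (ℕ.m≤n*m (suc n) (suc c₁)) (ℕ.m≤n+m _ (d ℕ.* tri (suc n)))

-- The exponent is quadratic with difference c + d (n - 1) between n - 1 and n, and d j = d (m + 1 -
-- n) makes up for the rest.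
expo-pred : ∀ d c c′ → c ℕ.+ c′ ≡ d → ∀ m n j → + suc m - n ≡ + j →
  (c ℕ.+ d ℕ.* m) ℕ.+ expo d c c′ (ℤ.pred n) ≡ d ℕ.* j ℕ.+ expo d c c′ n
expo-pred d c c′ refl m (+ zero) j eq with ℤ.+-injective (trans (sym (ℤ.+-identityʳ (+ suc m))) eq)
... | refl = identity c c′ m
  where
  identity : ∀ c c′ m → (c ℕ.+ (c ℕ.+ c′) ℕ.* m) ℕ.+ ((c ℕ.+ c′) ℕ.* 0 ℕ.+ c′ ℕ.* 1)
                      ≡ (c ℕ.+ c′) ℕ.* suc m ℕ.+ ((c ℕ.+ c′) ℕ.* 0 ℕ.+ c ℕ.* 0)
  identity = ℕ-Ring.solve-∀
expo-pred d c c′ refl m (+ (suc p)) j eq with ℕ.suc-injective (trans (ℤ.+-injective (move (+ suc m) (+ suc p) (+ j) eq)) (ℕ.+-suc j p))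
  where
  move : ∀ a b c → a - b ≡ c → a ≡ c + b
  move a b c refl = sym (x-y+y≡x a b)
... | refl = identity c c′ j p (tri p)
  where
  identity : ∀ c c′ j p t → (c ℕ.+ (c ℕ.+ c′) ℕ.* (j ℕ.+ p)) ℕ.+ ((c ℕ.+ c′) ℕ.* t ℕ.+ c ℕ.* p)
                          ≡ (c ℕ.+ c′) ℕ.* j ℕ.+ ((c ℕ.+ c′) ℕ.* (p ℕ.+ t) ℕ.+ c ℕ.* suc p)
  identity = ℕ-Ring.solve-∀
expo-pred d c c′ refl m -[1+ p ] j eq with ℤ.+-injective eq
... | refl = identity c c′ m p (tri p)
  where
  identity : ∀ c c′ m p t →
    (c ℕ.+ (c ℕ.+ c′) ℕ.* m) ℕ.+ ((c ℕ.+ c′) ℕ.* (suc p ℕ.+ (p ℕ.+ t)) ℕ.+ c′ ℕ.* suc (suc p))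
    ≡ (c ℕ.+ c′) ℕ.* (suc m ℕ.+ suc p) ℕ.+ ((c ℕ.+ c′) ℕ.* (p ℕ.+ t) ℕ.+ c′ ℕ.* suc p)
  identity = ℕ-Ring.solve-∀

-- The summand of the finite triple product ∏_{i<m} (1 - q^{c+di}) ∏_{i<l} (1 - q^{c′+di}).
jacobiTerm : (d c c′ m l : ℕ) → ℤ → Series
jacobiTerm d c c′ m l n N = alt n * shift (expo d c c′ n) (gaussℤ d (+ l + n) (+ m - n)) N

jacobiTerm-≢0 : ∀ d c c′ m l n N → jacobiTerm d c c′ m l n N ≢ 0ℤ → ∃ λ k → ∃ λ j → + l + n ≡ + k × + m - n ≡ + j
jacobiTerm-≢0 d c c′ m l n N nz with + l + n | + m - n
... | + k      | + j      = k , j , refl , refl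
... | + k      | -[1+ j ] = contradiction (trans (cong (alt n *_) (shift-zero (expo d c c′ n) (λ _ → refl) N)) (ℤ.*-zeroʳ (alt n))) nz
... | -[1+ k ] | _        = contradiction (trans (cong (alt n *_) (shift-zero (expo d c c′ n) (λ _ → refl) N)) (ℤ.*-zeroʳ (alt n))) nz

-- Nonzero terms have - l ≤ n ≤ m. The bound on n + 1 is included because a new factor moves terms
-- from index n to n + 1, which must stay in the range of summation.
jacobiTerm-support : ∀ d c c′ m l n N → jacobiTerm d c c′ m l n N ≢ 0ℤ →
  ∀ B → suc m ℕ.≤ B → l ℕ.≤ B → ∣ n ∣ ℕ.≤ B × ∣ ℤ.suc n ∣ ℕ.≤ B
jacobiTerm-support d c c′ m l (+ p) N nz B m<B l≤B with jacobiTerm-≢0 d c c′ m l (+ p) N nz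
... | _ , j , _ , eq = ℕ.≤-trans p≤m (ℕ.≤-trans (ℕ.n≤1+n m) m<B) , ℕ.≤-trans (s≤s p≤m) m<B
  where
  p≤m : p ℕ.≤ m
  p≤m = subst (p ℕ.≤_) (sym (ℤ.+-injective (trans (sym (x-y+y≡x (+ m) (+ p))) (cong (_+ + p) eq)))) (ℕ.m≤n+m p j)
jacobiTerm-support d c c′ m l -[1+ p ] N nz B m<B l≤B with jacobiTerm-≢0 d c c′ m l -[1+ p ] N nz
... | k , _ , eq , _ = ℕ.≤-trans p<l l≤B , subst (ℕ._≤ B) (sym suc-p) (ℕ.≤-trans (ℕ.n≤1+n p) (ℕ.≤-trans p<l l≤B))
  where
  p<l : suc p ℕ.≤ l
  p<l = subst (suc p ℕ.≤_) (sym (ℤ.+-injective (trans (sym (x-y+y≡x (+ l) (+ suc p))) (cong (_+ + suc p) eq)))) (ℕ.m≤n+m (suc p) k)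
  suc-p : ∣ ℤ.suc -[1+ p ] ∣ ≡ p
  suc-p = trans (cong ∣_∣ (ℤ.1-[1+n]≡-n p)) (ℤ.∣-i∣≡∣i∣ (+ p))

-- Pascal's rule splits the binomial. One part is the term for m; by `expo-pred` the other is the
-- term of index n - 1 times q^{c+dm}, with the sign of (- 1)^n reversed.
jacobiTerm-step : ∀ d c c′ → c ℕ.+ c′ ≡ d → ∀ m l n N →
  jacobiTerm d c c′ (suc m) l n N
    ≡ jacobiTerm d c c′ m l n N - shift (c ℕ.+ d ℕ.* m) (jacobiTerm d c c′ m l (ℤ.pred n)) N
jacobiTerm-step d c c′ c+c′≡d m l n N = begin
  alt n * shift e (gaussℤ d K (+ suc m - n)) N
    ≡⟨ cong (alt n *_) (pascal (+ suc m - n) refl) ⟩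
  alt n * (shift e (gaussℤ d K (ℤ.pred (+ suc m - n))) N + shift (a ℕ.+ e′) (gaussℤ d (ℤ.pred K) (+ suc m - n)) N)
    ≡⟨ cong (λ z → alt n * (shift e (gaussℤ d K z) N + shift (a ℕ.+ e′) (gaussℤ d (ℤ.pred K) (+ suc m - n)) N))
         (pred-diff (+ m) n) ⟩
  alt n * (shift e (gaussℤ d K (+ m - n)) N + shift (a ℕ.+ e′) (gaussℤ d (ℤ.pred K) (+ suc m - n)) N)
    ≡⟨ distrib (alt n) (shift e (gaussℤ d K (+ m - n)) N) (shift (a ℕ.+ e′) (gaussℤ d (ℤ.pred K) (+ suc m - n)) N) ⟩
  alt n * shift e (gaussℤ d K (+ m - n)) N - (- alt n) * shift (a ℕ.+ e′) (gaussℤ d (ℤ.pred K) (+ suc m - n)) N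
    ≡⟨ cong (_-_ (alt n * shift e (gaussℤ d K (+ m - n)) N)) tail ⟩
  alt n * shift e (gaussℤ d K (+ m - n)) N - shift a (jacobiTerm d c c′ m l (ℤ.pred n)) N ∎
  where
  open ≡-Reasoning
  K = + l + n
  a = c ℕ.+ d ℕ.* m
  e = expo d c c′ n
  e′ = expo d c c′ (ℤ.pred n)
  pred-diff : ∀ m n → -1ℤ + (1ℤ + m - n) ≡ m - n
  pred-diff = solve-∀
  pred-sum : ∀ l n → l + (-1ℤ + n) ≡ -1ℤ + (l + n)
  pred-sum = solve-∀
  diff-pred : ∀ m n → m - (-1ℤ + n) ≡ 1ℤ + m - n
  diff-pred = solve-∀
  total : ∀ l m n → (l + n) + (1ℤ + m - n) ≡ 1ℤ + (l + m)
  total = solve-∀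
  distrib : ∀ s x y → s * (x + y) ≡ s * x - (- s) * y
  distrib = solve-∀
  zeros : ∀ k → shift k (λ _ → 0ℤ) N ≡ 0ℤ
  zeros k = shift-zero k (λ _ → refl) N
  gaussℤ-negʳ : ∀ K j → gaussℤ d K -[1+ j ] ≡ (λ _ → 0ℤ)
  gaussℤ-negʳ (+ _)    j = refl
  gaussℤ-negʳ -[1+ _ ] j = refl
  pascal : ∀ J → + suc m - n ≡ J → shift e (gaussℤ d K J) N
    ≡ shift e (gaussℤ d K (ℤ.pred J)) N + shift (a ℕ.+ e′) (gaussℤ d (ℤ.pred K) J) N
  pascal -[1+ j ] eq = trans (vanish e K j) (sym (cong₂ _+_ (vanish e K (suc j)) (vanish (a ℕ.+ e′) (ℤ.pred K) j)))
    where
    vanish : ∀ k K j → shift k (gaussℤ d K -[1+ j ]) N ≡ 0ℤ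
    vanish k K j = trans (cong (λ f → shift k f N) (gaussℤ-negʳ K j)) (zeros k)
  pascal (+ j) eq = trans
    (shift-cong e (gaussℤ-pascal d K j (l ℕ.+ m) (trans (cong (_+_ K) (sym eq)) (total (+ l) (+ m) n))) N)
    (shift-⊕-shift e (d ℕ.* j) (a ℕ.+ e′) (gaussℤ d K (ℤ.pred (+ j))) (gaussℤ d (ℤ.pred K) (+ j))
      (trans (ℕ.+-comm e (d ℕ.* j)) (sym (expo-pred d c c′ c+c′≡d m n j eq))) N)
  tail : (- alt n) * shift (a ℕ.+ e′) (gaussℤ d (ℤ.pred K) (+ suc m - n)) N
       ≡ shift a (jacobiTerm d c c′ m l (ℤ.pred n)) N
  tail = begin
    (- alt n) * shift (a ℕ.+ e′) (gaussℤ d (ℤ.pred K) (+ suc m - n)) N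
      ≡⟨ cong₂ _*_ (sym (alt-pred n)) (cong₂ (λ x y → shift (a ℕ.+ e′) (gaussℤ d x y) N)
           (sym (pred-sum (+ l) n)) (sym (diff-pred (+ m) n))) ⟩
    alt (ℤ.pred n) * shift (a ℕ.+ e′) (gaussℤ d (+ l + ℤ.pred n) (+ m - ℤ.pred n)) N
      ≡⟨ cong (alt (ℤ.pred n) *_) (sym (shift-shift a e′ (gaussℤ d (+ l + ℤ.pred n) (+ m - ℤ.pred n)) N)) ⟩
    alt (ℤ.pred n) * shift a (shift e′ (gaussℤ d (+ l + ℤ.pred n) (+ m - ℤ.pred n))) N
      ≡⟨ sym (shift-scale a (alt (ℤ.pred n)) (shift e′ (gaussℤ d (+ l + ℤ.pred n) (+ m - ℤ.pred n))) N) ⟩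
    shift a (jacobiTerm d c c′ m l (ℤ.pred n)) N ∎

partialPoch : ℕ → ℕ → ℕ → Series
partialPoch c d = prodBelow (λ i → oneMinusQ^ (c ℕ.+ d ℕ.* i))

-- Cauchy's finite form of the triple product. The range `B` does not depend on m and l, so that
-- sums for successive m can be compared termwise.
FiniteJacobi : (B d c c′ m l : ℕ) → Set
FiniteJacobi B d c c′ m l =
  partialPoch c d m ⊛ partialPoch c′ d l ≗ (λ N → sumℤ B (λ n → jacobiTerm d c c′ m l n N))

finiteJacobi-zero : ∀ B d c c′ → FiniteJacobi B d c c′ 0 0
finiteJacobi-zero B d c c′ N = trans (⊛-identityˡ oneS N) (sym (trans
  (sumℤ-single B 0ℤ (λ n → jacobiTerm d c c′ 0 0 n N) z≤n others)
  (trans (ℤ.*-identityˡ _) (cong (λ e → shift e oneS N) (cong₂ ℕ._+_ (ℕ.*-zeroʳ d) (ℕ.*-zeroʳ c))))))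
  where
  others : ∀ n → n ≢ 0ℤ → jacobiTerm d c c′ 0 0 n N ≡ 0ℤ
  others (+ zero)    n≢0 = contradiction refl n≢0
  others (+ (suc p)) n≢0 = trans (cong (alt (+ suc p) *_) (shift-zero (expo d c c′ (+ suc p)) (λ _ → refl) N)) (ℤ.*-zeroʳ (alt (+ suc p)))
  others -[1+ p ]    n≢0 = trans (cong (alt -[1+ p ] *_) (shift-zero (expo d c c′ -[1+ p ]) (λ _ → refl) N)) (ℤ.*-zeroʳ (alt -[1+ p ]))

finiteJacobi-suc : ∀ B d c₀ c′ → suc c₀ ℕ.+ c′ ≡ d → ∀ m l → suc m ℕ.≤ B → l ℕ.≤ B →
  FiniteJacobi B d (suc c₀) c′ m l → FiniteJacobi B d (suc c₀) c′ (suc m) l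
finiteJacobi-suc B d c₀ c′ c+c′≡d m l m<B l≤B hyp N = begin
  ((P ⊛ φ) ⊛ P′) N
    ≡⟨ ⊛-Solver.solve 3 (λ x y z → (x :⊛ y) :⊛ z ⊜ (x :⊛ z) :⊛ y) (λ _ → refl) P φ P′ N ⟩
  ((P ⊛ P′) ⊛ φ) N
    ≡⟨ ⊛-congʳ φ hyp N ⟩
  (S ⊛ φ) N
    ≡⟨ ⊛-oneMinusQ^ (c₀ ℕ.+ d ℕ.* m) S N ⟩
  S N - shift a S N
    ≡⟨ cong (_-_ (S N)) (trans (shift-sum a (suc (B ℕ.+ B)) (λ i → T (i ⊖ B)) N) (sym shifted)) ⟩
  S N - sumℤ B (λ n → shift a (T (ℤ.pred n)) N)
    ≡⟨ cong (_+_ (S N)) (sym (trans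
         (sumℤ-cong′ B (λ n → sym (ℤ.-1*i≡-i (shift a (T (ℤ.pred n)) N))))
         (trans (sumℤ-*ˡ B -1ℤ (λ n → shift a (T (ℤ.pred n)) N)) (ℤ.-1*i≡-i _)))) ⟩
  S N + sumℤ B (λ n → - shift a (T (ℤ.pred n)) N)
    ≡⟨ sym (sumℤ-+ B (λ n → T n N) (λ n → - shift a (T (ℤ.pred n)) N)) ⟩
  sumℤ B (λ n → T n N - shift a (T (ℤ.pred n)) N)
    ≡⟨ sumℤ-cong′ B (λ n → sym (jacobiTerm-step d (suc c₀) c′ c+c′≡d m l n N)) ⟩
  sumℤ B (λ n → jacobiTerm d (suc c₀) c′ (suc m) l n N) ∎
  where
  open ≡-Reasoning
  a = suc c₀ ℕ.+ d ℕ.* m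
  P = partialPoch (suc c₀) d m
  P′ = partialPoch c′ d l
  φ = oneMinusQ^ a
  T = jacobiTerm d (suc c₀) c′ m l
  S : Series
  S M = sumℤ B (λ n → T n M)
  support : ∀ n → shift a (T n) N ≢ 0ℤ → ∣ n ∣ ℕ.≤ B × ∣ ℤ.suc n ∣ ℕ.≤ B
  support n nz with a ℕ.≤? N
  ... | no a≰N  = contradiction (shift-below a (T n) N (ℕ.≰⇒> a≰N)) nz
  ... | yes a≤N = jacobiTerm-support d (suc c₀) c′ m l n (N ℕ.∸ a)
    (λ eq → nz (trans (cong (shift a (T n)) (sym (ℕ.m+[n∸m]≡n a≤N))) (trans (shift-above a (T n) (N ℕ.∸ a)) eq)))
    B m<B l≤B
  shifted : sumℤ B (λ n → shift a (T (ℤ.pred n)) N) ≡ sumℤ B (λ n → shift a (T n) N)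
  shifted = sumℤ-reindex B B (λ n → shift a (T n) N) ℤ.pred
    (λ j k eq → trans (sym (ℤ.suc-pred j)) (trans (cong ℤ.suc eq) (ℤ.suc-pred k)))
    (λ u nz → ℤ.suc u , proj₂ (support u nz) , ℤ.pred-suc u)
    (λ k nz → proj₁ (support (ℤ.pred k) nz))

-- The substitution n ↦ - n exchanges the two progressions, so an induction step in m alone serves
-- for both factors.
finiteJacobi-sym : ∀ B d c c′ m l → FiniteJacobi B d c c′ m l → FiniteJacobi B d c′ c l m
finiteJacobi-sym B d c c′ m l hyp N = begin
  (partialPoch c′ d l ⊛ partialPoch c d m) N
    ≡⟨ ⊛-comm (partialPoch c′ d l) (partialPoch c d m) N ⟩
  (partialPoch c d m ⊛ partialPoch c′ d l) N
    ≡⟨ hyp N ⟩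
  sumℤ B (λ n → jacobiTerm d c c′ m l n N)
    ≡⟨ sumℤ-neg B (λ n → jacobiTerm d c c′ m l n N) ⟨
  sumℤ B (λ n → jacobiTerm d c c′ m l (- n) N)
    ≡⟨ sumℤ-cong′ B flip ⟩
  sumℤ B (λ n → jacobiTerm d c′ c l m n N) ∎
  where
  open ≡-Reasoning
  flip : ∀ n → jacobiTerm d c c′ m l (- n) N ≡ jacobiTerm d c′ c l m n N
  flip n = cong₂ _*_ (cong altℕ (ℤ.∣-i∣≡∣i∣ n)) (begin
    shift (expo d c c′ (- n)) (gaussℤ d (+ l - n) (+ m - - n)) N
      ≡⟨ cong₂ (λ e y → shift e (gaussℤ d (+ l - n) (+ m + y)) N) (expo-neg d c c′ n) (ℤ.neg-involutive n) ⟩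
    shift (expo d c′ c n) (gaussℤ d (+ l - n) (+ m + n)) N
      ≡⟨ shift-cong (expo d c′ c n) (gaussℤ-sym d (+ l - n) (+ m + n)) N ⟩
    shift (expo d c′ c n) (gaussℤ d (+ m + n) (+ l - n)) N ∎)

finiteJacobi : ∀ B d c₀ c₁ → suc c₀ ℕ.+ suc c₁ ≡ d → ∀ m l → m ℕ.≤ B → l ℕ.≤ B →
  FiniteJacobi B d (suc c₀) (suc c₁) m l
finiteJacobi B d c₀ c₁ hyp zero zero    _   _   = finiteJacobi-zero B d (suc c₀) (suc c₁)
finiteJacobi B d c₀ c₁ hyp zero (suc l) _   l<B =
  finiteJacobi-sym B d (suc c₁) (suc c₀) (suc l) 0
    (finiteJacobi-suc B d c₁ (suc c₀) (trans (ℕ.+-comm (suc c₁) (suc c₀)) hyp) l 0 l<B z≤n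
      (finiteJacobi-sym B d (suc c₀) (suc c₁) 0 l
        (finiteJacobi B d c₀ c₁ hyp zero l z≤n (ℕ.≤-trans (ℕ.n≤1+n l) l<B))))
finiteJacobi B d c₀ c₁ hyp (suc m) l m<B l≤B =
  finiteJacobi-suc B d c₀ (suc c₁) hyp m l m<B l≤B
    (finiteJacobi B d c₀ c₁ hyp m l (ℕ.≤-trans (ℕ.n≤1+n m) m<B) l≤B)

sum-⊛ : ∀ n (F : ℕ → Series) g N → ((λ M → sumBelow n (λ i → F i M)) ⊛ g) N ≡ sumBelow n (λ i → (F i ⊛ g) N)
sum-⊛ zero    F g N = sum-zero (suc N) (λ _ _ → refl)
sum-⊛ (suc n) F g N = trans (⊛-distribʳ-⊕ g (λ M → sumBelow n (λ i → F i M)) (F n) N)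
  (cong (_+ (F n ⊛ g) N) (sum-⊛ n F g N))

-- Take m = l = B in the finite product. After multiplication by (q^d;q^d) each Gaussian binomial
-- becomes 1 to the precision that the coefficient of q^N can see.
jacobi : ∀ d₀ c₀ c₁ → suc c₀ ℕ.+ suc c₁ ≡ suc d₀ → ∀ N B → N ℕ.< B →
  (poch (suc c₀) (suc d₀) ⊛ poch (suc c₁) (suc d₀) ⊛ poch (suc d₀) (suc d₀)) N
    ≡ sumℤ B (λ n → alt n * 𝟙 (N ℕ.≟ expo (suc d₀) (suc c₀) (suc c₁) n))
jacobi d₀ c₀ c₁ hyp N B N<B = begin
  (poch c d ⊛ poch c′ d ⊛ poch d d) N
    ≡⟨ ⊛-agree N {g = poch d d} (⊛-agree N (infProd-agree (poch-unit c₀ d) N B N<B) (infProd-agree (poch-unit c₁ d) N B N<B))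
         (λ _ _ → refl) N ℕ.≤-refl ⟩
  ((partialPoch c d B ⊛ partialPoch c′ d B) ⊛ poch d d) N
    ≡⟨ ⊛-congʳ (poch d d) (finiteJacobi B d c₀ c₁ hyp B B ℕ.≤-refl ℕ.≤-refl) N ⟩
  ((λ M → sumℤ B (λ n → T n M)) ⊛ poch d d) N
    ≡⟨ sum-⊛ (suc (B ℕ.+ B)) (λ i → T (i ⊖ B)) (poch d d) N ⟩
  sumℤ B (λ n → (T n ⊛ poch d d) N)
    ≡⟨ sumℤ-cong B (λ n n≤B → trans (⊛-scale (alt n) (shift (e n) (G n)) (poch d d) N)
         (cong (alt n *_) (trans (shift-⊛ (e n) (G n) (poch d d) N) (trans (limit n n≤B) (shift-one (e n) N))))) ⟩
  sumℤ B (λ n → alt n * 𝟙 (N ℕ.≟ e n)) ∎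
  where
  open ≡-Reasoning
  d = suc d₀
  c = suc c₀
  c′ = suc c₁
  T = jacobiTerm d c c′ B B
  e = expo d c c′
  G : ℤ → Series
  G n = gaussℤ d (+ B + n) (+ B - n)
  -- Both entries B + n and B - n of the binomial exceed r. For r = N - e n this is available
  -- because ∣ n ∣ ≤ e n, so that r + ∣ n ∣ ≤ N < B.
  agree : ∀ n → ∣ n ∣ ℕ.≤ B → ∀ r → r ℕ.+ ∣ n ∣ ℕ.< B → Agree r (G n ⊛ poch d d) oneS
  agree (+ p) p≤B r r+p<B = subst (λ z → Agree r (gaussℤ d (+ (B ℕ.+ p)) z ⊛ poch d d) oneS)
    (sym (trans (ℤ.m-n≡m⊖n B p) (ℤ.⊖-≥ p≤B)))
    (gauss-⊛-poch d₀ (B ℕ.+ p) (B ℕ.∸ p) r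
      (ℕ.<-≤-trans (ℕ.≤-<-trans (ℕ.m≤m+n r p) r+p<B) (ℕ.m≤m+n B p))
      (ℕ.m+n≤o⇒m≤o∸n r (ℕ.<⇒≤ r+p<B)))
  agree -[1+ p ] p<B r r+p<B = subst (λ z → Agree r (gaussℤ d z (+ (B ℕ.+ suc p)) ⊛ poch d d) oneS)
    (sym (ℤ.⊖-≥ p<B))
    (gauss-⊛-poch d₀ (B ℕ.∸ suc p) (B ℕ.+ suc p) r
      (ℕ.m+n≤o⇒m≤o∸n (suc r) r+p<B)
      (ℕ.≤-trans (ℕ.≤-trans (ℕ.m≤m+n r (suc p)) (ℕ.<⇒≤ r+p<B)) (ℕ.m≤m+n B (suc p))))
  limit : ∀ n → ∣ n ∣ ℕ.≤ B → shift (e n) (G n ⊛ poch d d) N ≡ shift (e n) oneS N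
  limit n n≤B with e n ℕ.≤? N
  ... | no e≰N  = trans (shift-below (e n) (G n ⊛ poch d d) N (ℕ.≰⇒> e≰N)) (sym (shift-below (e n) oneS N (ℕ.≰⇒> e≰N)))
  ... | yes e≤N = shift-agree (e n) r (agree n n≤B r r+n<B) N (ℕ.≤-reflexive (sym (ℕ.m+[n∸m]≡n e≤N)))
    where
    r = N ℕ.∸ e n
    r+n<B : r ℕ.+ ∣ n ∣ ℕ.< B
    r+n<B = ℕ.≤-<-trans (ℕ.≤-trans (ℕ.+-monoʳ-≤ r (expo-≥ d c₀ c₁ n)) (ℕ.≤-reflexive (ℕ.m∸n+n≡m e≤N))) N<B

-- Periodic functions on ℤ

remainder-unique : ∀ m r s x y → r ℕ.< m → s ℕ.< m → + r + x * + m ≡ + s + y * + m → r ≡ s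
remainder-unique m r s x y r<m s<m eq with ∣ y - x ∣ in ∣y-x∣
... | zero = ℤ.+-injective (+ℤ.∙-cancelʳ (x * + m) (+ r) (+ s)
  (trans eq (cong (λ z → + s + z * + m) (ℤ.i-j≡0⇒i≡j y x (ℤ.∣i∣≡0⇒i≡0 ∣y-x∣)))))
... | suc k = contradiction (ℕ.≤-<-trans m≤∣r-s∣ (ℕ.≤-<-trans (ℤ.∣m⊝n∣≤m⊔n r s) (ℕ.⊔-lub r<m s<m))) (ℕ.<-irrefl refl)
  where
  difference : ∀ r s x y m → r + x * m ≡ s + y * m → r - s ≡ (y - x) * m
  difference r s x y m eq = trans (left r x m s) (trans (cong (λ z → z - x * m - s) eq) (right s y m x))
    where
    left : ∀ r x m s → r - s ≡ r + x * m - x * m - s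
    left = solve-∀
    right : ∀ s y m x → s + y * m - x * m - s ≡ (y - x) * m
    right = solve-∀
  m≤∣r-s∣ : m ℕ.≤ ∣ r ⊖ s ∣
  m≤∣r-s∣ = subst (m ℕ.≤_)
    (trans (cong (ℕ._* m) (sym ∣y-x∣)) (trans (sym (ℤ.abs-* (y - x) (+ m)))
      (cong ∣_∣ (trans (sym (difference (+ r) (+ s) x y (+ m) eq)) (ℤ.m-n≡m⊖n r s)))))
    (ℕ.m≤n*m m (suc k))

%ℕ-periodic : ∀ m .{{_ : NonZero m}} z k → (z + k * + m) %ℕ m ≡ z %ℕ m
%ℕ-periodic m z k = remainder-unique m _ _ ((z + k * + m) /ℕ m) (z /ℕ m + k) (n%ℕd<d (z + k * + m) m) (n%ℕd<d z m)
  (trans (sym (a≡a%ℕn+[a/ℕn]*n (z + k * + m) m))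
    (trans (cong (_+ k * + m) (a≡a%ℕn+[a/ℕn]*n z m)) (collect (+ (z %ℕ m)) (z /ℕ m) k (+ m))))
  where
  collect : ∀ r q k m → r + q * m + k * m ≡ r + (q + k) * m
  collect = solve-∀

Periodic : ℕ → (ℤ → ℤ) → Set
Periodic M f = ∀ z k → f (z + k * + M) ≡ f z

-- All multiples of the period are recorded, since functions with different moduli are compared
-- modulo a common multiple.
PeriodicFn : ℕ → Set
PeriodicFn m = ∃ λ f → ∀ j → Periodic (j ℕ.* m) f

onResidues : ∀ m .{{_ : NonZero m}} → (ℕ → ℤ) → PeriodicFn m
onResidues m table = (λ z → table (z %ℕ m)) , λ j z k → cong table (trans
  (cong (λ w → (z + w) %ℕ m) (trans (cong (k *_) (ℤ.pos-* j m)) (sym (ℤ.*-assoc k (+ j) (+ m)))))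
  (%ℕ-periodic m z (k * + j)))

Biperiodic : ℕ → (ℤ → ℤ → ℤ) → Set
Biperiodic M F = ∀ x y j k → F (x + j * + M) (y + k * + M) ≡ F x y

module _ {M : ℕ} where

  linear : ∀ {f} a b → Periodic M f → Biperiodic M (λ x y → f (a * x + b * y))
  linear {f} a b pf x y j k = trans (cong f (expand a b x y j k (+ M))) (pf (a * x + b * y) (a * j + b * k))
    where
    expand : ∀ a b x y j k M → a * (x + j * M) + b * (y + k * M) ≡ a * x + b * y + (a * j + b * k) * M
    expand = solve-∀

  first : ∀ {f} → Periodic M f → Biperiodic M (λ x y → f x)
  first pf x y j k = pf x j

  second : ∀ {f} → Periodic M f → Biperiodic M (λ x y → f y)
  second pf x y j k = pf y k

  _⟨*⟩_ : ∀ {F G} → Biperiodic M F → Biperiodic M G → Biperiodic M (λ x y → F x y * G x y)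
  (pF ⟨*⟩ pG) x y j k = cong₂ _*_ (pF x y j k) (pG x y j k)

  _⟨+⟩_ : ∀ {F G} → Biperiodic M F → Biperiodic M G → Biperiodic M (λ x y → F x y + G x y)
  (pF ⟨+⟩ pG) x y j k = cong₂ _+_ (pF x y j k) (pG x y j k)

  ⟨-⟩_ : ∀ {F} → Biperiodic M F → Biperiodic M (λ x y → - F x y)
  (⟨-⟩ pF) x y j k = cong -_ (pF x y j k)

  infixl 7 _⟨*⟩_
  infixl 6 _⟨+⟩_
  infix 8 ⟨-⟩_

equalOnResidues? : ∀ M (F G : ℤ → ℤ → ℤ) → Dec (∀ {r} → r ℕ.< M → ∀ {s} → s ℕ.< M → F (+ r) (+ s) ≡ G (+ r) (+ s))
equalOnResidues? M F G = ℕ.allUpTo? (λ r → ℕ.allUpTo? (λ s → F (+ r) (+ s) ℤ.≟ G (+ r) (+ s)) M) M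

-- The identity is evaluated on the M² pairs of residues. The periodicity proofs are composed by
-- `linear`, `first`, `second` and the operators above, which is why arguments are written with
-- explicit coefficients, as in 1ℤ * u + -1ℤ * x.
biperiodic-≡ : ∀ M .{{_ : NonZero M}} {F G} → Biperiodic M F → Biperiodic M G →
  True (equalOnResidues? M F G) → ∀ x y → F x y ≡ G x y
biperiodic-≡ M {F} {G} pF pG check x y = begin
  F x y                                            ≡⟨ cong₂ F (a≡a%ℕn+[a/ℕn]*n x M) (a≡a%ℕn+[a/ℕn]*n y M) ⟩
  F (+ r + x /ℕ M * + M) (+ s + y /ℕ M * + M)      ≡⟨ pF (+ r) (+ s) (x /ℕ M) (y /ℕ M) ⟩
  F (+ r) (+ s)                                    ≡⟨ toWitness {a? = equalOnResidues? M F G} check (n%ℕd<d x M) (n%ℕd<d y M) ⟩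
  G (+ r) (+ s)                                    ≡⟨ pG (+ r) (+ s) (x /ℕ M) (y /ℕ M) ⟨
  G (+ r + x /ℕ M * + M) (+ s + y /ℕ M * + M)      ≡⟨ cong₂ G (a≡a%ℕn+[a/ℕn]*n x M) (a≡a%ℕn+[a/ℕn]*n y M) ⟨
  G x y ∎
  where
  open ≡-Reasoning
  r = x %ℕ M
  s = y %ℕ M

-- Sign functions modulo 4, 5, 7 and 12

χ₄ᵖ : PeriodicFn 4
χ₄ᵖ = onResidues 4 λ { 1 → 1ℤ ; 3 → -1ℤ ; _ → 0ℤ }

χ₁₂ᵖ : PeriodicFn 12
χ₁₂ᵖ = onResidues 12 λ { 1 → 1ℤ ; 5 → -1ℤ ; 7 → -1ℤ ; 11 → 1ℤ ; _ → 0ℤ }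

-- Not a character, and neither is `σ₇ᵖ`: they are odd functions supported on ± 2 modulo 5 and ± 1
-- modulo 7, the residues of the square roots of 169.
σ₅ᵖ : PeriodicFn 5
σ₅ᵖ = onResidues 5 λ { 2 → 1ℤ ; 3 → -1ℤ ; _ → 0ℤ }

σ₇ᵖ : PeriodicFn 7
σ₇ᵖ = onResidues 7 λ { 1 → 1ℤ ; 6 → -1ℤ ; _ → 0ℤ }

oddᵖ : PeriodicFn 2
oddᵖ = onResidues 2 λ { 1 → 1ℤ ; _ → 0ℤ }

coprime₆ᵖ : PeriodicFn 6
coprime₆ᵖ = onResidues 6 λ { 1 → 1ℤ ; 5 → 1ℤ ; _ → 0ℤ }

three₆ᵖ : PeriodicFn 6
three₆ᵖ = onResidues 6 λ { 3 → 1ℤ ; _ → 0ℤ }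

parityᵖ : PeriodicFn 2
parityᵖ = onResidues 2 λ { 1 → 1ℤ ; _ → -1ℤ }

div₂ᵖ : PeriodicFn 2
div₂ᵖ = onResidues 2 λ { 0 → 1ℤ ; _ → 0ℤ }

div₆ᵖ : PeriodicFn 6
div₆ᵖ = onResidues 6 λ { 0 → 1ℤ ; _ → 0ℤ }

χ₄ χ₁₂ σ₅ σ₇ odd coprime₆ three₆ parity div₂ div₆ : ℤ → ℤ
χ₄ = proj₁ χ₄ᵖ
χ₁₂ = proj₁ χ₁₂ᵖ
σ₅ = proj₁ σ₅ᵖ
σ₇ = proj₁ σ₇ᵖ
odd = proj₁ oddᵖ
coprime₆ = proj₁ coprime₆ᵖ
three₆ = proj₁ three₆ᵖ
parity = proj₁ parityᵖ
div₂ = proj₁ div₂ᵖ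
div₆ = proj₁ div₆ᵖ

-- If x and y are prime to 6, exactly one of x + y and x - y is divisible by 6.
χ₁₂-split : ∀ x y → χ₁₂ x * χ₁₂ y ≡ χ₁₂ x * χ₁₂ y * (div₆ (1ℤ * x + 1ℤ * y) + div₆ (1ℤ * x + -1ℤ * y))
χ₁₂-split = biperiodic-≡ 12 (first (proj₂ χ₁₂ᵖ 1) ⟨*⟩ second (proj₂ χ₁₂ᵖ 1))
  (first (proj₂ χ₁₂ᵖ 1) ⟨*⟩ second (proj₂ χ₁₂ᵖ 1) ⟨*⟩ (linear 1ℤ 1ℤ (proj₂ div₆ᵖ 2) ⟨+⟩ linear 1ℤ -1ℤ (proj₂ div₆ᵖ 2))) tt

-- The character `χ₁₂` changes sign under a shift by 6 and takes the value - 1 at - 7, so for x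
-- prime to 6 the product is - (- 1)^u.
χ₁₂-product : ∀ u x → χ₁₂ x * χ₁₂ (+ 6 * u + -[1+ 6 ] * x) ≡ parity u * coprime₆ x
χ₁₂-product = biperiodic-≡ 12 (second (proj₂ χ₁₂ᵖ 1) ⟨*⟩ linear (+ 6) -[1+ 6 ] (proj₂ χ₁₂ᵖ 1))
  (first (proj₂ parityᵖ 6) ⟨*⟩ second (proj₂ coprime₆ᵖ 2)) tt

coprime₆-split : ∀ x → odd x ≡ coprime₆ x + three₆ x
coprime₆-split x = biperiodic-≡ 12 (first (proj₂ oddᵖ 6)) (first (proj₂ coprime₆ᵖ 2) ⟨+⟩ first (proj₂ three₆ᵖ 2)) tt x x

-- For odd u, 2x - u is congruent modulo 4 to u if x is odd and to - u if x is even. For even u both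
-- sides vanish, since x and u - x have the same parity; this is where even u enters with total
-- weight zero.
χ₄-product : ∀ u x → χ₄ u * χ₄ (-1ℤ * u + + 2 * x) ≡ parity u * (odd x - odd (1ℤ * u + -1ℤ * x))
χ₄-product = biperiodic-≡ 12 (first (proj₂ χ₄ᵖ 3) ⟨*⟩ linear -1ℤ (+ 2) (proj₂ χ₄ᵖ 3))
  (first (proj₂ parityᵖ 6) ⟨*⟩ (second (proj₂ oddᵖ 6) ⟨+⟩ ⟨-⟩ linear 1ℤ -1ℤ (proj₂ oddᵖ 6))) tt

χ₄-even-sum : ∀ u v → χ₄ u * χ₄ v ≡ χ₄ u * χ₄ v * div₂ (1ℤ * u + 1ℤ * v)
χ₄-even-sum = biperiodic-≡ 12 (first (proj₂ χ₄ᵖ 3) ⟨*⟩ second (proj₂ χ₄ᵖ 3))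
  (first (proj₂ χ₄ᵖ 3) ⟨*⟩ second (proj₂ χ₄ᵖ 3) ⟨*⟩ linear 1ℤ 1ℤ (proj₂ div₂ᵖ 6)) tt

parity-flip : ∀ u z → odd z * parity (-1ℤ * u + + 7 * z) ≡ - (odd z * parity u)
parity-flip = biperiodic-≡ 12 (second (proj₂ oddᵖ 6) ⟨*⟩ linear -1ℤ (+ 7) (proj₂ parityᵖ 6))
  (⟨-⟩ (second (proj₂ oddᵖ 6) ⟨*⟩ first (proj₂ parityᵖ 6))) tt

-- Modulo 5, 6u - 7x ≡ - (2x - u). With `σ₇-linear` this splits the sign of y into a sign of v and a
-- sign of u.
σ₅-linear : ∀ u x → σ₅ (+ 6 * u + -[1+ 6 ] * x) ≡ - σ₅ (-1ℤ * u + + 2 * x)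
σ₅-linear = biperiodic-≡ 5 (linear (+ 6) -[1+ 6 ] (proj₂ σ₅ᵖ 1)) (⟨-⟩ linear -1ℤ (+ 2) (proj₂ σ₅ᵖ 1)) tt

σ₅-flip : ∀ u z → σ₅ (1ℤ * u + -1ℤ * z) ≡ - σ₅ (-1ℤ * u + + 6 * z)
σ₅-flip = biperiodic-≡ 5 (linear 1ℤ -1ℤ (proj₂ σ₅ᵖ 1)) (⟨-⟩ linear -1ℤ (+ 6) (proj₂ σ₅ᵖ 1)) tt

σ₇-linear : ∀ u x → σ₇ (+ 6 * u + -[1+ 6 ] * x) ≡ - σ₇ u
σ₇-linear = biperiodic-≡ 7 (linear (+ 6) -[1+ 6 ] (proj₂ σ₇ᵖ 1)) (⟨-⟩ first (proj₂ σ₇ᵖ 1)) tt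

σ₇-flip : ∀ u z → σ₇ (-1ℤ * u + + 7 * z) ≡ - σ₇ u
σ₇-flip = biperiodic-≡ 7 (linear -1ℤ (+ 7) (proj₂ σ₇ᵖ 1)) (⟨-⟩ first (proj₂ σ₇ᵖ 1)) tt

module _ {M : ℕ} .{{_ : NonZero M}} {f : ℤ → ℤ} (pf : Periodic M f) where

  even-on-residues : True (equalOnResidues? M (λ x y → f (-1ℤ * x + 0ℤ * y)) (λ x y → f x)) → ∀ x → f (- x) ≡ f x
  even-on-residues check x = trans (cong f (negate x)) (biperiodic-≡ M (linear -1ℤ 0ℤ pf) (first pf) check x x)
    where
    negate : ∀ x → - x ≡ -1ℤ * x + 0ℤ * x
    negate = solve-∀

  odd-on-residues : True (equalOnResidues? M (λ x y → f (-1ℤ * x + 0ℤ * y)) (λ x y → - f x)) → ∀ x → f (- x) ≡ - f x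
  odd-on-residues check x = trans (cong f (negate x)) (biperiodic-≡ M (linear -1ℤ 0ℤ pf) (⟨-⟩ first pf) check x x)
    where
    negate : ∀ x → - x ≡ -1ℤ * x + 0ℤ * x
    negate = solve-∀

χ₁₂-even : ∀ x → χ₁₂ (- x) ≡ χ₁₂ x
χ₁₂-even = even-on-residues (proj₂ χ₁₂ᵖ 1) tt

σ₅-odd : ∀ x → σ₅ (- x) ≡ - σ₅ x
σ₅-odd = odd-on-residues (proj₂ σ₅ᵖ 1) tt

σ₇-odd : ∀ x → σ₇ (- x) ≡ - σ₇ x
σ₇-odd = odd-on-residues (proj₂ σ₇ᵖ 1) tt

-- Theta series

+∣x∣²≡x² : ∀ x → + (∣ x ∣ ℕ.* ∣ x ∣) ≡ x * x
+∣x∣²≡x² (+ n)    = ℤ.pos-* n n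
+∣x∣²≡x² -[1+ n ] = refl

-- The exponent k with u² = m k + r; a junk value when there is no such k.
level : ∀ m .{{_ : NonZero m}} → ℕ → ℤ → ℕ
level m r u = (∣ u ∣ ℕ.* ∣ u ∣ ℕ.∸ r) / m

level-≡ : ∀ m .{{_ : NonZero m}} r u k → u * u ≡ + m * + k + + r → level m r u ≡ k
level-≡ m r u k eq = trans
  (cong (λ s → (s ℕ.∸ r) / m) (ℤ.+-injective (trans (+∣x∣²≡x² u) (trans eq (cong (_+ + r) (trans (sym (ℤ.pos-* m k)) (cong +_ (ℕ.*-comm m k))))))))
  (trans (cong (_/ m) (ℕ.m+n∸n≡m (k ℕ.* m) r)) (m*n/n≡m k m))

level-neg : ∀ m .{{_ : NonZero m}} r u → level m r (- u) ≡ level m r u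
level-neg m r u = cong (λ n → (n ℕ.* n ℕ.∸ r) / m) (ℤ.∣-i∣≡∣i∣ u)

square-bound : ∀ u K → u * u ≡ + K → ∣ u ∣ ℕ.≤ K
square-bound u K eq = ℕ.≤-trans (n≤n² ∣ u ∣) (ℕ.≤-reflexive (ℤ.+-injective (trans (+∣x∣²≡x² u) eq)))
  where
  n≤n² : ∀ n → n ℕ.≤ n ℕ.* n
  n≤n² zero    = z≤n
  n≤n² (suc n) = ℕ.m≤m*n (suc n) (suc n)

alt-unique : ∀ (f : ℤ → ℤ) → f 0ℤ ≡ 1ℤ → (∀ n → f (ℤ.suc n) ≡ - f n) → ∀ n → f n ≡ alt n
alt-unique f f0 fsuc (+ zero)        = f0
alt-unique f f0 fsuc (+ (suc n))     = trans (fsuc (+ n)) (cong -_ (alt-unique f f0 fsuc (+ n)))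
alt-unique f f0 fsuc -[1+ zero ]     = trans (sym (ℤ.neg-involutive (f -1ℤ))) (cong -_ (trans (sym (fsuc -1ℤ)) f0))
alt-unique f f0 fsuc -[1+ (suc n) ]  = trans (sym (ℤ.neg-involutive (f -[1+ suc n ])))
  (cong -_ (trans (sym (fsuc -[1+ suc n ])) (alt-unique f f0 fsuc -[1+ n ])))

-- Completing the square in the triple product with c + c′ = d and c′ - c = D > 0:
-- 8 d expo n + D² = (2 d n - D)².
module Theta (c₀ D₀ : ℕ) where

  c c′ d D : ℕ
  c  = suc c₀
  D  = suc D₀
  c′ = suc (c₀ ℕ.+ D)
  d  = suc (c₀ ℕ.+ c′)

  center : ℤ → ℤ
  center n = + 2 * + d * n - + D

  double-tri : ∀ p → + 2 * + tri p ≡ + p * + p - + p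
  double-tri zero    = refl
  double-tri (suc p) = trans (expand (+ p) (+ tri p)) (trans (cong (_+_ (+ 2 * + p)) (double-tri p)) (collect (+ p)))
    where
    expand : ∀ p t → + 2 * (p + t) ≡ + 2 * p + + 2 * t
    expand = solve-∀
    collect : ∀ p → + 2 * p + (p * p - p) ≡ (1ℤ + p) * (1ℤ + p) - (1ℤ + p)
    collect = solve-∀

  double-expo : ∀ n → + 2 * + expo d c c′ n ≡ + d * (n * n) - + D * n
  double-expo (+ p) = begin
    + 2 * (+ (d ℕ.* tri p) + + (c ℕ.* p))
      ≡⟨ cong₂ (λ x y → + 2 * (x + y)) (ℤ.pos-* d (tri p)) (ℤ.pos-* c p) ⟩
    + 2 * (+ d * + tri p + + c * + p)
      ≡⟨ expand (+ d) (+ tri p) (+ c) (+ p) ⟩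
    + d * (+ 2 * + tri p) + + 2 * + c * + p
      ≡⟨ cong (λ z → + d * z + + 2 * + c * + p) (double-tri p) ⟩
    + d * (+ p * + p - + p) + + 2 * + c * + p
      ≡⟨ collect (+ c) (+ D) (+ p) ⟩
    + d * (+ p * + p) - + D * + p ∎
    where
    open ≡-Reasoning
    expand : ∀ d t c p → + 2 * (d * t + c * p) ≡ d * (+ 2 * t) + + 2 * c * p
    expand = solve-∀
    collect : ∀ c D p → (c + (c + D)) * (p * p - p) + + 2 * c * p ≡ (c + (c + D)) * (p * p) - D * p
    collect = solve-∀
  double-expo -[1+ p ] = begin
    + 2 * (+ (d ℕ.* tri (suc p)) + + (c′ ℕ.* suc p))
      ≡⟨ cong₂ (λ x y → + 2 * (x + y)) (ℤ.pos-* d (tri (suc p))) (ℤ.pos-* c′ (suc p)) ⟩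
    + 2 * (+ d * + tri (suc p) + + c′ * + suc p)
      ≡⟨ expand (+ d) (+ tri (suc p)) (+ c′) (+ suc p) ⟩
    + d * (+ 2 * + tri (suc p)) + + 2 * + c′ * + suc p
      ≡⟨ cong (λ z → + d * z + + 2 * + c′ * + suc p) (double-tri (suc p)) ⟩
    + d * (+ suc p * + suc p - + suc p) + + 2 * + c′ * + suc p
      ≡⟨ collect (+ c) (+ D) (+ suc p) ⟩
    + d * (-[1+ p ] * -[1+ p ]) - + D * -[1+ p ] ∎
    where
    open ≡-Reasoning
    expand : ∀ d t c p → + 2 * (d * t + c * p) ≡ d * (+ 2 * t) + + 2 * c * p
    expand = solve-∀
    collect : ∀ c D p → (c + (c + D)) * (p * p - p) + + 2 * (c + D) * p ≡ (c + (c + D)) * ((- p) * (- p)) - D * (- p)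
    collect = solve-∀

  center-square : ∀ n → center n * center n ≡ + (8 ℕ.* d) * + expo d c c′ n + + (D ℕ.* D)
  center-square n = begin
    center n * center n
      ≡⟨ expand (+ d) n (+ D) ⟩
    + 4 * + d * (+ d * (n * n) - + D * n) + + D * + D
      ≡⟨ cong₂ (λ x y → + 4 * + d * x + y) (sym (double-expo n)) (sym (ℤ.pos-* D D)) ⟩
    + 4 * + d * (+ 2 * + expo d c c′ n) + + (D ℕ.* D)
      ≡⟨ cong (_+ + (D ℕ.* D)) (collect (+ d) (+ expo d c c′ n)) ⟩
    + 8 * + d * + expo d c c′ n + + (D ℕ.* D)
      ≡⟨ cong (λ z → z * + expo d c c′ n + + (D ℕ.* D)) (sym (ℤ.pos-* 8 d)) ⟩
    + (8 ℕ.* d) * + expo d c c′ n + + (D ℕ.* D) ∎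
    where
    open ≡-Reasoning
    expand : ∀ d n D → (+ 2 * d * n - D) * (+ 2 * d * n - D) ≡ + 4 * d * (d * (n * n) - D * n) + D * D
    expand = solve-∀
    collect : ∀ d e → + 4 * d * (+ 2 * e) ≡ + 8 * d * e
    collect = solve-∀

  level-center : ∀ n → level (8 ℕ.* d) (D ℕ.* D) (center n) ≡ expo d c c′ n
  level-center n = level-≡ (8 ℕ.* d) (D ℕ.* D) (center n) (expo d c c′ n) (center-square n)

  center-injective : ∀ j k → center j ≡ center k → j ≡ k
  center-injective j k eq = ℤ.*-cancelˡ-≡ (+ 2 * + d) j k (+ℤ.∙-cancelʳ (- + D) (+ 2 * + d * j) (+ 2 * + d * k) eq)

  -- Otherwise d (j + k) = D, which is impossible for 0 < D < d.
  center-opposite : ∀ j k → center j ≢ - center k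
  center-opposite j k eq = impossible ∣ j + k ∣ (trans (sym (ℤ.abs-* (+ d) (j + k)))
    (cong ∣_∣ (ℤ.*-cancelˡ-≡ (+ 2) (+ d * (j + k)) (+ D)
      (trans (left (+ d) j k (+ D)) (trans (cong (λ z → z + + D + + 2 * + d * k) eq) (right (+ d) k (+ D)))))))
    where
    left : ∀ d j k D → + 2 * (d * (j + k)) ≡ + 2 * d * j - D + D + + 2 * d * k
    left = solve-∀
    right : ∀ d k D → - (+ 2 * d * k - D) + D + + 2 * d * k ≡ + 2 * D
    right = solve-∀
    D<d : D ℕ.< d
    D<d = s≤s (ℕ.≤-trans (ℕ.≤-trans (ℕ.m≤n+m D c₀) (ℕ.n≤1+n (c₀ ℕ.+ D))) (ℕ.m≤n+m c′ c₀))
    impossible : ∀ i → d ℕ.* i ≢ D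
    impossible zero    eq = ℕ.1+n≢0 (sym (trans (sym (ℕ.*-zeroʳ d)) eq))
    impossible (suc i) eq = ℕ.<⇒≱ D<d (subst (d ℕ.≤_) eq (ℕ.m≤m*n d (suc i)))

  thetaProduct : Series
  thetaProduct = poch c d ⊛ poch c′ d ⊛ poch d d

  module _ (w : ℤ → ℤ)
    (w-even : ∀ u → w (- u) ≡ w u)
    (w-center : ∀ n → w (center n) ≡ alt n)
    (w-support : ∀ u → w u ≢ 0ℤ → ∃ λ n → center n ≡ u ⊎ center n ≡ - u) where

    support-square : ∀ u → w u ≢ 0ℤ → u * u ≡ + (8 ℕ.* d) * + level (8 ℕ.* d) (D ℕ.* D) u + + (D ℕ.* D)
    support-square u wu≢0 with w-support u wu≢0
    ... | n , inj₁ refl = trans (center-square n)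
      (cong (λ e → + (8 ℕ.* d) * + e + + (D ℕ.* D)) (sym (level-center n)))
    ... | n , inj₂ eq = trans (trans (sym (neg-square u)) (cong₂ _*_ (sym eq) (sym eq)))
      (trans (center-square n) (cong (λ e → + (8 ℕ.* d) * + e + + (D ℕ.* D))
        (trans (sym (level-center n)) (trans (cong (level (8 ℕ.* d) (D ℕ.* D)) eq) (level-neg (8 ℕ.* d) (D ℕ.* D) u)))))

    -- The centers contain one member of each pair ± u in the support of `w`; summing over all u
    -- costs the factor 2. No term is lost: ∣ n ∣ is at most the exponent N, and ∣ u ∣ ≤ u² ≤ C.
    theta-fold : ∀ N C → 8 ℕ.* d ℕ.* N ℕ.+ D ℕ.* D ℕ.≤ C →
      + 2 * thetaProduct N ≡ sumℤ C (λ u → w u * 𝟙 (N ℕ.≟ level (8 ℕ.* d) (D ℕ.* D) u))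
    theta-fold N C bound = begin
      + 2 * thetaProduct N
        ≡⟨ cong (+ 2 *_) (jacobi (c₀ ℕ.+ c′) c₀ (c₀ ℕ.+ D) refl N (suc N) ℕ.≤-refl) ⟩
      + 2 * sumℤ (suc N) (λ n → alt n * 𝟙 (N ℕ.≟ expo d c c′ n))
        ≡⟨ cong (+ 2 *_) (sumℤ-cong′ (suc N) (λ n →
             cong₂ (λ x y → x * 𝟙 (N ℕ.≟ y)) (sym (w-center n)) (sym (level-center n)))) ⟩
      + 2 * sumℤ (suc N) (h ∘ center)
        ≡⟨ sum-fold-even (suc (suc N ℕ.+ suc N)) C h (λ i → center (i ⊖ suc N))
             (λ u → cong₂ (λ x y → x * 𝟙 (N ℕ.≟ y)) (w-even u) (level-neg (8 ℕ.* d) (D ℕ.* D) u))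
             (λ i j _ _ eq → ⊖-injectiveˡ (suc N) (center-injective (i ⊖ suc N) (j ⊖ suc N) eq))
             (λ i j → center-opposite (i ⊖ suc N) (j ⊖ suc N))
             surjective
             (λ i _ → bounded (i ⊖ suc N)) ⟩
      sumℤ C h ∎
      where
      open ≡-Reasoning
      h : ℤ → ℤ
      h u = w u * 𝟙 (N ℕ.≟ level (8 ℕ.* d) (D ℕ.* D) u)
      h-level : ∀ u → h u ≢ 0ℤ → N ≡ level (8 ℕ.* d) (D ℕ.* D) u
      h-level u nz = 𝟙≢0 (N ℕ.≟ level (8 ℕ.* d) (D ℕ.* D) u) (*-≢0ʳ (w u) _ nz)
      bounded : ∀ n → h (center n) ≢ 0ℤ → ∣ center n ∣ ℕ.≤ C
      bounded n nz = ℕ.≤-trans (square-bound (center n) (8 ℕ.* d ℕ.* N ℕ.+ D ℕ.* D)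
        (trans (center-square n) (trans
          (cong (λ e → + (8 ℕ.* d) * + e + + (D ℕ.* D)) (sym (trans (h-level (center n) nz) (level-center n))))
          (cong (_+ + (D ℕ.* D)) (sym (ℤ.pos-* (8 ℕ.* d) N)))))) bound
      index : ∀ n → N ≡ expo d c c′ n → ∃ λ i → i ℕ.< suc (suc N ℕ.+ suc N) × i ⊖ suc N ≡ n
      index n eq = ⊖-surjective (suc N) n
        (ℕ.≤-trans (expo-≥ d c₀ (c₀ ℕ.+ D) n) (ℕ.≤-trans (ℕ.≤-reflexive (sym eq)) (ℕ.n≤1+n N)))
      surjective : ∀ u → h u ≢ 0ℤ → ∃ λ i → i ℕ.< suc (suc N ℕ.+ suc N) × (center (i ⊖ suc N) ≡ u ⊎ center (i ⊖ suc N) ≡ - u)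
      surjective u nz with w-support u (*-≢0ˡ (w u) _ nz)
      ... | n , inj₁ eq = let i , i< , i⊖ = index n (trans (h-level u nz) (trans (cong (level (8 ℕ.* d) (D ℕ.* D)) (sym eq)) (level-center n)))
                          in i , i< , inj₁ (trans (cong center i⊖) eq)
      ... | n , inj₂ eq = let i , i< , i⊖ = index n (trans (h-level u nz)
                                (trans (sym (level-neg (8 ℕ.* d) (D ℕ.* D) u)) (trans (cong (level (8 ℕ.* d) (D ℕ.* D)) (sym eq)) (level-center n))))
                          in i , i< , inj₂ (trans (cong center i⊖) eq)

  -- r ≡ - D or r ≡ D modulo 2 d, where D ≡ - (4 c + D) because 2 d = 4 c + 2 D.
  OnCenters : ℕ → Set
  OnCenters r = (2 ℕ.* d ∣ r ℕ.+ D) ⊎ (2 ℕ.* d ∣ r ℕ.+ (4 ℕ.* c ℕ.+ D))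

  supportedOnCenters? : ∀ (w : ℤ → ℤ) → Dec (∀ {r} → r ℕ.< 4 ℕ.* d → w (+ r) ≢ 0ℤ → OnCenters r)
  supportedOnCenters? w = ℕ.allUpTo? (λ r → ¬? (w (+ r) ℤ.≟ 0ℤ) →-dec
    ((2 ℕ.* d ∣? r ℕ.+ D) ⊎-dec (2 ℕ.* d ∣? r ℕ.+ (4 ℕ.* c ℕ.+ D)))) (4 ℕ.* d)

  module _ (w : ℤ → ℤ) (periodic : Periodic (4 ℕ.* d) w) where

    -- One period is checked by evaluation. It is 4 d, twice the spacing of the centers, because the
    -- sign alternates from one center to the next.
    periodic-support : True (supportedOnCenters? w) → ∀ u → w u ≢ 0ℤ → ∃ λ n → center n ≡ u ⊎ center n ≡ - u
    periodic-support check u wu≢0 = conclude (toWitness {a? = supportedOnCenters? w} check (n%ℕd<d u (4 ℕ.* d))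
      (λ eq → wu≢0 (trans (trans (cong w u≡) (periodic (+ r) k)) eq)))
      where
      open ≡-Reasoning
      r = u %ℕ (4 ℕ.* d)
      k = u /ℕ (4 ℕ.* d)
      u≡ : u ≡ + r + k * + (4 ℕ.* d)
      u≡ = a≡a%ℕn+[a/ℕn]*n u (4 ℕ.* d)
      conclude : OnCenters r → ∃ λ n → center n ≡ u ⊎ center n ≡ - u
      -- Here r + D = 2 d q, so u = r + 4 d k is the center of index q + 2 k.
      conclude (inj₁ (divides q eq)) = + q + + 2 * k , inj₁ (begin
        + 2 * + d * (+ q + + 2 * k) - + D
          ≡⟨ expand (+ d) (+ q) k (+ D) ⟩
        + q * (+ 2 * + d) - + D + k * (+ 4 * + d)
          ≡⟨ cong₂ (λ x y → + q * x - + D + k * y) (sym (ℤ.pos-* 2 d)) (sym (ℤ.pos-* 4 d)) ⟩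
        + q * + (2 ℕ.* d) - + D + k * + (4 ℕ.* d)
          ≡⟨ cong (λ z → z - + D + k * + (4 ℕ.* d)) (trans (sym (ℤ.pos-* q (2 ℕ.* d))) (cong +_ (sym eq))) ⟩
        + r + + D - + D + k * + (4 ℕ.* d)
          ≡⟨ cong (_+ k * + (4 ℕ.* d)) (x+y-y≡x (+ r) (+ D)) ⟩
        + r + k * + (4 ℕ.* d)
          ≡⟨ u≡ ⟨
        u ∎)
        where
        expand : ∀ d q k D → + 2 * d * (q + + 2 * k) - D ≡ q * (+ 2 * d) - D + k * (+ 4 * d)
        expand = solve-∀
      -- Here r = 2 d q - (4 c + D) = 2 d (q - 1) + D, so - u is the center of index 1 - q - 2 k.
      conclude (inj₂ (divides q eq)) = 1ℤ - + q - + 2 * k , inj₂ (begin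
        + 2 * + d * (1ℤ - + q - + 2 * k) - + D
          ≡⟨ expand (+ c) (+ D) (+ q) k ⟩
        - (+ q * (+ 2 * + d) - (+ 4 * + c + + D) + k * (+ 4 * + d))
          ≡⟨ cong₂ (λ x y → - (+ q * x - y + k * (+ 4 * + d))) (sym (ℤ.pos-* 2 d)) (cong (_+ + D) (sym (ℤ.pos-* 4 c))) ⟩
        - (+ q * + (2 ℕ.* d) - + (4 ℕ.* c ℕ.+ D) + k * (+ 4 * + d))
          ≡⟨ cong₂ (λ x y → - (x - + (4 ℕ.* c ℕ.+ D) + k * y)) (trans (sym (ℤ.pos-* q (2 ℕ.* d))) (cong +_ (sym eq))) (sym (ℤ.pos-* 4 d)) ⟩
        - (+ r + + (4 ℕ.* c ℕ.+ D) - + (4 ℕ.* c ℕ.+ D) + k * + (4 ℕ.* d))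
          ≡⟨ cong (λ z → - (z + k * + (4 ℕ.* d))) (x+y-y≡x (+ r) (+ (4 ℕ.* c ℕ.+ D))) ⟩
        - (+ r + k * + (4 ℕ.* d))
          ≡⟨ cong -_ u≡ ⟨
        - u ∎)
        where
        expand : ∀ c D q k → + 2 * (c + (c + D)) * (1ℤ - q - + 2 * k) - D
               ≡ - (q * (+ 2 * (c + (c + D))) - (+ 4 * c + D) + k * (+ 4 * (c + (c + D))))
        expand = solve-∀

    periodic-center : w (- + D) ≡ 1ℤ →
      True (equalOnResidues? (4 ℕ.* d) (λ x y → w (x + + (2 ℕ.* d))) (λ x y → - w x)) →
      ∀ n → w (center n) ≡ alt n
    periodic-center w-D check = alt-unique (w ∘ center)
      (trans (cong w (trans (cong (_- + D) (ℤ.*-zeroʳ (+ 2 * + d))) (ℤ.+-identityˡ (- + D)))) w-D)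
      (λ n → trans (cong w (trans (step (+ d) n (+ D)) (cong (_+_ (center n)) (sym (ℤ.pos-* 2 d)))))
        (biperiodic-≡ (4 ℕ.* d) (first translate) (⟨-⟩ first periodic) check (center n) 0ℤ))
      where
      step : ∀ d n D → + 2 * d * (1ℤ + n) - D ≡ + 2 * d * n - D + + 2 * d
      step = solve-∀
      translate : Periodic (4 ℕ.* d) (λ x → w (x + + (2 ℕ.* d)))
      translate x k = trans (cong w (commute x (k * + (4 ℕ.* d)) (+ (2 ℕ.* d)))) (periodic (x + + (2 ℕ.* d)) k)
        where
        commute : ∀ x y z → x + y + z ≡ x + z + y
        commute = solve-∀

-- Products of theta series

-- The truncated theta series Σ w(x) q^{e(x)} over ∣ x ∣ ≤ C.
genSeries : ℕ → (ℤ → ℤ) → (ℤ → ℕ) → Series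
genSeries C w e N = sumℤ C (λ x → w x * 𝟙 (N ℕ.≟ e x))

genSeries-⊛ : ∀ C w e w′ e′ N → (genSeries C w e ⊛ genSeries C w′ e′) N
  ≡ sumℤ C (λ x → sumℤ C (λ y → w x * w′ y * 𝟙 (N ℕ.≟ e x ℕ.+ e′ y)))
genSeries-⊛ C w e w′ e′ N = begin
  (genSeries C w e ⊛ g) N
    ≡⟨ ⊛-congʳ g (λ M → sumℤ-cong′ C (λ x → cong (w x *_) (sym (shift-one (e x) M)))) N ⟩
  ((λ M → sumℤ C (λ x → w x * shift (e x) oneS M)) ⊛ g) N
    ≡⟨ sum-⊛ (suc (C ℕ.+ C)) (λ i M → w (i ⊖ C) * shift (e (i ⊖ C)) oneS M) g N ⟩
  sumℤ C (λ x → ((λ M → w x * shift (e x) oneS M) ⊛ g) N)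
    ≡⟨ sumℤ-cong′ C (λ x → trans (⊛-scale (w x) (shift (e x) oneS) g N)
         (trans (cong (w x *_) (trans (shift-⊛ (e x) oneS g N) (trans (shift-cong (e x) (⊛-identityˡ g) N) (inner (e x)))))
           (trans (sym (sumℤ-*ˡ C (w x) (λ y → w′ y * 𝟙 (N ℕ.≟ e x ℕ.+ e′ y))))
             (sumℤ-cong′ C (λ y → sym (ℤ.*-assoc (w x) (w′ y) (𝟙 (N ℕ.≟ e x ℕ.+ e′ y)))))))) ⟩
  sumℤ C (λ x → sumℤ C (λ y → w x * w′ y * 𝟙 (N ℕ.≟ e x ℕ.+ e′ y))) ∎
  where
  open ≡-Reasoning
  g = genSeries C w′ e′
  inner : ∀ k → shift k g N ≡ sumℤ C (λ y → w′ y * 𝟙 (N ℕ.≟ k ℕ.+ e′ y))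
  inner k = begin
    shift k g N
      ≡⟨ shift-cong k (λ M → sumℤ-cong′ C (λ y → cong (w′ y *_) (sym (shift-one (e′ y) M)))) N ⟩
    shift k (λ M → sumℤ C (λ y → w′ y * shift (e′ y) oneS M)) N
      ≡⟨ shift-sum k (suc (C ℕ.+ C)) (λ i M → w′ (i ⊖ C) * shift (e′ (i ⊖ C)) oneS M) N ⟩
    sumℤ C (λ y → shift k (λ M → w′ y * shift (e′ y) oneS M) N)
      ≡⟨ sumℤ-cong′ C (λ y → trans (shift-scale k (w′ y) (shift (e′ y) oneS) N)
           (cong (w′ y *_) (trans (shift-shift k (e′ y) oneS N) (shift-one (k ℕ.+ e′ y) N)))) ⟩
    sumℤ C (λ y → w′ y * 𝟙 (N ℕ.≟ k ℕ.+ e′ y)) ∎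

-- The identity of lattice sums

divisible : ∀ m .{{_ : NonZero m}} z → z %ℕ m ≡ 0 → ∃ λ k → z ≡ + m * k
divisible m z eq = z /ℕ m , trans (a≡a%ℕn+[a/ℕn]*n z m)
  (trans (cong (λ r → + r + z /ℕ m * + m) eq) (trans (ℤ.+-identityˡ _) (ℤ.*-comm (z /ℕ m) (+ m))))

div₂-≢0 : ∀ z → div₂ z ≢ 0ℤ → ∃ λ k → z ≡ + 2 * k
div₂-≢0 z nz with z %ℕ 2 in eq
... | zero  = divisible 2 z eq
... | suc _ = contradiction refl nz

div₆-≢0 : ∀ z → div₆ z ≢ 0ℤ → ∃ λ k → z ≡ + 6 * k
div₆-≢0 z nz with z %ℕ 6 in eq
... | zero  = divisible 6 z eq
... | suc _ = contradiction refl nz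

three₆-≢0 : ∀ x → three₆ x ≢ 0ℤ → ∃ λ z → x ≡ + 3 * z × odd z ≡ 1ℤ
three₆-≢0 x nz with x %ℕ 6 in eq
... | 0 = contradiction refl nz
... | 1 = contradiction refl nz
... | 2 = contradiction refl nz
... | suc (suc (suc (suc _))) = contradiction refl nz
... | 3 = 1ℤ + x /ℕ 6 * + 2 ,
  trans (a≡a%ℕn+[a/ℕn]*n x 6) (trans (cong (λ r → + r + x /ℕ 6 * + 6) eq) (regroup (x /ℕ 6))) ,
  odd-≡ (1ℤ + x /ℕ 6 * + 2) (%ℕ-periodic 2 1ℤ (x /ℕ 6))
  where
  regroup : ∀ q → + 3 + q * + 6 ≡ + 3 * (1ℤ + q * + 2)
  regroup = solve-∀
  odd-≡ : ∀ z → z %ℕ 2 ≡ 1 → odd z ≡ 1ℤ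
  odd-≡ z eq rewrite eq = refl

-- Both forms are positive definite with positive integer coefficients, so all solutions lie in one
-- box and every sum over u, v, x or y can be truncated at the same bound.
form-bound : ∀ a b x y M → + suc a * (x * x) + + suc b * (y * y) ≡ + M → ∣ x ∣ ℕ.≤ M × ∣ y ∣ ℕ.≤ M
form-bound a b x y M eq =
  ℕ.≤-trans (below a ∣ x ∣) (ℕ.≤-trans (ℕ.m≤m+n (suc a ℕ.* X) (suc b ℕ.* Y)) (ℕ.≤-reflexive eqℕ)) ,
  ℕ.≤-trans (below b ∣ y ∣) (ℕ.≤-trans (ℕ.m≤n+m (suc b ℕ.* Y) (suc a ℕ.* X)) (ℕ.≤-reflexive eqℕ))
  where
  X = ∣ x ∣ ℕ.* ∣ x ∣
  Y = ∣ y ∣ ℕ.* ∣ y ∣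
  eqℕ : suc a ℕ.* X ℕ.+ suc b ℕ.* Y ≡ M
  eqℕ = ℤ.+-injective (trans (cong₂ _+_
    (trans (ℤ.pos-* (suc a) X) (cong (+ suc a *_) (+∣x∣²≡x² x)))
    (trans (ℤ.pos-* (suc b) Y) (cong (+ suc b *_) (+∣x∣²≡x² y)))) eq)
  below : ∀ a n → n ℕ.≤ suc a ℕ.* (n ℕ.* n)
  below a zero    = z≤n
  below a (suc n) = ℕ.≤-trans (ℕ.m≤m*n (suc n) (suc n)) (ℕ.m≤n*m (suc n ℕ.* suc n) (suc a))

self-opposite : ∀ i → i ≡ - i → i ≡ 0ℤ
self-opposite (+ zero) _ = refl

-- The sign of the term with y² = 840 m + 169, as a function of the root y instead of the index n.
ψ : ℤ → ℤ
ψ y = χ₁₂ y * (σ₅ y * σ₇ y)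

ψ-even : ∀ y → ψ (- y) ≡ ψ y
ψ-even y = trans (cong₂ _*_ (χ₁₂-even y) (cong₂ _*_ (σ₅-odd y) (σ₇-odd y))) (signs (χ₁₂ y) (σ₅ y) (σ₇ y))
  where
  signs : ∀ a b c → a * ((- b) * (- c)) ≡ a * (b * c)
  signs = solve-∀

module Lattice (M : ℕ) where

  form₁ form₂ : ℤ → ℤ → ℤ
  form₁ x y = + 35 * (x * x) + + 1 * (y * y)
  form₂ u v = + 15 * (u * u) + + 21 * (v * v)

  δ₁ δ₂ : ℤ → ℤ → ℤ
  δ₁ x y = 𝟙 (form₁ x y ℤ.≟ + M)
  δ₂ u v = 𝟙 (form₂ u v ℤ.≟ + M)

  -- With v = 2x - u and y = 6u - 7x the two forms agree, and (u , x) ranges over ℤ².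
  V Y : ℤ → ℤ → ℤ
  V u x = -1ℤ * u + + 2 * x
  Y u x = + 6 * u + -[1+ 6 ] * x

  forms-agree : ∀ u x → form₁ x (Y u x) ≡ form₂ u (V u x)
  forms-agree = identity
    where
    identity : ∀ u x → + 35 * (x * x) + + 1 * ((+ 6 * u + -[1+ 6 ] * x) * (+ 6 * u + -[1+ 6 ] * x))
                     ≡ + 15 * (u * u) + + 21 * ((-1ℤ * u + + 2 * x) * (-1ℤ * u + + 2 * x))
    identity = solve-∀

  bound-ux : ∀ u x → form₂ u (V u x) ≡ + M → ∣ u ∣ ℕ.≤ M × ∣ x ∣ ℕ.≤ M
  bound-ux u x eq = proj₁ (form-bound 14 20 u (V u x) M eq) ,
    proj₁ (form-bound 34 0 x (Y u x) M (trans (forms-agree u x) eq))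

  K : ℤ → ℤ → ℤ
  K u x = parity u * (σ₇ u * σ₅ (V u x)) * δ₂ u (V u x)

  K-form : ∀ u x → K u x ≢ 0ℤ → form₂ u (V u x) ≡ + M
  K-form u x nz = 𝟙≢0 (form₂ u (V u x) ℤ.≟ + M) (*-≢0ʳ (parity u * (σ₇ u * σ₅ (V u x))) _ nz)

  H : ℤ → ℤ → ℤ
  H x y = χ₁₂ x * ψ y * δ₁ x y

  δ₁-even : ∀ x y → δ₁ x (- y) ≡ δ₁ x y
  δ₁-even x y = cong (λ z → 𝟙 (+ 35 * (x * x) + + 1 * z ℤ.≟ + M)) (neg-square y)

  δ₂-even : ∀ u v → δ₂ u (- v) ≡ δ₂ u v
  δ₂-even u v = cong (λ z → 𝟙 (+ 15 * (u * u) + + 21 * z ℤ.≟ + M)) (neg-square v)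

  -- For x prime to 6, the contributing y satisfy y ≡ - x or y ≡ x modulo 6. The two classes are
  -- exchanged by y ↦ - y, under which `H` is even, and the first one is the image of u ↦ 6u - 7x.
  halve : ∀ x → sumℤ M (H x) ≡ + 2 * sumℤ M (λ u → H x (Y u x))
  halve x = begin
    sumℤ M (H x)
      ≡⟨ sumℤ-cong′ M split ⟩
    sumℤ M (λ y → H⁺ y + H⁺ (- y))
      ≡⟨ sumℤ-+ M H⁺ (H⁺ ∘ -_) ⟩
    sumℤ M H⁺ + sumℤ M (H⁺ ∘ -_)
      ≡⟨ cong (_+_ (sumℤ M H⁺)) (sumℤ-neg M H⁺) ⟩
    sumℤ M H⁺ + sumℤ M H⁺
      ≡⟨ x+x≡2x (sumℤ M H⁺) ⟩
    + 2 * sumℤ M H⁺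
      ≡⟨ cong (+ 2 *_) (sym (trans (sumℤ-cong′ M onY) (sumℤ-reindex M M H⁺ (λ u → Y u x) injective surjective bounded))) ⟩
    + 2 * sumℤ M (λ u → H x (Y u x)) ∎
    where
    open ≡-Reasoning
    H⁺ : ℤ → ℤ
    H⁺ y = H x y * div₆ (1ℤ * x + 1ℤ * y)
    split : ∀ y → H x y ≡ H⁺ y + H⁺ (- y)
    split y = begin
      χ₁₂ x * (χ₁₂ y * (σ₅ y * σ₇ y)) * δ₁ x y
        ≡⟨ gather (χ₁₂ x) (χ₁₂ y) (σ₅ y * σ₇ y) (δ₁ x y) ⟩
      χ₁₂ x * χ₁₂ y * (σ₅ y * σ₇ y * δ₁ x y)
        ≡⟨ cong (_* (σ₅ y * σ₇ y * δ₁ x y)) (χ₁₂-split x y) ⟩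
      χ₁₂ x * χ₁₂ y * (p + m) * (σ₅ y * σ₇ y * δ₁ x y)
        ≡⟨ distribute (χ₁₂ x) (χ₁₂ y) p m (σ₅ y * σ₇ y) (δ₁ x y) ⟩
      H x y * p + H x y * m
        ≡⟨ cong (_+_ (H x y * p)) (cong₂ _*_
             (sym (cong₂ (λ a b → χ₁₂ x * a * b) (ψ-even y) (δ₁-even x y)))
             (cong div₆ (negate x y))) ⟩
      H⁺ y + H⁺ (- y) ∎
      where
      p = div₆ (1ℤ * x + 1ℤ * y)
      m = div₆ (1ℤ * x + -1ℤ * y)
      gather : ∀ a b c d → a * (b * c) * d ≡ a * b * (c * d)
      gather = solve-∀
      distribute : ∀ a b p m c d → a * b * (p + m) * (c * d) ≡ a * (b * c) * d * p + a * (b * c) * d * m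
      distribute = solve-∀
      negate : ∀ x y → 1ℤ * x + -1ℤ * y ≡ 1ℤ * x + 1ℤ * (- y)
      negate = solve-∀
    onY : ∀ u → H x (Y u x) ≡ H⁺ (Y u x)
    onY u = sym (trans (cong (H x (Y u x) *_) (trans (cong div₆ (six u x)) (div₆-six u x))) (ℤ.*-identityʳ (H x (Y u x))))
      where
      six : ∀ u x → 1ℤ * x + 1ℤ * (+ 6 * u + -[1+ 6 ] * x) ≡ + 6 * u + -[1+ 5 ] * x
      six = solve-∀
      div₆-six : ∀ u x → div₆ (+ 6 * u + -[1+ 5 ] * x) ≡ 1ℤ
      div₆-six = biperiodic-≡ 12 (linear (+ 6) -[1+ 5 ] (proj₂ div₆ᵖ 2)) (λ _ _ _ _ → refl) tt
    H⁺-form : ∀ y → H⁺ y ≢ 0ℤ → form₁ x y ≡ + M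
    H⁺-form y nz = 𝟙≢0 (form₁ x y ℤ.≟ + M) (*-≢0ʳ (χ₁₂ x * ψ y) _ (*-≢0ˡ (H x y) _ nz))
    injective : ∀ j k → Y j x ≡ Y k x → j ≡ k
    injective j k eq = ℤ.*-cancelˡ-≡ (+ 6) j k (+ℤ.∙-cancelʳ (-[1+ 6 ] * x) (+ 6 * j) (+ 6 * k) eq)
    surjective : ∀ y → H⁺ y ≢ 0ℤ → ∃ λ u → ∣ u ∣ ℕ.≤ M × Y u x ≡ y
    -- From x + y = 6k follows y = 6k - x = 6 (k + x) - 7x.
    surjective y nz = k + x , proj₁ (bound-ux (k + x) x
        (trans (sym (forms-agree (k + x) x)) (trans (cong (form₁ x) Y≡y) (H⁺-form y nz)))) , Y≡y
      where
      sixfold : ∃ λ k → 1ℤ * x + 1ℤ * y ≡ + 6 * k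
      sixfold = div₆-≢0 (1ℤ * x + 1ℤ * y) (*-≢0ʳ (H x y) _ nz)
      k = proj₁ sixfold
      expand : ∀ k x → + 6 * (k + x) + -[1+ 6 ] * x ≡ + 6 * k - x
      expand = solve-∀
      cancel : ∀ x y → 1ℤ * x + 1ℤ * y - x ≡ y
      cancel = solve-∀
      Y≡y : Y (k + x) x ≡ y
      Y≡y = trans (expand k x) (trans (cong (_- x) (sym (proj₂ sixfold))) (cancel x y))
    bounded : ∀ u → H⁺ (Y u x) ≢ 0ℤ → ∣ Y u x ∣ ℕ.≤ M
    bounded u nz = proj₂ (form-bound 34 0 x (Y u x) M (H⁺-form (Y u x) nz))

  H-as-K : ∀ u x → H x (Y u x) ≡ coprime₆ x * K u x
  H-as-K u x = begin
    χ₁₂ x * (χ₁₂ (Y u x) * (σ₅ (Y u x) * σ₇ (Y u x))) * δ₁ x (Y u x)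
      ≡⟨ gather (χ₁₂ x) (χ₁₂ (Y u x)) (σ₅ (Y u x) * σ₇ (Y u x)) (δ₁ x (Y u x)) ⟩
    χ₁₂ x * χ₁₂ (Y u x) * (σ₅ (Y u x) * σ₇ (Y u x)) * δ₁ x (Y u x)
      ≡⟨ cong₂ _*_ (cong₂ _*_ (χ₁₂-product u x) (cong₂ _*_ (σ₅-linear u x) (σ₇-linear u x)))
                   (cong (λ z → 𝟙 (z ℤ.≟ + M)) (forms-agree u x)) ⟩
    parity u * coprime₆ x * ((- σ₅ (V u x)) * (- σ₇ u)) * δ₂ u (V u x)
      ≡⟨ reorder (parity u) (coprime₆ x) (σ₅ (V u x)) (σ₇ u) (δ₂ u (V u x)) ⟩
    coprime₆ x * K u x ∎
    where
    open ≡-Reasoning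
    gather : ∀ a b c d → a * (b * c) * d ≡ a * b * c * d
    gather = solve-∀
    reorder : ∀ p c a b d → p * c * ((- a) * (- b)) * d ≡ c * (p * (b * a) * d)
    reorder = solve-∀

  -- The reflection u ↦ 7z - u, v ↦ u - z preserves form₂ on the line x = 3z and, for odd z, changes the parity of u.
  K-reflect : ∀ u z → odd z ≡ 1ℤ → K (-1ℤ * u + + 7 * z) (+ 3 * z) ≡ - K u (+ 3 * z)
  K-reflect u z oddz = begin
    parity u′ * (σ₇ u′ * σ₅ (V u′ (+ 3 * z))) * δ₂ u′ (V u′ (+ 3 * z))
      ≡⟨ cong₂ _*_ (cong₂ _*_ parity-u′ (cong₂ _*_ (σ₇-flip u z) σ₅-u′))
                   (cong (λ w → 𝟙 (w ℤ.≟ + M)) (form-flip u z)) ⟩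
    (- parity u) * ((- σ₇ u) * (- σ₅ (V u (+ 3 * z)))) * δ₂ u (V u (+ 3 * z))
      ≡⟨ signs (parity u) (σ₇ u) (σ₅ (V u (+ 3 * z))) (δ₂ u (V u (+ 3 * z))) ⟩
    - K u (+ 3 * z) ∎
    where
    open ≡-Reasoning
    u′ = -1ℤ * u + + 7 * z
    parity-u′ : parity u′ ≡ - parity u
    parity-u′ = begin
      parity u′            ≡⟨ ℤ.*-identityˡ (parity u′) ⟨
      1ℤ * parity u′       ≡⟨ cong (_* parity u′) (sym oddz) ⟩
      odd z * parity u′    ≡⟨ parity-flip u z ⟩
      - (odd z * parity u) ≡⟨ cong (λ o → - (o * parity u)) oddz ⟩
      - (1ℤ * parity u)    ≡⟨ cong -_ (ℤ.*-identityˡ (parity u)) ⟩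
      - parity u ∎
    V-flip : ∀ u z → -1ℤ * (-1ℤ * u + + 7 * z) + + 2 * (+ 3 * z) ≡ 1ℤ * u + -1ℤ * z
    V-flip = solve-∀
    V-line : ∀ u z → -1ℤ * u + + 6 * z ≡ -1ℤ * u + + 2 * (+ 3 * z)
    V-line = solve-∀
    σ₅-u′ : σ₅ (V u′ (+ 3 * z)) ≡ - σ₅ (V u (+ 3 * z))
    σ₅-u′ = trans (cong σ₅ (V-flip u z)) (trans (σ₅-flip u z) (cong (-_ ∘ σ₅) (V-line u z)))
    form-flip : ∀ u z →
      + 15 * ((-1ℤ * u + + 7 * z) * (-1ℤ * u + + 7 * z))
        + + 21 * ((-1ℤ * (-1ℤ * u + + 7 * z) + + 2 * (+ 3 * z)) * (-1ℤ * (-1ℤ * u + + 7 * z) + + 2 * (+ 3 * z)))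
      ≡ + 15 * (u * u) + + 21 * ((-1ℤ * u + + 2 * (+ 3 * z)) * (-1ℤ * u + + 2 * (+ 3 * z)))
    form-flip = solve-∀
    signs : ∀ p a b d → (- p) * ((- a) * (- b)) * d ≡ - (p * (a * b) * d)
    signs = solve-∀

  three₆-vanishes : ∀ x → three₆ x * sumℤ M (λ u → K u x) ≡ 0ℤ
  three₆-vanishes x with three₆ x ℤ.≟ 0ℤ
  ... | yes eq = cong (_* sumℤ M (λ u → K u x)) eq
  ... | no nz with three₆-≢0 x nz
  ...   | z , refl , oddz = trans (cong (three₆ x *_) (self-opposite S S≡-S)) (ℤ.*-zeroʳ (three₆ x))
    where
    S = sumℤ M (λ u → K u (+ 3 * z))
    reflect : ℤ → ℤ
    reflect u = -1ℤ * u + + 7 * z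
    involutive : ∀ u → reflect (reflect u) ≡ u
    involutive u = identity u z
      where
      identity : ∀ u z → -1ℤ * (-1ℤ * u + + 7 * z) + + 7 * z ≡ u
      identity = solve-∀
    bounded : ∀ u → K u (+ 3 * z) ≢ 0ℤ → ∣ u ∣ ℕ.≤ M
    bounded u nz = proj₁ (bound-ux u (+ 3 * z) (K-form u (+ 3 * z) nz))
    reflected : ∀ u → K u (+ 3 * z) ≢ 0ℤ → K (reflect u) (+ 3 * z) ≢ 0ℤ
    reflected u nz eq = nz (trans (sym (ℤ.neg-involutive (K u (+ 3 * z))))
      (cong -_ (trans (sym (K-reflect u z oddz)) eq)))
    S≡-S : S ≡ - S
    S≡-S = trans (sym (sumℤ-reindex M M (λ u → K u (+ 3 * z)) reflect
        (λ j k eq → trans (sym (involutive j)) (trans (cong reflect eq) (involutive k)))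
        (λ u nz → reflect u , bounded (reflect u) (reflected u nz) , involutive u)
        (λ u → bounded (reflect u))))
      (trans (sumℤ-cong′ M (λ u → trans (K-reflect u z oddz) (sym (ℤ.-1*i≡-i (K u (+ 3 * z))))))
        (trans (sumℤ-*ˡ M -1ℤ (λ u → K u (+ 3 * z))) (ℤ.-1*i≡-i S)))

  V-reflect : ∀ u x → V u (1ℤ * u + -1ℤ * x) ≡ - V u x
  V-reflect = identity
    where
    identity : ∀ u x → -1ℤ * u + + 2 * (1ℤ * u + -1ℤ * x) ≡ - (-1ℤ * u + + 2 * x)
    identity = solve-∀

  -- The map x ↦ u - x is v ↦ - v, and of the factors of `K` only `σ₅` is odd in v.
  K-conjugate : ∀ u x → K u (1ℤ * u + -1ℤ * x) ≡ - K u x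
  K-conjugate u x = begin
    parity u * (σ₇ u * σ₅ (V u x′)) * δ₂ u (V u x′)
      ≡⟨ cong (λ v → parity u * (σ₇ u * σ₅ v) * δ₂ u v) (V-reflect u x) ⟩
    parity u * (σ₇ u * σ₅ (- V u x)) * δ₂ u (- V u x)
      ≡⟨ cong₂ (λ a b → parity u * (σ₇ u * a) * b) (σ₅-odd (V u x)) (δ₂-even u (V u x)) ⟩
    parity u * (σ₇ u * (- σ₅ (V u x))) * δ₂ u (V u x)
      ≡⟨ signs (parity u) (σ₇ u) (σ₅ (V u x)) (δ₂ u (V u x)) ⟩
    - K u x ∎
    where
    open ≡-Reasoning
    x′ = 1ℤ * u + -1ℤ * x
    signs : ∀ p a b d → p * (a * (- b)) * d ≡ - (p * (a * b) * d)
    signs = solve-∀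

  F : ℤ → ℤ → ℤ
  F u v = (χ₄ u * σ₇ u) * (χ₄ v * σ₅ v) * δ₂ u v

  -- Since `χ₄` leaves only odd u and v, v = 2x - u reaches every contributing v. By `χ₄-product`
  -- the sign is a difference of the conditions that x and u - x be odd, and `K-conjugate` turns it
  -- into a sum of two terms exchanged by x ↦ u - x.
  fold : ∀ u → sumℤ M (F u) ≡ + 2 * sumℤ M (λ x → odd x * K u x)
  fold u = begin
    sumℤ M (F u)
      ≡⟨ sumℤ-reindex M M (F u) (V u) injective surjective bounded ⟨
    sumℤ M (λ x → F u (V u x))
      ≡⟨ sumℤ-cong′ M onV ⟩
    sumℤ M (λ x → odd x * K u x + odd (x ′) * K u (x ′))
      ≡⟨ sumℤ-+ M (λ x → odd x * K u x) (λ x → odd (x ′) * K u (x ′)) ⟩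
    sumℤ M G + sumℤ M (G ∘ _′)
      ≡⟨ cong (_+_ (sumℤ M G)) (sumℤ-reindex M M G _′
           (λ j k eq → trans (sym (involutive j)) (trans (cong _′ eq) (involutive k)))
           (λ x nz → x ′ , G-bounded (x ′) (K-≢0 x (*-≢0ʳ (odd x) _ nz)) , involutive x)
           (λ x nz → G-bounded (x ′) (*-≢0ʳ (odd (x ′)) _ nz))) ⟩
    sumℤ M G + sumℤ M G
      ≡⟨ x+x≡2x (sumℤ M G) ⟩
    + 2 * sumℤ M G ∎
    where
    open ≡-Reasoning
    infix 9 _′
    _′ : ℤ → ℤ
    x ′ = 1ℤ * u + -1ℤ * x
    G : ℤ → ℤ
    G x = odd x * K u x
    involutive : ∀ x → (x ′) ′ ≡ x
    involutive x = identity u x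
      where
      identity : ∀ u x → 1ℤ * u + -1ℤ * (1ℤ * u + -1ℤ * x) ≡ x
      identity = solve-∀
    G-bounded : ∀ x → K u x ≢ 0ℤ → ∣ x ∣ ℕ.≤ M
    G-bounded x nz = proj₂ (bound-ux u x (K-form u x nz))
    K-≢0 : ∀ x → K u x ≢ 0ℤ → K u (x ′) ≢ 0ℤ
    K-≢0 x nz eq = nz (trans (sym (ℤ.neg-involutive (K u x))) (cong -_ (trans (sym (K-conjugate u x)) eq)))
    onV : ∀ x → F u (V u x) ≡ odd x * K u x + odd (x ′) * K u (x ′)
    onV x = begin
      (χ₄ u * σ₇ u) * (χ₄ (V u x) * σ₅ (V u x)) * δ₂ u (V u x)
        ≡⟨ gather (χ₄ u) (σ₇ u) (χ₄ (V u x)) (σ₅ (V u x)) (δ₂ u (V u x)) ⟩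
      χ₄ u * χ₄ (V u x) * (σ₇ u * σ₅ (V u x) * δ₂ u (V u x))
        ≡⟨ cong (_* (σ₇ u * σ₅ (V u x) * δ₂ u (V u x))) (χ₄-product u x) ⟩
      parity u * (odd x - odd (x ′)) * (σ₇ u * σ₅ (V u x) * δ₂ u (V u x))
        ≡⟨ distribute (parity u) (odd x) (odd (x ′)) (σ₇ u * σ₅ (V u x)) (δ₂ u (V u x)) ⟩
      odd x * K u x + odd (x ′) * (- K u x)
        ≡⟨ cong (λ k → odd x * K u x + odd (x ′) * k) (K-conjugate u x) ⟨
      odd x * K u x + odd (x ′) * K u (x ′) ∎
      where
      gather : ∀ a b c d e → (a * b) * (c * d) * e ≡ a * c * (b * d * e)
      gather = solve-∀
      distribute : ∀ p a b s d → p * (a - b) * (s * d) ≡ a * (p * s * d) + b * (- (p * s * d))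
      distribute = solve-∀
    F-form : ∀ v → F u v ≢ 0ℤ → form₂ u v ≡ + M
    F-form v nz = 𝟙≢0 (form₂ u v ℤ.≟ + M) (*-≢0ʳ ((χ₄ u * σ₇ u) * (χ₄ v * σ₅ v)) _ nz)
    injective : ∀ j k → V u j ≡ V u k → j ≡ k
    injective j k eq = ℤ.*-cancelˡ-≡ (+ 2) j k (+ℤ.∙-cancelˡ (-1ℤ * u) (+ 2 * j) (+ 2 * k) eq)
    bounded : ∀ x → F u (V u x) ≢ 0ℤ → ∣ V u x ∣ ℕ.≤ M
    bounded x nz = proj₂ (form-bound 14 20 u (V u x) M (F-form (V u x) nz))
    surjective : ∀ v → F u v ≢ 0ℤ → ∃ λ x → ∣ x ∣ ℕ.≤ M × V u x ≡ v
    surjective v nz = k , proj₂ (bound-ux u k (trans (cong (form₂ u) V≡v) (F-form v nz))) , V≡v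
      where
      reorder : ∀ a b c d e → (a * b) * (c * d) * e ≡ a * c * (b * d * e)
      reorder = solve-∀
      χχ≢0 : χ₄ u * χ₄ v ≢ 0ℤ
      χχ≢0 = *-≢0ˡ _ (σ₇ u * σ₅ v * δ₂ u v)
        (nz ∘ trans (reorder (χ₄ u) (σ₇ u) (χ₄ v) (σ₅ v) (δ₂ u v)))
      even-sum : div₂ (1ℤ * u + 1ℤ * v) ≢ 0ℤ
      even-sum = *-≢0ʳ (χ₄ u * χ₄ v) _ (χχ≢0 ∘ trans (χ₄-even-sum u v))
      twofold : ∃ λ k → 1ℤ * u + 1ℤ * v ≡ + 2 * k
      twofold = div₂-≢0 (1ℤ * u + 1ℤ * v) even-sum
      k = proj₁ twofold
      cancel : ∀ u v → -1ℤ * u + (1ℤ * u + 1ℤ * v) ≡ v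
      cancel = solve-∀
      V≡v : V u k ≡ v
      V≡v = trans (cong (_+_ (-1ℤ * u)) (sym (proj₂ twofold))) (cancel u v)

  lattice : sumℤ M (λ x → sumℤ M (H x)) ≡ sumℤ M (λ u → sumℤ M (F u))
  lattice = begin
    sumℤ M (λ x → sumℤ M (H x))
      ≡⟨ sumℤ-cong′ M (λ x → trans (halve x) (cong (+ 2 *_)
           (trans (sumℤ-cong′ M (λ u → H-as-K u x)) (trans (sumℤ-*ˡ M (coprime₆ x) (λ u → K u x)) (coprime-odd x))))) ⟩
    sumℤ M (λ x → + 2 * sumℤ M (λ u → odd x * K u x))
      ≡⟨ sumℤ-*ˡ M (+ 2) (λ x → sumℤ M (λ u → odd x * K u x)) ⟩
    + 2 * sumℤ M (λ x → sumℤ M (λ u → odd x * K u x))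
      ≡⟨ cong (+ 2 *_) (sumℤ-swap M M (λ x u → odd x * K u x)) ⟩
    + 2 * sumℤ M (λ u → sumℤ M (λ x → odd x * K u x))
      ≡⟨ sumℤ-*ˡ M (+ 2) (λ u → sumℤ M (λ x → odd x * K u x)) ⟨
    sumℤ M (λ u → + 2 * sumℤ M (λ x → odd x * K u x))
      ≡⟨ sumℤ-cong′ M fold ⟨
    sumℤ M (λ u → sumℤ M (F u)) ∎
    where
    open ≡-Reasoning
    -- Adding the vanishing contribution of the odd multiples of 3 weakens the condition that x be
    -- prime to 6 to x being odd.
    coprime-odd : ∀ x → coprime₆ x * sumℤ M (λ u → K u x) ≡ sumℤ M (λ u → odd x * K u x)
    coprime-odd x = begin
      coprime₆ x * S            ≡⟨ ℤ.+-identityʳ (coprime₆ x * S) ⟨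
      coprime₆ x * S + 0ℤ       ≡⟨ cong (_+_ (coprime₆ x * S)) (three₆-vanishes x) ⟨
      coprime₆ x * S + three₆ x * S ≡⟨ ℤ.*-distribʳ-+ S (coprime₆ x) (three₆ x) ⟨
      (coprime₆ x + three₆ x) * S   ≡⟨ cong (_* S) (coprime₆-split x) ⟨
      odd x * S                     ≡⟨ sumℤ-*ˡ M (odd x) (λ u → K u x) ⟨
      sumℤ M (λ u → odd x * K u x) ∎
      where S = sumℤ M (λ u → K u x)

-- The enumeration of the squares 840 m + 169

StrictlyIncreasing : (ℕ → ℕ) → Set
StrictlyIncreasing f = ∀ m n → m ℕ.< n → f m ℕ.< f n

module _ {f : ℕ → ℕ} (f-inc : StrictlyIncreasing f) where

  increasing-≤ : ∀ m n → m ℕ.≤ n → f m ℕ.≤ f n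
  increasing-≤ m n m≤n with ℕ.m≤n⇒m<n∨m≡n m≤n
  ... | inj₁ m<n  = ℕ.<⇒≤ (f-inc m n m<n)
  ... | inj₂ refl = ℕ.≤-refl

  increasing-reflects-< : ∀ m n → f m ℕ.< f n → m ℕ.< n
  increasing-reflects-< m n fm<fn = ℕ.≰⇒> (λ n≤m → ℕ.<⇒≱ fm<fn (increasing-≤ n m n≤m))

  increasing-injective : ∀ m n → f m ≡ f n → m ≡ n
  increasing-injective m n eq with ℕ.<-cmp m n
  ... | tri< m<n _ _ = contradiction eq (ℕ.<⇒≢ (f-inc m n m<n))
  ... | tri≈ _ m≡n _ = m≡n
  ... | tri> _ _ n<m = contradiction (sym eq) (ℕ.<⇒≢ (f-inc n m n<m))

  increasing-≥ : ∀ n → n ℕ.≤ f n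
  increasing-≥ zero    = z≤n
  increasing-≥ (suc n) = ℕ.≤-<-trans (increasing-≥ n) (f-inc n (suc n) ℕ.≤-refl)

module _ {f g : ℕ → ℕ} (f-inc : StrictlyIncreasing f) (g-inc : StrictlyIncreasing g) where

  -- The index k n with f (k n) = g n is strictly increasing in n, so n ≤ k n and f n ≤ f (k n) = g
  -- n.
  enumeration-≤ : (∀ n → ∃ λ k → f k ≡ g n) → ∀ n → f n ℕ.≤ g n
  enumeration-≤ inverse n = subst (f n ℕ.≤_) (proj₂ (inverse n)) (increasing-≤ f-inc n (index n) (increasing-≥ index-inc n))
    where
    index : ℕ → ℕ
    index n = proj₁ (inverse n)
    index-inc : StrictlyIncreasing index
    index-inc m n m<n = increasing-reflects-< f-inc (index m) (index n)
      (subst₂ ℕ._<_ (sym (proj₂ (inverse m))) (sym (proj₂ (inverse n))) (g-inc m n m<n))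

enumeration-unique : ∀ {f g} → StrictlyIncreasing f → StrictlyIncreasing g →
  (∀ n → ∃ λ k → f k ≡ g n) → (∀ n → ∃ λ k → g k ≡ f n) → ∀ n → f n ≡ g n
enumeration-unique f-inc g-inc f⊇g g⊇f n = ℕ.≤-antisym (enumeration-≤ f-inc g-inc f⊇g n) (enumeration-≤ g-inc f-inc g⊇f n)

-- The residues s modulo 420 with s² ≡ 169 modulo 840, in increasing order: two choices modulo each
-- of 4, 3, 5 and 7. The value 0 is a default for indices outside the table.
root : ℕ → ℕ
root 0  = 13
root 1  = 43
root 2  = 83
root 3  = 97
root 4  = 113
root 5  = 127
root 6  = 167
root 7  = 197
root 8  = 223
root 9  = 253
root 10 = 293
root 11 = 307
root 12 = 323
root 13 = 337
root 14 = 377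
root 15 = 407
root _  = 0

root-increasing : ∀ {k} → k ℕ.< 16 → ∀ {j} → j ℕ.< k → root j ℕ.< root k
root-increasing = toWitness {a? = ℕ.allUpTo? (λ k → ℕ.allUpTo? (λ j → root j ℕ.<? root k) k) 16} tt

root-bounds : ∀ {k} → k ℕ.< 16 → 0 ℕ.< root k × root k ℕ.< 420
root-bounds = toWitness {a? = ℕ.allUpTo? (λ k → (0 ℕ.<? root k) ×-dec (root k ℕ.<? 420)) 16} tt

rootLevel : ℕ → ℕ
rootLevel k = (root k ℕ.* root k ℕ.∸ 169) / 840

root-square : ∀ {k} → k ℕ.< 16 → root k ℕ.* root k ≡ 840 ℕ.* rootLevel k ℕ.+ 169
root-square = toWitness {a? = ℕ.allUpTo? (λ k → root k ℕ.* root k ℕ.≟ 840 ℕ.* rootLevel k ℕ.+ 169) 16} tt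

root-complete : ∀ {s} → s ℕ.< 420 → (s ℕ.* s) % 840 ≡ 169 → ∃ λ k → k ℕ.< 16 × root k ≡ s
root-complete = toWitness {a? = ℕ.allUpTo?
  (λ s → ((s ℕ.* s) % 840 ℕ.≟ 169) →-dec ℕ.anyUpTo? (λ k → root k ℕ.≟ s) 16) 420} tt

ψ-roots : ∀ {s} → s ℕ.< 420 → ψ (+ s) ≢ 0ℤ → ∃ λ k → k ℕ.< 16 × root k ≡ s
ψ-roots = toWitness {a? = ℕ.allUpTo?
  (λ s → ¬? (ψ (+ s) ℤ.≟ 0ℤ) →-dec ℕ.anyUpTo? (λ k → root k ℕ.≟ s) 16) 420} tt

-- The table of `t` is `ψ` read along the sixteen roots; its period 16 in n reflects the period 420
-- of `ψ`.
ψ-sign : ∀ {k} → k ℕ.< 16 → ψ (+ root k) ≡ (if tZero k then + 1 else - (+ 1))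
ψ-sign = toWitness {a? = ℕ.allUpTo? (λ k → ψ (+ root k) ℤ.≟ (if tZero k then + 1 else - (+ 1))) 16} tt

ψ-periodic : Periodic 420 ψ
ψ-periodic z k = cong₂ _*_ (proj₂ χ₁₂ᵖ 35 z k) (cong₂ _*_ (proj₂ σ₅ᵖ 84 z k) (proj₂ σ₇ᵖ 60 z k))

sqrtTerm : ℕ → ℕ
sqrtTerm n = root (n % 16) ℕ.+ n / 16 ℕ.* 420

sqrtTerm-increasing : StrictlyIncreasing sqrtTerm
sqrtTerm-increasing m n m<n with ℕ.m≤n⇒m<n∨m≡n (/-monoˡ-≤ 16 (ℕ.<⇒≤ m<n))
... | inj₁ q<q′ = ℕ.<-≤-trans
  (ℕ.+-monoˡ-< (m / 16 ℕ.* 420) (proj₂ (root-bounds (m%n<n m 16))))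
  (ℕ.≤-trans (ℕ.*-monoˡ-≤ 420 q<q′) (ℕ.m≤n+m (n / 16 ℕ.* 420) (root (n % 16))))
... | inj₂ q≡q′ = subst (λ q → root (m % 16) ℕ.+ m / 16 ℕ.* 420 ℕ.< root (n % 16) ℕ.+ q ℕ.* 420) q≡q′
  (ℕ.+-monoˡ-< (m / 16 ℕ.* 420) (root-increasing (m%n<n n 16) m%16<n%16))
  where
  m%16<n%16 : m % 16 ℕ.< n % 16
  m%16<n%16 = ℕ.+-cancelʳ-< (m / 16 ℕ.* 16) (m % 16) (n % 16)
    (subst₂ ℕ._<_ (m≡m%n+[m/n]*n m 16)
      (trans (m≡m%n+[m/n]*n n 16) (cong (λ q → n % 16 ℕ.+ q ℕ.* 16) (sym q≡q′))) m<n)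

sqrtTerm-onto : ∀ p {k} → k ℕ.< 16 → root k ≡ p % 420 → sqrtTerm (k ℕ.+ p / 420 ℕ.* 16) ≡ p
sqrtTerm-onto p {k} k<16 eq = trans (cong₂ (λ r q → root r ℕ.+ q ℕ.* 420) remainder quotient)
  (trans (cong (ℕ._+ p / 420 ℕ.* 420) eq) (sym (m≡m%n+[m/n]*n p 420)))
  where
  remainder : (k ℕ.+ p / 420 ℕ.* 16) % 16 ≡ k
  remainder = trans ([m+kn]%n≡m%n k (p / 420) 16) (m<n⇒m%n≡m k<16)
  quotient : (k ℕ.+ p / 420 ℕ.* 16) / 16 ≡ p / 420
  quotient = trans (+-distrib-/-∣ʳ k (n∣m*n (p / 420)))
    (cong₂ ℕ._+_ (m<n⇒m/n≡0 k<16) (m*n/n≡m (p / 420) 16))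

-- Since 420² = 210 · 840, the square modulo 840 depends only on the residue modulo 420.
square-mod-420 : ∀ r q → (r ℕ.+ q ℕ.* 420) ℕ.* (r ℕ.+ q ℕ.* 420) ≡ r ℕ.* r ℕ.+ (210 ℕ.* q ℕ.* q ℕ.+ q ℕ.* r) ℕ.* 840
square-mod-420 = ℕ-Ring.solve-∀

term : ℕ → ℕ
term n = rootLevel (n % 16) ℕ.+ (210 ℕ.* (n / 16) ℕ.* (n / 16) ℕ.+ n / 16 ℕ.* root (n % 16))

sqrtTerm-square : ∀ n → sqrtTerm n ℕ.* sqrtTerm n ≡ 840 ℕ.* term n ℕ.+ 169
sqrtTerm-square n = trans (square-mod-420 (root (n % 16)) (n / 16))
  (trans (cong (ℕ._+ k ℕ.* 840) (root-square (m%n<n n 16))) (collect (rootLevel (n % 16)) k))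
  where
  k = 210 ℕ.* (n / 16) ℕ.* (n / 16) ℕ.+ n / 16 ℕ.* root (n % 16)
  collect : ∀ l t → 840 ℕ.* l ℕ.+ 169 ℕ.+ t ℕ.* 840 ≡ 840 ℕ.* (l ℕ.+ t) ℕ.+ 169
  collect = ℕ-Ring.solve-∀

term-increasing : StrictlyIncreasing term
term-increasing m n m<n = ℕ.*-cancelˡ-< 840 (term m) (term n) (ℕ.+-cancelʳ-< 169 (840 ℕ.* term m) (840 ℕ.* term n)
  (subst₂ ℕ._<_ (sqrtTerm-square m) (sqrtTerm-square n) (ℕ.*-mono-< s<s′ s<s′)))
  where
  s<s′ = sqrtTerm-increasing m n m<n

term-≡ : ∀ n m → sqrtTerm n ℕ.* sqrtTerm n ≡ 840 ℕ.* m ℕ.+ 169 → term n ≡ m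
term-≡ n m eq = ℕ.*-cancelˡ-≡ (term n) m 840 (ℕ.+-cancelʳ-≡ 169 (840 ℕ.* term n) (840 ℕ.* m) (trans (sym (sqrtTerm-square n)) eq))

term-complete : ∀ m → IsSquare (840 ℕ.* m ℕ.+ 169) → ∃ λ n → term n ≡ m
term-complete m (p , p²≡) = conclude (root-complete (m%n<n p 420) residue)
  where
  s = p % 420
  q = p / 420
  residue : (s ℕ.* s) % 840 ≡ 169
  residue = begin
    (s ℕ.* s) % 840
      ≡⟨ [m+kn]%n≡m%n (s ℕ.* s) (210 ℕ.* q ℕ.* q ℕ.+ q ℕ.* s) 840 ⟨
    (s ℕ.* s ℕ.+ (210 ℕ.* q ℕ.* q ℕ.+ q ℕ.* s) ℕ.* 840) % 840
      ≡⟨ cong (_% 840) (square-mod-420 s q) ⟨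
    ((s ℕ.+ q ℕ.* 420) ℕ.* (s ℕ.+ q ℕ.* 420)) % 840
      ≡⟨ cong (λ k → (k ℕ.* k) % 840) (m≡m%n+[m/n]*n p 420) ⟨
    (p ℕ.* p) % 840
      ≡⟨ cong (_% 840) (trans p²≡ (trans (ℕ.+-comm (840 ℕ.* m) 169) (cong (169 ℕ.+_) (ℕ.*-comm 840 m)))) ⟩
    (169 ℕ.+ m ℕ.* 840) % 840
      ≡⟨ [m+kn]%n≡m%n 169 m 840 ⟩
    169 ∎
    where open ≡-Reasoning
  conclude : (∃ λ k → k ℕ.< 16 × root k ≡ s) → ∃ λ n → term n ≡ m
  conclude (k , k<16 , eq) = k ℕ.+ q ℕ.* 16 ,
    term-≡ (k ℕ.+ q ℕ.* 16) m (trans (cong (λ r → r ℕ.* r) (sqrtTerm-onto p k<16 eq)) p²≡)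

sequence-≡-term : ∀ a → StrictlyIncreasing a → (∀ m → IsSquare (840 ℕ.* m ℕ.+ 169) ⇔ (∃ λ n → a n ≡ m)) → ∀ n → a n ≡ term n
sequence-≡-term a a-inc a-image = enumeration-unique a-inc term-increasing
  (λ n → Equivalence.to (a-image (term n)) (sqrtTerm n , sqrtTerm-square n))
  (λ n → term-complete (a n) (Equivalence.from (a-image (a n)) (n , refl)))

-- The left-hand side as a theta series

ψ-sqrtTerm : ∀ n → ψ (+ sqrtTerm n) ≡ sgn n
ψ-sqrtTerm n = trans
  (cong ψ (cong (_+_ (+ root (n % 16))) (ℤ.pos-* (n / 16) 420)))
  (trans (ψ-periodic (+ root (n % 16)) (+ (n / 16))) (ψ-sign (m%n<n n 16)))

ψ-supportℕ : ∀ p → ψ (+ p) ≢ 0ℤ → ∃ λ n → sqrtTerm n ≡ p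
ψ-supportℕ p nz = conclude (ψ-roots (m%n<n p 420) (λ eq → nz (trans
  (cong ψ (trans (cong +_ (m≡m%n+[m/n]*n p 420)) (cong (_+_ (+ (p % 420))) (ℤ.pos-* (p / 420) 420))))
  (trans (ψ-periodic (+ (p % 420)) (+ (p / 420))) eq))))
  where
  conclude : (∃ λ k → k ℕ.< 16 × root k ≡ p % 420) → ∃ λ n → sqrtTerm n ≡ p
  conclude (k , k<16 , eq) = k ℕ.+ p / 420 ℕ.* 16 , sqrtTerm-onto p k<16 eq

ψ-support : ∀ u → ψ u ≢ 0ℤ → ∃ λ n → + sqrtTerm n ≡ u ⊎ + sqrtTerm n ≡ - u
ψ-support (+ p)    nz = let n , eq = ψ-supportℕ p nz in n , inj₁ (cong +_ eq)
ψ-support -[1+ p ] nz = let n , eq = ψ-supportℕ (suc p) (nz ∘ trans (ψ-even (+ suc p))) in n , inj₂ (cong +_ eq)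

+sqrtTerm-square : ∀ n → + sqrtTerm n * + sqrtTerm n ≡ + 840 * + term n + + 169
+sqrtTerm-square n = trans (sym (ℤ.pos-* (sqrtTerm n) (sqrtTerm n)))
  (trans (cong +_ (sqrtTerm-square n)) (cong (_+ + 169) (ℤ.pos-* 840 (term n))))

level-sqrtTerm : ∀ n → level 840 169 (+ sqrtTerm n) ≡ term n
level-sqrtTerm n = level-≡ 840 169 (+ sqrtTerm n) (term n) (+sqrtTerm-square n)

ψ-level : ∀ u → ψ u ≢ 0ℤ → ∃ λ n → (+ sqrtTerm n ≡ u ⊎ + sqrtTerm n ≡ - u) × level 840 169 u ≡ term n
ψ-level u nz with ψ-support u nz
... | n , inj₁ eq = n , inj₁ eq , trans (cong (level 840 169) (sym eq)) (level-sqrtTerm n)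
... | n , inj₂ eq = n , inj₂ eq ,
  trans (sym (level-neg 840 169 u)) (trans (cong (level 840 169) (sym eq)) (level-sqrtTerm n))

ψ-square : ∀ u → ψ u ≢ 0ℤ → u * u ≡ + 840 * + level 840 169 u + + 169
ψ-square u nz = conclude (ψ-level u nz)
  where
  square : ∀ {s} → s ≡ u ⊎ s ≡ - u → u * u ≡ s * s
  square (inj₁ refl) = refl
  square (inj₂ refl) = sym (neg-square u)
  conclude : (∃ λ n → (+ sqrtTerm n ≡ u ⊎ + sqrtTerm n ≡ - u) × level 840 169 u ≡ term n) →
    u * u ≡ + 840 * + level 840 169 u + + 169
  conclude (n , sign , lvl) = trans (square sign) (trans (+sqrtTerm-square n) (cong (λ e → + 840 * + e + + 169) (sym lvl)))

-- The analogue of `theta-fold`, with the positive roots `sqrtTerm n` in the role of the centers.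
-- Indices n ≤ N suffice because n ≤ term n.
lhs-fold : ∀ a → (∀ n → a n ≡ term n) → ∀ N C → 840 ℕ.* N ℕ.+ 169 ℕ.≤ C →
  + 2 * lhsSeries a N ≡ sumℤ C (λ u → ψ u * 𝟙 (N ℕ.≟ level 840 169 u))
lhs-fold a a≡term N C bound = trans
  (cong (+ 2 *_) (sum-cong (suc N) (λ n _ → summand n)))
  (sum-fold-even (suc N) C h (λ n → + sqrtTerm n)
    (λ u → cong₂ (λ x y → x * 𝟙 (N ℕ.≟ y)) (ψ-even u) (level-neg 840 169 u))
    (λ i j _ _ eq → increasing-injective sqrtTerm-increasing i j (ℤ.+-injective eq))
    (λ i j → opposite (sqrtTerm i) (sqrtTerm j) (positive i))
    surjective
    (λ i _ → bounded i))
  where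
  h : ℤ → ℤ
  h u = ψ u * 𝟙 (N ℕ.≟ level 840 169 u)
  h-level : ∀ u → h u ≢ 0ℤ → N ≡ level 840 169 u
  h-level u nz = 𝟙≢0 (N ℕ.≟ level 840 169 u) (*-≢0ʳ (ψ u) _ nz)
  choose : {P : Set} (P? : Dec P) (s : ℤ) → (if does P? then s else + 0) ≡ s * 𝟙 P?
  choose (yes _) s = sym (ℤ.*-identityʳ s)
  choose (no _)  s = sym (ℤ.*-zeroʳ s)
  summand : ∀ n → (if does (a n ℕ.≟ N) then sgn n else + 0) ≡ h (+ sqrtTerm n)
  summand n = trans (choose (a n ℕ.≟ N) (sgn n)) (cong₂ _*_ (sym (ψ-sqrtTerm n))
    (𝟙-cong (a n ℕ.≟ N) (N ℕ.≟ level 840 169 (+ sqrtTerm n))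
      (λ eq → trans (sym eq) (trans (a≡term n) (sym (level-sqrtTerm n))))
      (λ eq → trans (a≡term n) (trans (sym (level-sqrtTerm n)) (sym eq)))))
  positive : ∀ n → 0 ℕ.< sqrtTerm n
  positive n = ℕ.<-≤-trans (proj₁ (root-bounds (m%n<n n 16))) (ℕ.m≤m+n (root (n % 16)) (n / 16 ℕ.* 420))
  opposite : ∀ p q → 0 ℕ.< p → + p ≢ - + q
  opposite (suc p) zero    _ ()
  opposite (suc p) (suc q) _ ()
  surjective : ∀ u → h u ≢ 0ℤ → ∃ λ n → n ℕ.< suc N × (+ sqrtTerm n ≡ u ⊎ + sqrtTerm n ≡ - u)
  surjective u nz with ψ-level u (*-≢0ˡ (ψ u) _ nz)
  ... | n , sign , lvl = n , s≤s (ℕ.≤-trans (increasing-≥ term-increasing n) (ℕ.≤-reflexive (sym (trans (h-level u nz) lvl)))) , sign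
  bounded : ∀ n → h (+ sqrtTerm n) ≢ 0ℤ → sqrtTerm n ℕ.≤ C
  bounded n nz = ℕ.≤-trans (square-bound (+ sqrtTerm n) (840 ℕ.* N ℕ.+ 169)
    (trans (+sqrtTerm-square n) (trans
      (cong (λ e → + 840 * + e + + 169) (sym (trans (h-level (+ sqrtTerm n) nz) (level-sqrtTerm n))))
      (cong (_+ + 169) (sym (ℤ.pos-* 840 N)))))) bound

-- The three triple products and the comparison of coefficients

module Euler = Theta 0 0
module Theta₇ = Theta 2 0
module Theta₅ = Theta 0 2

-- The centers 14n - 1 and 10n - 3 are constant modulo 7 and modulo 5 but alternate modulo 4, so
-- `χ₄` supplies (- 1)^n up to a constant sign that `σ₇` and `σ₅` correct.
w₇ w₅ : ℤ → ℤ
w₇ u = χ₄ u * σ₇ u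
w₅ v = χ₄ v * σ₅ v

w₇-periodic : Periodic 28 w₇
w₇-periodic z k = cong₂ _*_ (proj₂ χ₄ᵖ 7 z k) (proj₂ σ₇ᵖ 4 z k)

w₅-periodic : Periodic 20 w₅
w₅-periodic z k = cong₂ _*_ (proj₂ χ₄ᵖ 5 z k) (proj₂ σ₅ᵖ 4 z k)

w₇-even : ∀ u → w₇ (- u) ≡ w₇ u
w₇-even = even-on-residues w₇-periodic tt

w₅-even : ∀ u → w₅ (- u) ≡ w₅ u
w₅-even = even-on-residues w₅-periodic tt

χ₁₂-center : ∀ n → χ₁₂ (Euler.center n) ≡ alt n
χ₁₂-center = Euler.periodic-center χ₁₂ (proj₂ χ₁₂ᵖ 1) refl tt

χ₁₂-support : ∀ x → χ₁₂ x ≢ 0ℤ → ∃ λ n → Euler.center n ≡ x ⊎ Euler.center n ≡ - x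
χ₁₂-support = Euler.periodic-support χ₁₂ (proj₂ χ₁₂ᵖ 1) tt

w₇-center : ∀ n → w₇ (Theta₇.center n) ≡ alt n
w₇-center = Theta₇.periodic-center w₇ w₇-periodic refl tt

w₇-support : ∀ u → w₇ u ≢ 0ℤ → ∃ λ n → Theta₇.center n ≡ u ⊎ Theta₇.center n ≡ - u
w₇-support = Theta₇.periodic-support w₇ w₇-periodic tt

w₅-center : ∀ n → w₅ (Theta₅.center n) ≡ alt n
w₅-center = Theta₅.periodic-center w₅ w₅-periodic refl tt

w₅-support : ∀ v → w₅ v ≢ 0ℤ → ∃ λ n → Theta₅.center n ≡ v ⊎ Theta₅.center n ≡ - v
w₅-support = Theta₅.periodic-support w₅ w₅-periodic tt

weighted-𝟙-cong : {P Q : Set} (c : ℤ) (P? : Dec P) (Q? : Dec Q) → (c ≢ 0ℤ → (P → Q) × (Q → P)) → c * 𝟙 P? ≡ c * 𝟙 Q?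
weighted-𝟙-cong c P? Q? iff with c ℤ.≟ 0ℤ
... | yes refl = refl
... | no c≢0   = cong (c *_) (𝟙-cong P? Q? (proj₁ (iff c≢0)) (proj₂ (iff c≢0)))

-- 35 x² + y² and 15 u² + 21 v² both become 840 (e + f) + 204 in terms of the exponents e and f.
level-sum : ∀ {N M} → 840 ℕ.* N ℕ.+ 204 ≡ M → ∀ X e f → X ≡ + 840 * (+ e + + f) + + 204 →
  (N ≡ e ℕ.+ f → X ≡ + M) × (X ≡ + M → N ≡ e ℕ.+ f)
level-sum {N} refl X e f X≡ =
  (λ { refl → X≡+ }) ,
  (λ eq → ℕ.*-cancelˡ-≡ N (e ℕ.+ f) 840 (ℕ.+-cancelʳ-≡ 204 (840 ℕ.* N) (840 ℕ.* (e ℕ.+ f))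
    (ℤ.+-injective (trans (sym eq) X≡+))))
  where
  X≡+ : X ≡ + (840 ℕ.* (e ℕ.+ f) ℕ.+ 204)
  X≡+ = trans X≡ (cong (_+ + 204) (sym (ℤ.pos-* 840 (e ℕ.+ f))))

2*⊛2* : ∀ f g N → ((λ i → + 2 * f i) ⊛ (λ i → + 2 * g i)) N ≡ + 4 * (f ⊛ g) N
2*⊛2* f g N = trans
  (sum-cong (suc N) (λ i _ → four (f i) (g (N ℕ.∸ i))))
  (sum-*ˡ (suc N) (+ 4) (λ i → f i * g (N ℕ.∸ i)))
  where
  four : ∀ a b → (+ 2 * a) * (+ 2 * b) ≡ + 4 * (a * b)
  four = solve-∀

bound : ∀ k r i {N M} → k ℕ.≤ 840 → r ℕ.≤ 204 → i ℕ.≤ N → 840 ℕ.* N ℕ.+ 204 ≡ M → k ℕ.* i ℕ.+ r ℕ.≤ M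
bound k r i k≤ r≤ i≤N refl = ℕ.+-mono-≤ (ℕ.*-mono-≤ k≤ i≤N) r≤

-- The number M = 840 N + 204 is both the value taken by the two forms and a truncation bound valid
-- for all four theta series. The factor 4 comes from doubling both factors of each product and is
-- cancelled in ℤ.
euler-⊛-lhs-coefficient : ∀ a → (∀ n → a n ≡ term n) → ∀ N M → 840 ℕ.* N ℕ.+ 204 ≡ M →
  (Euler.thetaProduct ⊛ lhsSeries a) N ≡ (Theta₇.thetaProduct ⊛ Theta₅.thetaProduct) N
euler-⊛-lhs-coefficient a a≡term N M M≡ = ℤ.*-cancelˡ-≡ (+ 4) ((E ⊛ L) N) ((T₇ ⊛ T₅) N) (begin
  + 4 * (E ⊛ L) N
    ≡⟨ 2*⊛2* E L N ⟨
  (2E ⊛ 2L) N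
    ≡⟨ ⊛-agree N {f = 2E} {f′ = genSeries M χ₁₂ (level 24 1)} {g = 2L} {g′ = genSeries M ψ (level 840 169)} E-agree L-agree N ℕ.≤-refl ⟩
  (genSeries M χ₁₂ (level 24 1) ⊛ genSeries M ψ (level 840 169)) N
    ≡⟨ genSeries-⊛ M χ₁₂ (level 24 1) ψ (level 840 169) N ⟩
  sumℤ M (λ x → sumℤ M (λ y → χ₁₂ x * ψ y * 𝟙 (N ℕ.≟ level 24 1 x ℕ.+ level 840 169 y)))
    ≡⟨ sumℤ-cong′ M (λ x → sumℤ-cong′ M (λ y → to-form₁ x y)) ⟩
  sumℤ M (λ x → sumℤ M (H x))
    ≡⟨ lattice ⟩
  sumℤ M (λ u → sumℤ M (F u))
    ≡⟨ sumℤ-cong′ M (λ u → sumℤ-cong′ M (λ v → to-form₂ u v)) ⟨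
  sumℤ M (λ u → sumℤ M (λ v → w₇ u * w₅ v * 𝟙 (N ℕ.≟ level 56 1 u ℕ.+ level 40 9 v)))
    ≡⟨ genSeries-⊛ M w₇ (level 56 1) w₅ (level 40 9) N ⟨
  (genSeries M w₇ (level 56 1) ⊛ genSeries M w₅ (level 40 9)) N
    ≡⟨ ⊛-agree N {f = 2T₇} {f′ = genSeries M w₇ (level 56 1)} {g = 2T₅} {g′ = genSeries M w₅ (level 40 9)} T₇-agree T₅-agree N ℕ.≤-refl ⟨
  (2T₇ ⊛ 2T₅) N
    ≡⟨ 2*⊛2* T₇ T₅ N ⟩
  + 4 * (T₇ ⊛ T₅) N ∎)
  where
  open ≡-Reasoning
  E = Euler.thetaProduct
  T₇ = Theta₇.thetaProduct
  T₅ = Theta₅.thetaProduct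
  L = lhsSeries a
  2E 2L 2T₇ 2T₅ : Series
  2E i  = + 2 * E i
  2L i  = + 2 * L i
  2T₇ i = + 2 * T₇ i
  2T₅ i = + 2 * T₅ i
  E-agree : Agree N 2E (genSeries M χ₁₂ (level 24 1))
  E-agree i i≤N = Euler.theta-fold χ₁₂ χ₁₂-even χ₁₂-center χ₁₂-support i M
    (bound 24 1 i (ℕ.m≤m+n 24 816) (ℕ.m≤m+n 1 203) i≤N M≡)
  L-agree : Agree N 2L (genSeries M ψ (level 840 169))
  L-agree i i≤N = lhs-fold a a≡term i M (bound 840 169 i ℕ.≤-refl (ℕ.m≤m+n 169 35) i≤N M≡)
  T₇-agree : Agree N 2T₇ (genSeries M w₇ (level 56 1))
  T₇-agree i i≤N = Theta₇.theta-fold w₇ w₇-even w₇-center w₇-support i M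
    (bound 56 1 i (ℕ.m≤m+n 56 784) (ℕ.m≤m+n 1 203) i≤N M≡)
  T₅-agree : Agree N 2T₅ (genSeries M w₅ (level 40 9))
  T₅-agree i i≤N = Theta₅.theta-fold w₅ w₅-even w₅-center w₅-support i M
    (bound 40 9 i (ℕ.m≤m+n 40 800) (ℕ.m≤m+n 9 195) i≤N M≡)
  open Lattice M using (H; F; form₁; form₂; lattice)
  to-form₁ : ∀ x y → χ₁₂ x * ψ y * 𝟙 (N ℕ.≟ level 24 1 x ℕ.+ level 840 169 y) ≡ H x y
  to-form₁ x y = weighted-𝟙-cong (χ₁₂ x * ψ y) (N ℕ.≟ level 24 1 x ℕ.+ level 840 169 y) (form₁ x y ℤ.≟ + M)
    (λ nz → level-sum M≡ (form₁ x y) (level 24 1 x) (level 840 169 y) (trans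
      (cong₂ (λ s t → + 35 * s + + 1 * t)
        (Euler.support-square χ₁₂ χ₁₂-even χ₁₂-center χ₁₂-support x (*-≢0ˡ (χ₁₂ x) (ψ y) nz))
        (ψ-square y (*-≢0ʳ (χ₁₂ x) (ψ y) nz)))
      (collect (+ level 24 1 x) (+ level 840 169 y))))
    where
    collect : ∀ e f → + 35 * (+ 24 * e + + 1) + + 1 * (+ 840 * f + + 169) ≡ + 840 * (e + f) + + 204
    collect = solve-∀
  to-form₂ : ∀ u v → w₇ u * w₅ v * 𝟙 (N ℕ.≟ level 56 1 u ℕ.+ level 40 9 v) ≡ F u v
  to-form₂ u v = weighted-𝟙-cong (w₇ u * w₅ v) (N ℕ.≟ level 56 1 u ℕ.+ level 40 9 v) (form₂ u v ℤ.≟ + M)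
    (λ nz → level-sum M≡ (form₂ u v) (level 56 1 u) (level 40 9 v) (trans
      (cong₂ (λ s t → + 15 * s + + 21 * t)
        (Theta₇.support-square w₇ w₇-even w₇-center w₇-support u (*-≢0ˡ (w₇ u) (w₅ v) nz))
        (Theta₅.support-square w₅ w₅-even w₅-center w₅-support v (*-≢0ʳ (w₇ u) (w₅ v) nz)))
      (collect (+ level 56 1 u) (+ level 40 9 v))))
    where
    collect : ∀ e f → + 15 * (+ 56 * e + + 1) + + 21 * (+ 40 * f + + 9) ≡ + 840 * (e + f) + + 204
    collect = solve-∀

euler-⊛-lhs : ∀ a → (∀ n → a n ≡ term n) → Euler.thetaProduct ⊛ lhsSeries a ≗ Theta₇.thetaProduct ⊛ Theta₅.thetaProduct
euler-⊛-lhs a a≡term N = euler-⊛-lhs-coefficient a a≡term N (840 ℕ.* N ℕ.+ 204) refl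

-- Division by the Euler product

euler-mod-5 : Euler.thetaProduct ≗ oneS ⊛ poch 1 5 ⊛ poch 2 5 ⊛ poch 3 5 ⊛ poch 4 5 ⊛ poch 5 5
euler-mod-5 = begin
  poch 1 3 ⊛ poch 2 3 ⊛ poch 3 3
    ≈⟨ ⊛-congʳ (poch 3 3) (⊛-congʳ (poch 2 3) (λ N → sym (⊛-identityˡ (poch 1 3) N))) ⟩
  oneS ⊛ poch 1 3 ⊛ poch 2 3 ⊛ poch 3 3
    ≈⟨ (λ N → sym (poch-residues 3 N)) ⟩
  poch 1 1
    ≈⟨ poch-residues 5 ⟩
  oneS ⊛ poch 1 5 ⊛ poch 2 5 ⊛ poch 3 5 ⊛ poch 4 5 ⊛ poch 5 5 ∎
  where open ≗-Reasoning

module _ {c ℓ} (M : CommutativeMonoid c ℓ) where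

  open CommutativeMonoid M using (_∙_; _≈_; ε; ∙-cong; ∙-congˡ; ∙-congʳ; identityˡ; identityʳ) renaming (refl to ≈-refl; trans to ≈-trans)
  open import Algebra.Solver.CommutativeMonoid M using (solve; id) renaming (_⊕_ to _⊗_; _⊜_ to _≋_)
  open import Relation.Binary.Reasoning.Setoid (CommutativeMonoid.setoid M)

  -- With p_j = (q^j;q⁵) and inverse i_j, multiplication by all five i_j removes the Euler product
  -- on the left; on the right it cancels p₁ p₄ p₅ and leaves i₂ i₃. Only the invertibility of the
  -- p_j enters, so this is a fact about commutative monoids.
  divide-out : ∀ L T p₁ p₂ p₃ p₄ p₅ i₁ i₂ i₃ i₄ i₅ →
    p₁ ∙ i₁ ≈ ε → p₂ ∙ i₂ ≈ ε → p₃ ∙ i₃ ≈ ε → p₄ ∙ i₄ ≈ ε → p₅ ∙ i₅ ≈ ε →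
    (((((ε ∙ p₁) ∙ p₂) ∙ p₃) ∙ p₄) ∙ p₅) ∙ L ≈ T ∙ ((p₁ ∙ p₄) ∙ p₅) → L ≈ (T ∙ i₂) ∙ i₃
  divide-out L T p₁ p₂ p₃ p₄ p₅ i₁ i₂ i₃ i₄ i₅ u₁ u₂ u₃ u₄ u₅ hyp = begin
    L
      ≈⟨ identityʳ L ⟨
    L ∙ ε
      ≈⟨ ∙-congˡ (unit (unit (unit (unit u₁ u₂) u₃) u₄) u₅) ⟨
    L ∙ (((((p₁ ∙ i₁) ∙ (p₂ ∙ i₂)) ∙ (p₃ ∙ i₃)) ∙ (p₄ ∙ i₄)) ∙ (p₅ ∙ i₅))
      ≈⟨ solve 11 (λ l p₁ p₂ p₃ p₄ p₅ i₁ i₂ i₃ i₄ i₅ →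
           l ⊗ (((((p₁ ⊗ i₁) ⊗ (p₂ ⊗ i₂)) ⊗ (p₃ ⊗ i₃)) ⊗ (p₄ ⊗ i₄)) ⊗ (p₅ ⊗ i₅))
           ≋ ((((((id ⊗ p₁) ⊗ p₂) ⊗ p₃) ⊗ p₄) ⊗ p₅) ⊗ l) ⊗ ((((i₁ ⊗ i₂) ⊗ i₃) ⊗ i₄) ⊗ i₅))
           ≈-refl L p₁ p₂ p₃ p₄ p₅ i₁ i₂ i₃ i₄ i₅ ⟩
    ((((((ε ∙ p₁) ∙ p₂) ∙ p₃) ∙ p₄) ∙ p₅) ∙ L) ∙ ((((i₁ ∙ i₂) ∙ i₃) ∙ i₄) ∙ i₅)
      ≈⟨ ∙-congʳ hyp ⟩
    (T ∙ ((p₁ ∙ p₄) ∙ p₅)) ∙ ((((i₁ ∙ i₂) ∙ i₃) ∙ i₄) ∙ i₅)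
      ≈⟨ solve 9 (λ t p₁ p₄ p₅ i₁ i₂ i₃ i₄ i₅ →
           (t ⊗ ((p₁ ⊗ p₄) ⊗ p₅)) ⊗ ((((i₁ ⊗ i₂) ⊗ i₃) ⊗ i₄) ⊗ i₅)
           ≋ ((t ⊗ i₂) ⊗ i₃) ⊗ (((p₁ ⊗ i₁) ⊗ (p₄ ⊗ i₄)) ⊗ (p₅ ⊗ i₅)))
           ≈-refl T p₁ p₄ p₅ i₁ i₂ i₃ i₄ i₅ ⟩
    ((T ∙ i₂) ∙ i₃) ∙ (((p₁ ∙ i₁) ∙ (p₄ ∙ i₄)) ∙ (p₅ ∙ i₅))
      ≈⟨ ∙-congˡ (unit (unit u₁ u₄) u₅) ⟩
    ((T ∙ i₂) ∙ i₃) ∙ ε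
      ≈⟨ identityʳ ((T ∙ i₂) ∙ i₃) ⟩
    (T ∙ i₂) ∙ i₃ ∎
    where
    unit : ∀ {f g} → f ≈ ε → g ≈ ε → f ∙ g ≈ ε
    unit f≈ε g≈ε = ≈-trans (∙-cong f≈ε g≈ε) (identityˡ ε)

lhs≗rhs : ∀ a → (∀ n → a n ≡ term n) → lhsSeries a ≗ rhsSeries
lhs≗rhs a a≡term = divide-out ⊛-commutativeMonoid (lhsSeries a) Theta₇.thetaProduct
  (poch 1 5) (poch 2 5) (poch 3 5) (poch 4 5) (poch 5 5)
  (invPoch 1 5) (invPoch 2 5) (invPoch 3 5) (invPoch 4 5) (invPoch 5 5)
  (poch-inverse 0 5) (poch-inverse 1 5) (poch-inverse 2 5) (poch-inverse 3 5) (poch-inverse 4 5)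
  (λ N → trans (⊛-congʳ (lhsSeries a) (λ M → sym (euler-mod-5 M)) N) (euler-⊛-lhs a a≡term N))

theorem6 : (a : ℕ → ℕ)
    → (∀ m n → m ℕ.< n → a m ℕ.< a n)
    → (∀ m → IsSquare (840 ℕ.* m ℕ.+ 169) ⇔ (∃ λ n → a n ≡ m))
    → ∀ N → lhsSeries a N ≡ rhsSeries N
theorem6 a a-inc a-image = lhs≗rhs a (sequence-≡-term a a-inc a-image)
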